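{- Let $k \leq n$ be positive integers and let $\lambda = (\lambda_1 \geq \cdots \geq \lambda_s\ge0)$ be a partition of $k$ with $s$ parts. The set $\{ \delta_{\sigma} : \sigma \in \mathcal{OP}_{n,\lambda} \}$ is a harmonic basis of $R_{n,\lambda}$; that is, it is a basis of the harmonic space $V_{n,\lambda}$ (and hence its image in $R_{n,\lambda}$ is a basis of $R_{n,\lambda}$).
   Context: A partition of $k$ with $s$ parts is a weakly decreasing sequence of $s$ nonnegative integers (trailing zeros allowed) summing to $k$; $\lambda'=(\lambda'_1,\dots,\lambda'_n)$ is its conjugate padded with zeros. $e_d(S)$ is the degree $d$ elementary symmetric polynomial in $\{x_i:i\in S\}$ (zero if $d>|S|$). $I_{n,\lambda}\subseteq\mathbb{Q}[x_1,\dots,x_n]$ is generated by $x_1^s,\dots,x_n^s$ and all $e_d(S)$ with $S\subseteq[n]$, $d>|S|-\lambda'_n-\cdots-\lambda'_{n-|S|+1}$; $R_{n,\lambda}=\mathbb{Q}[x_1,\dots,x_n]/I_{n,\lambda}$. With $f\odot g=f(\partial/\partial x_1,\dots,\partial/\partial x_n)(g)$ and $\langle f,g\rangle$ the constant term of $f\odot g$, $V_{n,\lambda}=\{g:\langle f,g\rangle=0\ \forall f\in I_{n,\lambda}\}$; one has $\mathbb{Q}[x_1,\dots,x_n]=V_{n,\lambda}\oplus I_{n,\lambda}$. $\mathcal{OP}_{n,\lambda}$: sequences $\sigma=(B_1\mid\cdots\mid B_s)$ of subsets with $[n]=\bigsqcup B_i$, $|B_i|\ge\lambda_i$. Container: column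 $i$ has $\lambda_i$ top-justified boxes, rows numbered from the top; the box in row $j$ of column $i$ holds the $(\lambda_i-j+1)$-th smallest element of $B_i$; the remaining elements of $B_i$ are floating in block $i$. Coinversions $(i,j)$, $i<j$: (a) $i$ floating, $j$ in a block to the right, $j$ in container row 1; (b) $i$ not floating, $j$ in a block to the right, same container row; (c) $i$ not floating, $j$ in a block to the left, $j$ in the row directly below that of $i$. $c_i$ = number of $j>i$ with $(i,j)$ a coinversion, plus $p-1$ if $i$ is floating in block $p$; $\mathtt{code}(\sigma)=(c_1,\dots,c_n)$. $\mathtt{maxcode}(\sigma)=(a_1,\dots,a_n)$: $a_i=s-1$ if $i$ floating; $a_i=\lambda'_j-m$ if $i$ is the $m$-th smallest entry of container row $j$. $T(\sigma)$ is the column-strict injective tableau of shape $\lambda$ whose $j$-th column consists of the entries of container row $j$ of $\sigma$, increasing downward. For a column-strict injective tableau $T$ with entries in $[n]$: $\mathbf{x}(T)=\prod x_i^{b_i}$, $b_i$ = number of boxes below $i$ in its column if $i\in T$, else $s-1$; $C_T$ = permutations of $[n]$ stabilizing each column's entry set and fixing entries not in $T$; $\delta_T=\sum_{w\in C_T}\mathrm{sign}(w)\,w\cdot\mathbf{x}(T)$ ($\mathfrak{S}_n$ permutes subscripts). Finally $\delta_\sigma=(x_1^{a_1-c_1}\cdots x_n^{a_n-c_n})\odot\delta_{T(\sigma)}$ where $(c_i)=\mathtt{code}(\sigma)$, $(a_i)=\mathtt{maxcode}(\sigma)$ (one has $c_i\le a_i$). -}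

module Defs where

open import Data.Nat as ℕ using (ℕ; zero; suc; _≤_; _<_; _∸_; _≤ᵇ_; _<ᵇ_; _≡ᵇ_)
open import Data.Nat.Combinatorics using (_P_)
open import Data.Nat.ListAction using (sum; product)
open import Data.Nat.DivMod using (_%_)
open import Data.Integer using (+_)
open import Data.Rational as ℚ using (ℚ; 0ℚ; 1ℚ)
open import Data.Fin as Fin using (Fin; toℕ)
open import Data.Fin.Subset using (Subset; ∣_∣)
open import Data.Vec as Vec using (Vec; lookup; replicate; tabulate; zipWith)
import Data.Vec.Properties as VecP
open import Data.List as List using (List; []; _∷_; _++_; map; concatMap; foldr; filterᵇ)
open import Data.List.Relation.Unary.All using (All)
open import Data.List.Relation.Unary.Unique.Propositional using (Unique)
open import Data.Bool using (Bool; true; false; if_then_else_; _∧_; _∨_; not)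
open import Data.Product using (Σ; _×_; _,_; proj₁; proj₂)
open import Data.Maybe using (Maybe; just; nothing)
open import Relation.Nullary.Decidable using (⌊_⌋)
open import Relation.Binary.PropositionalEquality using (_≡_)

count : ∀ {n} → (Fin n → Bool) → ℕ
count {n} p = List.length (filterᵇ p (List.allFin n))

_==F_ : ∀ {n} → Fin n → Fin n → Bool
i ==F j = ⌊ i Fin.≟ j ⌋

_<F_ : ∀ {n} → Fin n → Fin n → Bool
i <F j = toℕ i <ᵇ toℕ j

-- Polynomials in x_1..x_n over ℚ, as formal finite sums of terms
-- c · x^e  (e an exponent vector).  Two polynomials are equal (≈ₚ)
-- when all their coefficients agree.

Mon : ℕ → Set
Mon n = Vec ℕ n

Poly : ℕ → Set
Poly n = List (ℚ × Mon n)

coeff : ∀ {n} → Poly n → Mon n → ℚ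
coeff p m = foldr (λ t acc → if ⌊ VecP.≡-dec ℕ._≟_ (proj₂ t) m ⌋
                              then proj₁ t ℚ.+ acc else acc) 0ℚ p

infix 4 _≈ₚ_
_≈ₚ_ : ∀ {n} → Poly n → Poly n → Set
p ≈ₚ q = ∀ m → coeff p m ≡ coeff q m

0ₚ : ∀ {n} → Poly n
0ₚ = []

_+ₚ_ : ∀ {n} → Poly n → Poly n → Poly n
_+ₚ_ = _++_

_*ₚ_ : ∀ {n} → Poly n → Poly n → Poly n
p *ₚ q = concatMap (λ t → map (λ u → (proj₁ t ℚ.* proj₁ u , zipWith ℕ._+_ (proj₂ t) (proj₂ u))) q) p

scaleₚ : ∀ {n} → ℚ → Poly n → Poly n
scaleₚ c p = map (λ t → (c ℚ.* proj₁ t , proj₂ t)) p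

monomial : ∀ {n} → Mon n → Poly n
monomial e = (1ℚ , e) ∷ []

1ₚ : ∀ {n} → Poly n
1ₚ {n} = monomial (replicate n 0)

xpow : ∀ {n} → Fin n → ℕ → Poly n
xpow i d = monomial (tabulate (λ j → if i ==F j then d else 0))

sumₚ : ∀ {n} → List (Poly n) → Poly n
sumₚ = foldr _+ₚ_ 0ₚ

prodₚ : ∀ {n} → List (Poly n) → Poly n
prodₚ = foldr _*ₚ_ 1ₚ

ℕ→ℚ : ℕ → ℚ
ℕ→ℚ k = + k ℚ./ 1

-- ∂^e (x^f) = (∏ᵢ fᵢ(fᵢ-1)⋯(fᵢ-eᵢ+1)) x^(f-e)   (zero when some eᵢ > fᵢ)
dmon : ∀ {n} → Mon n → Mon n → ℚ × Mon n
dmon e f = (ℕ→ℚ (product (Vec.toList (zipWith _P_ f e))) , zipWith _∸_ f e)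

-- f ⊙ g = f(∂/∂x₁,…,∂/∂xₙ)(g)
_⊙_ : ∀ {n} → Poly n → Poly n → Poly n
f ⊙ g = concatMap (λ t → map (λ u → (proj₁ t ℚ.* proj₁ u ℚ.* proj₁ (dmon (proj₂ t) (proj₂ u))
                                     , proj₂ (dmon (proj₂ t) (proj₂ u)))) g) f

⟨_,_⟩ : ∀ {n} → Poly n → Poly n → ℚ
⟨_,_⟩ {n} f g = coeff (f ⊙ g) (replicate n 0)

choose : ∀ {A : Set} → ℕ → List A → List (List A)
choose zero    xs       = [] ∷ []
choose (suc d) []       = []
choose (suc d) (x ∷ xs) = map (x ∷_) (choose d xs) ++ choose (suc d) xs

elems : ∀ {n} → Subset n → List (Fin n)
elems {n} S = filterᵇ (λ i → lookup S i) (List.allFin n)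

esym : ∀ {n} → ℕ → Subset n → Poly n
esym d S = sumₚ (map (λ T → prodₚ (map (λ i → xpow i 1) T)) (choose d (elems S)))

IsPartition : ∀ {s} → ℕ → Vec ℕ s → Set
IsPartition {s} k lam = (∀ (i j : Fin s) → toℕ i ≤ toℕ j → lookup lam j ≤ lookup lam i)
                      × Vec.sum lam ≡ k

-- λ'_j (j ≥ 1) = #{ i : λ_i ≥ j }  (conjugate, padded with zeros)
conj : ∀ {s} → Vec ℕ s → ℕ → ℕ
conj lam j = count (λ i → j ≤ᵇ lookup lam i)

tailConj : ∀ {s} → ℕ → Vec ℕ s → ℕ → ℕ
tailConj n lam m = sum (map (λ t → conj lam (n ∸ t)) (List.upTo m))

data Gen (n s : ℕ) (lam : Vec ℕ s) : Set where
  powGen : Fin n → Gen n s lam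
  -- e_d(S) with d > |S| - (λ'_n + ⋯ + λ'_{n-|S|+1})
  eGen   : (S : Subset n) (d : ℕ) → ∣ S ∣ < d ℕ.+ tailConj n lam ∣ S ∣ → Gen n s lam

genPoly : ∀ {n s lam} → Gen n s lam → Poly n
genPoly {s = s} (powGen i) = xpow i s
genPoly (eGen S d _)       = esym d S

InIdeal : (n s : ℕ) (lam : Vec ℕ s) → Poly n → Set
InIdeal n s lam f = Σ (List (Poly n × Gen n s lam))
  λ L → f ≈ₚ sumₚ (map (λ t → proj₁ t *ₚ genPoly (proj₂ t)) L)

InV : (n s : ℕ) (lam : Vec ℕ s) → Poly n → Set
InV n s lam g = ∀ f → InIdeal n s lam f → ⟨ f , g ⟩ ≡ 0ℚ

-- Ordered set partitions OP_{n,λ}: blk assigns each element of [n]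
-- (encoded as Fin n) its block (Fin s), i.e. σ = (B_1 | ⋯ | B_s).

blockSize : ∀ {n s} → Vec (Fin s) n → Fin s → ℕ
blockSize blk b = count (λ x → lookup blk x ==F b)

record OP (n s : ℕ) (lam : Vec ℕ s) : Set where
  field
    blk : Vec (Fin s) n
    big : ∀ b → lookup lam b ≤ blockSize blk b
open OP public

-- position of an element: floating, or in the container in row j (j ≥ 1)
data Pos : Set where
  floating : Pos
  box      : ℕ → Pos

inRow : Pos → ℕ → Bool
inRow floating _ = false
inRow (box r) j  = r ≡ᵇ j

isFloating : Pos → Bool
isFloating floating = true
isFloating (box _)  = false

module _ {n s : ℕ} {lam : Vec ℕ s} (σ : OP n s lam) where

  bl : Fin n → Fin s
  bl x = lookup (blk σ) x

  rank : Fin n → ℕ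
  rank x = count (λ y → (y <F x) ∧ (bl y ==F bl x))

  -- the box in row j of column b holds the (λ_b - j + 1)-th smallest
  -- element of B_b; the elements beyond the λ_b smallest float
  pos : Fin n → Pos
  pos x = if rank x <ᵇ lookup lam (bl x)
          then box (lookup lam (bl x) ∸ rank x) else floating

  -- (x,y) is a coinversion (to be used for x < y)
  coinv : Fin n → Fin n → Bool
  coinv x y with pos x
  ... | floating = (bl x <F bl y) ∧ inRow (pos y) 1
  ... | box r    = ((bl x <F bl y) ∧ inRow (pos y) r)
                 ∨ ((bl y <F bl x) ∧ inRow (pos y) (suc r))

  code : Fin n → ℕ
  code x = count (λ y → (x <F y) ∧ coinv x y)
           ℕ.+ (if isFloating (pos x) then toℕ (bl x) else 0)

  maxcode : Fin n → ℕ
  maxcode x with pos x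
  ... | floating = s ∸ 1
  ... | box j    = conj lam j ∸ suc (count (λ y → (y <F x) ∧ inRow (pos y) j))

  -- T(σ): column j of T consists of the entries of container row j
  -- (increasing downward).  A column-strict injective tableau is
  -- recorded by the column (if any) in which each element of [n] sits.
  tab : Fin n → Maybe ℕ
  tab x with pos x
  ... | floating = nothing
  ... | box j    = just j

-- δ_T for a column-strict injective tableau T (given by column map)

module _ {n : ℕ} (s : ℕ) (T : Fin n → Maybe ℕ) where

  sameCol : Maybe ℕ → Maybe ℕ → Bool
  sameCol (just i) (just j) = i ≡ᵇ j
  sameCol _        _        = false

  -- b_i: number of boxes below i in its column (entries increase
  -- downward, so these are the larger entries of that column); s-1 if i ∉ T
  expT : Fin n → ℕ
  expT x with T x
  ... | nothing = s ∸ 1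
  ... | just j  = count (λ y → (x <F y) ∧ sameCol (T y) (just j))

  allVecs : ∀ {A : Set} → List A → (m : ℕ) → List (Vec A m)
  allVecs as zero    = Vec.[] ∷ []
  allVecs as (suc m) = concatMap (λ a → map (a Vec.∷_) (allVecs as m)) as

  isPerm : Vec (Fin n) n → Bool
  isPerm w = sum (map (λ i → count (λ j → (i <F j) ∧ (lookup w i ==F lookup w j)))
                     (List.allFin n)) ≡ᵇ 0

  inCT : Vec (Fin n) n → Bool
  inCT w = count (λ x → not (ok x)) ≡ᵇ 0
    where
    ok : Fin n → Bool
    ok x with T x
    ... | nothing = lookup w x ==F x
    ... | just j  = sameCol (T (lookup w x)) (just j)

  CT : List (Vec (Fin n) n)
  CT = filterᵇ (λ w → isPerm w ∧ inCT w) (allVecs (List.allFin n) n)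

  inversions : Vec (Fin n) n → ℕ
  inversions w = sum (map (λ i → count (λ j → (i <F j) ∧ (lookup w j <F lookup w i)))
                               (List.allFin n))

  sign : Vec (Fin n) n → ℚ
  sign w = if (inversions w % 2) ≡ᵇ 0 then 1ℚ else ℚ.- 1ℚ

  actXT : Vec (Fin n) n → Poly n
  actXT w = prodₚ (map (λ i → xpow (lookup w i) (expT i)) (List.allFin n))

  δT : Poly n
  δT = sumₚ (map (λ w → scaleₚ (sign w) (actXT w)) CT)

δσ : ∀ {n s lam} → OP n s lam → Poly n
δσ {n} {s} σ = monomial (tabulate (λ i → maxcode σ i ∸ code σ i)) ⊙ δT s (tab σ)

lincomb : ∀ {n s lam} → List (ℚ × OP n s lam) → Poly n
lincomb L = sumₚ (map (λ t → scaleₚ (proj₁ t) (δσ (proj₂ t))) L)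

IsHarmonicBasis : (n s : ℕ) (lam : Vec ℕ s) → Set
IsHarmonicBasis n s lam =
    (∀ (σ : OP n s lam) → InV n s lam (δσ σ))
  × (∀ (L : List (ℚ × OP n s lam)) → Unique (map (λ t → blk (proj₂ t)) L)
       → lincomb L ≈ₚ 0ₚ → All (λ t → proj₁ t ≡ 0ℚ) L)
  × (∀ (g : Poly n) → InV n s lam g
       → Σ (List (ℚ × OP n s lam)) λ L → g ≈ₚ lincomb L)

{-# OPTIONS --safe #-}

-- The δ_σ and V are compared through leading exponents in the lexicographic order with x₁ > x₂ > ⋯. Passing to the
-- divided power coefficients F m = m! · [x^m] g turns membership in V into linear recurrences for F, and
-- differentiation into a shift of m. The leading exponent of δ_T is the exponent of x(T), which is maxcode(σ) for
-- T = T(σ), so the leading exponent of δ_σ is code(σ). Conversely the leading exponent of any element of V is a code,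
-- by induction on n: the entry of 1 in a code is the rank of the block p containing 1 in a linear order of the blocks,
-- so it takes each value d < s exactly once, and the top coefficient in x₁, of degree d, of an element of V is
-- harmonic for the composition obtained from λ by removing a box from the block of rank d. For this induction λ has to
-- range over arbitrary compositions. Since codes are distinct, the δ_σ are triangular, hence a basis, once they are
-- known to lie in V; this follows from the antisymmetry of δ_T in the columns of T.

module Submission where

open import Defs
import Algebra.Properties.CommutativeMonoid.Sum
import Algebra.Properties.Group
open import Data.Bool using (Bool; true; false; if_then_else_; _∧_; _∨_; not; T)
open import Data.Bool.Properties using (not-involutive; ∧-zeroʳ)
open import Data.Empty using (⊥; ⊥-elim)
open import Data.Fin as Fin using (Fin; zero; suc; toℕ)
import Data.Fin.Properties as FinP
open import Data.Fin.Permutation using (Permutation′; permutation)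
open import Data.Fin.Subset using (Subset; ∣_∣)
import Data.Fin.Subset.Properties as SubsetP
import Data.Integer as ℤ
import Data.Integer.Properties as ℤP
open import Data.List as List using (List; []; _∷_; _++_; map; concatMap; filterᵇ)
import Data.List.Properties as ListP
open import Data.List.Membership.Propositional using (_∈_; lose)
open import Data.List.Membership.Propositional.Properties using (∈-++⁺ˡ; ∈-++⁺ʳ; ∈-map⁺; ∈-deduplicate⁺; ∈-concatMap⁺; ∈-allFin)
open import Data.List.Relation.Unary.All as All using (All; []; _∷_)
open import Data.List.Relation.Unary.Any using (here; there)
open import Data.List.Relation.Unary.AllPairs using ([]; _∷_)
open import Data.List.Relation.Unary.Unique.Propositional using (Unique)
import Data.List.Relation.Unary.Unique.DecPropositional.Properties as UniqueP
open import Data.Maybe using (Maybe; just; nothing)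
open import Data.Nat as ℕ using (ℕ; zero; suc; _+_; _*_; _∸_; _≤_; _<_; _≤ᵇ_; _<ᵇ_; _≡ᵇ_; z≤n; s≤s; _!)
open import Data.Nat.Combinatorics using (_P_; nPk≡n!/[n∸k]!; k>n⇒nPk≡0)
open import Data.Nat.DivMod using (_%_; _/_; m/n*n≡m; [m+n]%n≡m%n)
open import Data.Nat.Divisibility using (m≤n⇒m!∣n!)
open import Data.Nat.Induction using (<-wellFounded)
open import Data.Nat.ListAction using (sum; product)
open import Data.Nat.ListAction.Properties using (sum-++)
open import Data.Nat.Properties
import Data.Nat.Solver
open import Data.Product using (∃; _×_; _,_; proj₁; proj₂)
open import Data.Rational as ℚ using (ℚ; 0ℚ; 1ℚ)
import Data.Rational.Properties as ℚP
import Data.Rational.Solver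
import Data.Rational.Unnormalised as ℚᵘ
import Data.Rational.Unnormalised.Properties as ℚᵘP
open import Data.Sum using (_⊎_; inj₁; inj₂)
open import Data.Unit using (tt)
open import Data.Vec as Vec using (Vec; []; _∷_; lookup; tabulate; zipWith; replicate)
import Data.Vec.Properties as VecP
open import Data.Vec.Relation.Binary.Lex.Strict as Lex using (Lex-<; this; next)
open import Function using (_∘_; id; case_of_)
open import Induction.WellFounded using (Acc; acc; WellFounded)
open import Relation.Binary.Definitions using (tri<; tri≈; tri>)
open import Relation.Binary.PropositionalEquality
open import Relation.Nullary using (¬_; Dec; yes; no; contradiction)
open import Relation.Nullary.Decidable using (⌊_⌋)

-- No dimension formula for R enters: spanning is obtained by elimination. Some δ_σ shares the
-- leading exponent of a given element of V, and subtracting a multiple of it lowers that exponent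
-- in a well-founded order. The order of the blocks is dictated by the coinversions of the smallest
-- element. It fits the ideal because every block with more than u boxes precedes every block with
-- at most u. Hence a block p with λ_p ≤ u has rank at least c, the number of parts exceeding u, and
-- c factors x₁ can be traded for c degrees by e_{r+1}(S ∪ 1) = x₁ e_r(S) + e_{r+1}(S). Removing a
-- box from p may destroy monotonicity, so the generators are described by `excess`, which is
-- symmetric in the parts. Membership of δ_T in V rests on minimality of degree: a polynomial
-- antisymmetric in h variables has degree at least 0 + 1 + ⋯ + (h-1) in them, and δ_T attains this
-- in each of its columns. For a generator e_d(S), e_d(S) ⊙ δ_T is still antisymmetric in the
-- columns contained in S, while the bound on d forces every monomial of e_d(S) to lower the degree
-- in one of them.

module NSum = Algebra.Properties.CommutativeMonoid.Sum +-0-commutativeMonoid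
module QSum = Algebra.Properties.CommutativeMonoid.Sum ℚP.+-0-commutativeMonoid

-- Counting by finite sums

⟦_⟧ : Bool → ℕ
⟦ true ⟧  = 1
⟦ false ⟧ = 0

∑ : ∀ {n} → (Fin n → ℕ) → ℕ
∑ = NSum.sum

true≢false : {b : Bool} → b ≡ true → b ≡ false → ⊥
true≢false refl ()

==F-refl : ∀ {n} (i : Fin n) → (i ==F i) ≡ true
==F-refl i with i Fin.≟ i
... | yes _  = refl
... | no i≢i = contradiction refl i≢i

==F-≢ : ∀ {n} {i j : Fin n} → i ≢ j → (i ==F j) ≡ false
==F-≢ {i = i} {j} i≢j with i Fin.≟ j
... | yes eq = contradiction eq i≢j
... | no _   = refl

==F⇒≡ : ∀ {n} {i j : Fin n} → (i ==F j) ≡ true → i ≡ j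
==F⇒≡ {i = i} {j} eq with i Fin.≟ j
... | yes i≡j = i≡j
==F⇒≡ () | no _

==F-inj : ∀ {m n} (f : Fin m → Fin n) → (∀ {i j} → f i ≡ f j → i ≡ j) → ∀ i j → (f i ==F f j) ≡ (i ==F j)
==F-inj f inj i j with i Fin.≟ j
... | yes refl = ==F-refl (f i)
... | no i≢j   = ==F-≢ (i≢j ∘ inj)

==F-sym : ∀ {n} (i j : Fin n) → (i ==F j) ≡ (j ==F i)
==F-sym i j with i Fin.≟ j
... | yes refl = sym (==F-refl i)
... | no i≢j   = sym (==F-≢ (i≢j ∘ sym))

==F-suc : ∀ {n} (i j : Fin n) → (suc i ==F suc j) ≡ (i ==F j)
==F-suc = ==F-inj suc FinP.suc-injective

≡ᵇ⇒≡′ : ∀ m n → (m ≡ᵇ n) ≡ true → m ≡ n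
≡ᵇ⇒≡′ m n eq = ≡ᵇ⇒≡ m n (subst T (sym eq) tt)

≡ᵇ-refl : ∀ m → (m ≡ᵇ m) ≡ true
≡ᵇ-refl zero    = refl
≡ᵇ-refl (suc m) = ≡ᵇ-refl m

<⇒<ᵇ′ : ∀ {m n} → m < n → (m <ᵇ n) ≡ true
<⇒<ᵇ′ {m} {n} lt with m <ᵇ n | <⇒<ᵇ lt
... | true | _ = refl

<ᵇ⇒<′ : ∀ m n → (m <ᵇ n) ≡ true → m < n
<ᵇ⇒<′ m n eq = <ᵇ⇒< m n (subst T (sym eq) tt)

≮⇒<ᵇ : ∀ {m n} → ¬ m < n → (m <ᵇ n) ≡ false
≮⇒<ᵇ {m} {n} m≮n with m <ᵇ n in eq
... | true  = contradiction (<ᵇ⇒<′ m n eq) m≮n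
... | false = refl

<ᵇ⇒≮ : ∀ m n → (m <ᵇ n) ≡ false → ¬ m < n
<ᵇ⇒≮ m n eq lt = true≢false (<⇒<ᵇ′ lt) eq

∧-true : ∀ a b → a ∧ b ≡ true → a ≡ true × b ≡ true
∧-true true true _ = refl , refl

⟦∧⟧ : ∀ a b → ⟦ a ∧ b ⟧ ≡ ⟦ a ⟧ * ⟦ b ⟧
⟦∧⟧ true  b = sym (+-identityʳ ⟦ b ⟧)
⟦∧⟧ false b = refl

⟦⟧≤1 : ∀ a → ⟦ a ⟧ ≤ 1
⟦⟧≤1 true  = ≤-refl
⟦⟧≤1 false = z≤n

*-exchange : ∀ x y z → x * (y * z) ≡ y * (x * z)
*-exchange = solve 3 (λ x y z → x :* (y :* z) := y :* (x :* z)) refl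
  where open Data.Nat.Solver.+-*-Solver using (solve; _:*_; _:=_)

∑-cong : ∀ {n} {f g : Fin n → ℕ} → (∀ i → f i ≡ g i) → ∑ f ≡ ∑ g
∑-cong = NSum.sum-cong-≗

∑-mono : ∀ {n} {f g : Fin n → ℕ} → (∀ i → f i ≤ g i) → ∑ f ≤ ∑ g
∑-mono {zero}  h = z≤n
∑-mono {suc n} h = +-mono-≤ (h zero) (∑-mono (h ∘ suc))

∑-mono-< : ∀ {n} {f g : Fin n → ℕ} → (∀ i → f i ≤ g i) → ∀ i → f i < g i → ∑ f < ∑ g
∑-mono-< h zero    lt = +-mono-<-≤ lt (∑-mono (h ∘ suc))
∑-mono-< h (suc i) lt = +-mono-≤-< (h zero) (∑-mono-< (h ∘ suc) i lt)

∑-zero : ∀ {n} {f : Fin n → ℕ} → (∀ i → f i ≡ 0) → ∑ f ≡ 0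
∑-zero {zero}  h = refl
∑-zero {suc n} h = cong₂ _+_ (h zero) (∑-zero (h ∘ suc))

∑≡0⇒≡0 : ∀ {n} (f : Fin n → ℕ) → ∑ f ≡ 0 → ∀ i → f i ≡ 0
∑≡0⇒≡0 f eq zero    = m+n≡0⇒m≡0 (f zero) eq
∑≡0⇒≡0 f eq (suc i) = ∑≡0⇒≡0 (f ∘ suc) (m+n≡0⇒n≡0 (f zero) eq) i

∑-+ : ∀ {n} (f g : Fin n → ℕ) → ∑ (λ i → f i + g i) ≡ ∑ f + ∑ g
∑-+ = NSum.∑-distrib-+

∑-comm : ∀ {m n} (f : Fin m → Fin n → ℕ) → ∑ (λ i → ∑ (f i)) ≡ ∑ (λ j → ∑ λ i → f i j)
∑-comm = NSum.∑-comm

∑-*ˡ : ∀ {n} c (f : Fin n → ℕ) → ∑ (λ i → c * f i) ≡ c * ∑ f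
∑-*ˡ {zero}  c f = sym (*-zeroʳ c)
∑-*ˡ {suc n} c f = trans (cong (c * f zero +_) (∑-*ˡ c (f ∘ suc))) (sym (*-distribˡ-+ c (f zero) _))

∑-one : ∀ n → ∑ {n} (λ _ → 1) ≡ n
∑-one zero    = refl
∑-one (suc n) = cong suc (∑-one n)

∑-δ : ∀ {n} (f : Fin n → ℕ) j → ∑ (λ i → ⟦ i ==F j ⟧ * f i) ≡ f j
∑-δ {suc n} f zero    =
  trans (cong₂ _+_ (+-identityʳ (f zero)) (∑-zero {f = λ i → ⟦ suc i ==F zero ⟧ * f (suc i)} λ _ → refl)) (+-identityʳ (f zero))
∑-δ {suc n} f (suc j) =
  trans (∑-cong {f = λ i → ⟦ suc i ==F suc j ⟧ * f (suc i)} λ i → cong (λ b → ⟦ b ⟧ * f (suc i)) (==F-suc i j)) (∑-δ (f ∘ suc) j)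

∑-δ′ : ∀ {n} (f : Fin n → ℕ) j → ∑ (λ i → ⟦ j ==F i ⟧ * f i) ≡ f j
∑-δ′ f j = trans (∑-cong λ i → cong (λ b → ⟦ b ⟧ * f i) (==F-sym j i)) (∑-δ f j)

∑-term : ∀ {n} (f : Fin n → ℕ) i → f i ≤ ∑ f
∑-term f zero    = m≤m+n _ _
∑-term f (suc i) = ≤-trans (∑-term (f ∘ suc) i) (m≤n+m _ _)

length-filterᵇ-tabulate : ∀ {A : Set} {n} (p : A → Bool) (f : Fin n → A) →
  List.length (filterᵇ p (List.tabulate f)) ≡ ∑ (λ i → ⟦ p (f i) ⟧)
length-filterᵇ-tabulate {n = zero}  p f = refl
length-filterᵇ-tabulate {n = suc n} p f with p (f zero)
... | true  = cong suc (length-filterᵇ-tabulate p (f ∘ suc))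
... | false = length-filterᵇ-tabulate p (f ∘ suc)

-- The definitions count by lengths of filtered lists; as sums, counts can be split, compared
-- termwise and exchanged.
count-∑ : ∀ {n} (p : Fin n → Bool) → count p ≡ ∑ (λ i → ⟦ p i ⟧)
count-∑ p = length-filterᵇ-tabulate p id

count-cong : ∀ {n} {p q : Fin n → Bool} → (∀ i → p i ≡ q i) → count p ≡ count q
count-cong {p = p} {q} h = trans (count-∑ p) (trans (∑-cong λ i → cong ⟦_⟧ (h i)) (sym (count-∑ q)))

count-suc : ∀ {n} (p : Fin (suc n) → Bool) → count p ≡ ⟦ p zero ⟧ + count (p ∘ suc)
count-suc p = trans (count-∑ p) (cong (⟦ p zero ⟧ +_) (sym (count-∑ (p ∘ suc))))

count-false : ∀ {n} {p : Fin n → Bool} → (∀ i → p i ≡ false) → count p ≡ 0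
count-false {p = p} h = trans (count-∑ p) (∑-zero λ i → cong ⟦_⟧ (h i))

count≡0⇒false : ∀ {n} (p : Fin n → Bool) → (count p ≡ᵇ 0) ≡ true → ∀ i → p i ≡ false
count≡0⇒false p eq i with p i | ∑≡0⇒≡0 (λ j → ⟦ p j ⟧) (trans (sym (count-∑ p)) (≡ᵇ⇒≡′ _ 0 eq)) i
... | false | _ = refl

find : ∀ {n} (p : Fin n → Bool) → (∀ i → p i ≡ false) ⊎ ∃ λ i → p i ≡ true
find {zero}  p = inj₁ λ ()
find {suc n} p with p zero in eq | find (p ∘ suc)
... | true  | _            = inj₂ (zero , eq)
... | false | inj₂ (i , h) = inj₂ (suc i , h)
... | false | inj₁ h       = inj₁ λ { zero → eq ; (suc i) → h i }

count≢0⇒true : ∀ {n} (p : Fin n → Bool) → (count p ≡ᵇ 0) ≡ false → ∃ λ i → p i ≡ true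
count≢0⇒true p eq with find p
... | inj₂ w = w
... | inj₁ h = ⊥-elim (true≢false (cong (_≡ᵇ 0) (count-false h)) eq)

sum-map-tabulate : ∀ {A : Set} {n} (f : A → ℕ) (g : Fin n → A) → sum (map f (List.tabulate g)) ≡ ∑ (f ∘ g)
sum-map-tabulate {n = zero}  f g = refl
sum-map-tabulate {n = suc n} f g = cong (f (g zero) +_) (sum-map-tabulate f (g ∘ suc))

sum-allFin : ∀ {n} (f : Fin n → ℕ) → sum (map f (List.allFin n)) ≡ ∑ f
sum-allFin f = sum-map-tabulate f id

∑-at-most-one : ∀ {n} (p : Fin n → Bool) → (∀ {i j} → p i ≡ true → p j ≡ true → i ≡ j) → ∑ (λ i → ⟦ p i ⟧) ≤ 1
∑-at-most-one {zero}  p h = z≤n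
∑-at-most-one {suc n} p h with p zero in eq
... | false = ∑-at-most-one (p ∘ suc) λ a b → FinP.suc-injective (h a b)
... | true  = ≤-reflexive (cong suc (∑-zero λ i → cong ⟦_⟧ (none i)))
  where
  none : ∀ i → p (suc i) ≡ false
  none i with p (suc i) in eq′
  ... | false = refl
  ... | true  with () ← h eq eq′

-- If y is missed, then y together with the values of f gives an injection of n + 1 points into n.
injective⇒surjective : ∀ {n} (f : Fin n → Fin n) → (∀ {i j} → f i ≡ f j → i ≡ j) → ∀ y → ∃ λ x → f x ≡ y
injective⇒surjective {n} f inj y with find (λ x → f x ==F y)
... | inj₂ (x , h) = x , ==F⇒≡ h
... | inj₁ h = contradiction (FinP.injective⇒≤ {f = g} g-inj) (<⇒≱ (n<1+n n))
  where
  g : Fin (suc n) → Fin n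
  g zero    = y
  g (suc x) = f x
  miss : ∀ x → f x ≢ y
  miss x eq = true≢false (trans (cong (f x ==F_) (sym eq)) (==F-refl (f x))) (h x)
  g-inj : ∀ {i j} → g i ≡ g j → i ≡ j
  g-inj {zero}  {zero}  eq = refl
  g-inj {zero}  {suc j} eq = contradiction (sym eq) (miss j)
  g-inj {suc i} {zero}  eq = contradiction eq (miss i)
  g-inj {suc i} {suc j} eq = cong suc (inj eq)

vec-ext : ∀ {A : Set} {n} {u v : Vec A n} → (∀ i → lookup u i ≡ lookup v i) → u ≡ v
vec-ext {u = u} {v} h = trans (sym (VecP.tabulate∘lookup u)) (trans (VecP.tabulate-cong h) (VecP.tabulate∘lookup v))

-- Ordered set partitions and their codes

infixl 20 _⊖_
-- Truncation matters: if the part at p is 0, then the smallest element floats in block p and no box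
-- disappears with it.
_⊖_ : ∀ {s} → Vec ℕ s → Fin s → Vec ℕ s
α ⊖ p = Vec.updateAt α p ℕ.pred

lookup-⊖ : ∀ {s} (α : Vec ℕ s) p → lookup (α ⊖ p) p ≡ ℕ.pred (lookup α p)
lookup-⊖ α p = VecP.lookup∘updateAt p α

lookup-⊖-≡ : ∀ {s} (α : Vec ℕ s) {p b} → p ≡ b → lookup (α ⊖ p) b ≡ ℕ.pred (lookup α b)
lookup-⊖-≡ α {p} refl = lookup-⊖ α p

lookup-⊖-≢ : ∀ {s} (α : Vec ℕ s) {p b} → p ≢ b → lookup (α ⊖ p) b ≡ lookup α b
lookup-⊖-≢ α {p} {b} p≢b = VecP.lookup∘updateAt′ b p (p≢b ∘ sym) α

blockSize-∷ : ∀ {n s} (p : Fin s) (w : Vec (Fin s) n) b → blockSize (p ∷ w) b ≡ ⟦ p ==F b ⟧ + blockSize w b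
blockSize-∷ p w b = count-suc (λ x → lookup (p ∷ w) x ==F b)

consOP : ∀ {n s} {α : Vec ℕ s} (p : Fin s) → OP n s (α ⊖ p) → OP (suc n) s α
consOP p τ .blk = p ∷ blk τ
consOP {α = α} p τ .big b rewrite blockSize-∷ p (blk τ) b with p Fin.≟ b
... | yes refl = ≤-trans (suc-pred-≤ (lookup α p)) (s≤s (subst (_≤ _) (lookup-⊖ α p) (big τ p)))
  where
  suc-pred-≤ : ∀ m → m ≤ suc (ℕ.pred m)
  suc-pred-≤ zero    = z≤n
  suc-pred-≤ (suc m) = ≤-refl
... | no p≢b = subst (_≤ _) (lookup-⊖-≢ α p≢b) (big τ b)

tailOP : ∀ {n s} {α : Vec ℕ s} (p : Fin s) (w : Vec (Fin s) n) →
  (∀ b → lookup α b ≤ blockSize (p ∷ w) b) → OP n s (α ⊖ p)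
tailOP p w h .blk = w
tailOP {α = α} p w h .big b with h b
... | hb rewrite blockSize-∷ p w b with p Fin.≟ b
...   | yes refl = subst (_≤ _) (sym (lookup-⊖ α p)) (pred-mono-≤ hb)
...   | no p≢b   = subst (_≤ _) (sym (lookup-⊖-≢ α p≢b)) hb

-- The smallest element of [n] occupies the lowest box of its block p (if there is one), so deleting it leaves an
-- ordered set partition for α ⊖ p in which every other element keeps its position.
data View {n s} {α : Vec ℕ s} : OP (suc n) s α → Set where
  cons : (p : Fin s) (τ : OP n s (α ⊖ p)) {h : ∀ b → lookup α b ≤ blockSize (p ∷ blk τ) b} →
         View (record { blk = p ∷ blk τ ; big = h })

view : ∀ {n s} {α : Vec ℕ s} (σ : OP (suc n) s α) → View σ
view record { blk = p ∷ w ; big = h } = cons p (tailOP p w h)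

posOf : ℕ → ℕ → Pos
posOf r a = if r <ᵇ a then box (a ∸ r) else floating

-- Deleting the smallest element of a block lowers the ranks of the others and the number of boxes
-- alike, so the row a - r of a box is unchanged.
posOf-suc : ∀ r a → posOf (suc r) a ≡ posOf r (ℕ.pred a)
posOf-suc r zero    = refl
posOf-suc r (suc a) = refl

module _ {n s} {α : Vec ℕ s} (p : Fin s) (τ : OP n s (α ⊖ p))
         (h : ∀ b → lookup α b ≤ blockSize (p ∷ blk τ) b) where

  σ⁺ : OP (suc n) s α
  σ⁺ = record { blk = p ∷ blk τ ; big = h }

  pos-zero : pos σ⁺ zero ≡ posOf 0 (lookup α p)
  pos-zero = cong (λ r → posOf r (lookup α p)) (count-false {p = λ y → (y <F zero {n}) ∧ (bl σ⁺ y ==F p)} λ _ → refl)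

  pos-suc : ∀ x → pos σ⁺ (suc x) ≡ pos τ x
  pos-suc x rewrite count-suc (λ y → (y <F suc x) ∧ (bl σ⁺ y ==F bl τ x)) with p Fin.≟ bl τ x
  ... | no p≢b   = cong (posOf (rank τ x)) (sym (lookup-⊖-≢ α p≢b))
  ... | yes p≡b  = trans (posOf-suc (rank τ x) (lookup α (bl τ x))) (cong (posOf (rank τ x)) (sym (lookup-⊖-≡ α p≡b)))

-- A column of height a consists of its lowest box, in row a, and a column of height a - 1.
⟦box⟧ : ∀ a r → ⟦ inRow (posOf 0 a) (suc r) ⟧ + ⟦ r <ᵇ ℕ.pred a ⟧ ≡ ⟦ r <ᵇ a ⟧
⟦box⟧ zero          r = refl
⟦box⟧ (suc zero)    zero    = refl
⟦box⟧ (suc (suc a)) zero    = refl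
⟦box⟧ (suc zero)    (suc r) = refl
⟦box⟧ (suc (suc a)) (suc r) = ⟦box⟧ (suc a) r

-- Elements are removed one at a time, each taking the lowest box of its column. When none is left,
-- `big` forces all parts to vanish, so no box has stayed empty.
rowcount : ∀ {n s} {α : Vec ℕ s} (σ : OP n s α) b r →
  ∑ (λ y → ⟦ bl σ y ==F b ⟧ * ⟦ inRow (pos σ y) (suc r) ⟧) ≡ ⟦ r <ᵇ lookup α b ⟧
rowcount {zero} {α = α} σ b r rewrite n≤0⇒n≡0 (big σ b) = refl
rowcount {suc n} {α = α} σ b r with view σ
... | cons p τ {h} = begin
  ⟦ p ==F b ⟧ * ⟦ inRow (pos (σ⁺ p τ h) zero) (suc r) ⟧
    + ∑ (λ y → ⟦ bl τ y ==F b ⟧ * ⟦ inRow (pos (σ⁺ p τ h) (suc y)) (suc r) ⟧)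
    ≡⟨ cong₂ _+_ (cong (λ q → ⟦ p ==F b ⟧ * ⟦ inRow q (suc r) ⟧) (pos-zero p τ h))
         (∑-cong λ y → cong (λ q → ⟦ bl τ y ==F b ⟧ * ⟦ inRow q (suc r) ⟧) (pos-suc p τ h y)) ⟩
  ⟦ p ==F b ⟧ * ⟦ inRow (posOf 0 (lookup α p)) (suc r) ⟧ + ∑ (λ y → ⟦ bl τ y ==F b ⟧ * ⟦ inRow (pos τ y) (suc r) ⟧)
    ≡⟨ cong (⟦ p ==F b ⟧ * ⟦ inRow (posOf 0 (lookup α p)) (suc r) ⟧ +_) (rowcount τ b r) ⟩
  ⟦ p ==F b ⟧ * ⟦ inRow (posOf 0 (lookup α p)) (suc r) ⟧ + ⟦ r <ᵇ lookup (α ⊖ p) b ⟧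
    ≡⟨ step ⟩
  ⟦ r <ᵇ lookup α b ⟧ ∎
  where
  open ≡-Reasoning
  step : ⟦ p ==F b ⟧ * ⟦ inRow (posOf 0 (lookup α p)) (suc r) ⟧ + ⟦ r <ᵇ lookup (α ⊖ p) b ⟧ ≡ ⟦ r <ᵇ lookup α b ⟧
  step with p Fin.≟ b
  ... | no p≢b   = cong (λ u → ⟦ r <ᵇ u ⟧) (lookup-⊖-≢ α p≢b)
  ... | yes refl = trans (cong₂ _+_ (+-identityʳ _) (cong (λ u → ⟦ r <ᵇ u ⟧) (lookup-⊖ α p))) (⟦box⟧ (lookup α p) r)

∑-blocks : ∀ {n s} {α : Vec ℕ s} (σ : OP n s α) (g : Fin s → ℕ) (c : Fin n → ℕ) →
  ∑ (λ y → g (bl σ y) * c y) ≡ ∑ (λ b → g b * ∑ (λ y → ⟦ bl σ y ==F b ⟧ * c y))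
∑-blocks σ g c = begin
  ∑ (λ y → g (bl σ y) * c y)                             ≡⟨ ∑-cong (λ y → sym (∑-δ′ (λ b → g b * c y) (bl σ y))) ⟩
  ∑ (λ y → ∑ λ b → ⟦ bl σ y ==F b ⟧ * (g b * c y))       ≡⟨ ∑-comm (λ y b → ⟦ bl σ y ==F b ⟧ * (g b * c y)) ⟩
  ∑ (λ b → ∑ λ y → ⟦ bl σ y ==F b ⟧ * (g b * c y))
    ≡⟨ ∑-cong (λ b → ∑-cong λ y → *-exchange ⟦ bl σ y ==F b ⟧ (g b) (c y)) ⟩
  ∑ (λ b → ∑ λ y → g b * (⟦ bl σ y ==F b ⟧ * c y))       ≡⟨ ∑-cong (λ b → ∑-*ˡ (g b) (λ y → ⟦ bl σ y ==F b ⟧ * c y)) ⟩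
  ∑ (λ b → g b * ∑ (λ y → ⟦ bl σ y ==F b ⟧ * c y))       ∎
  where
  open ≡-Reasoning

-- The right-hand side no longer mentions σ. This is why the code entry of the smallest element
-- depends on its block only.
weighted-rowcount : ∀ {n s} {α : Vec ℕ s} (σ : OP n s α) (g : Fin s → ℕ) r →
  ∑ (λ y → g (bl σ y) * ⟦ inRow (pos σ y) (suc r) ⟧) ≡ ∑ (λ b → g b * ⟦ r <ᵇ lookup α b ⟧)
weighted-rowcount σ g r = trans (∑-blocks σ g _) (∑-cong λ b → cong (g b *_) (rowcount σ b r))

-- The order in which block p precedes block q when λ_p > λ_q, with ties broken from right to left
-- if λ_p = λ_q > 0 and from left to right if λ_p = λ_q = 0; precedes (λ_p) (λ_b) p b tells if b precedes p.
precedes : ∀ {s} → ℕ → ℕ → Fin s → Fin s → ℕ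
precedes zero    u p b = ⟦ p <F b ⟧ * ⟦ 0 <ᵇ u ⟧ + ⟦ b <F p ⟧
precedes (suc a) u p b = ⟦ p <F b ⟧ * ⟦ a <ᵇ u ⟧ + ⟦ b <F p ⟧ * ⟦ suc a <ᵇ u ⟧

blockRank : ∀ {s} → Vec ℕ s → Fin s → ℕ
blockRank α p = ∑ (λ b → precedes (lookup α p) (lookup α b) p b)

<F-irrefl : ∀ {n} (i : Fin n) → (i <F i) ≡ false
<F-irrefl i = ≮⇒<ᵇ {toℕ i} (<-irrefl refl)

precedes-irrefl : ∀ {s} a u (p : Fin s) → precedes a u p p ≡ 0
precedes-irrefl zero    u p rewrite <F-irrefl p = refl
precedes-irrefl (suc a) u p rewrite <F-irrefl p = refl

data Compare {s} (p b : Fin s) : Set where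
  before : (p <F b) ≡ true → (b <F p) ≡ false → p ≢ b → Compare p b
  same   : p ≡ b → Compare p b
  after  : (p <F b) ≡ false → (b <F p) ≡ true → p ≢ b → Compare p b

compareF : ∀ {s} (p b : Fin s) → Compare p b
compareF p b with <-cmp (toℕ p) (toℕ b)
... | tri< lt ne gt = before (<⇒<ᵇ′ lt) (≮⇒<ᵇ gt) (ne ∘ cong toℕ)
... | tri≈ lt eq gt = same (FinP.toℕ-injective eq)
... | tri> lt ne gt = after (≮⇒<ᵇ lt) (<⇒<ᵇ′ gt) (ne ∘ cong toℕ)

<ᵇ-weaken : ∀ a u → ⟦ suc a <ᵇ u ⟧ ≤ ⟦ a <ᵇ u ⟧
<ᵇ-weaken a       zero          = z≤n
<ᵇ-weaken zero    (suc zero)    = z≤n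
<ᵇ-weaken zero    (suc (suc u)) = ≤-refl
<ᵇ-weaken (suc a) (suc u)       = <ᵇ-weaken a u

precedes≤1 : ∀ {s} a u (p b : Fin s) → precedes a u p b ≤ 1
precedes≤1 a u p b with compareF p b
precedes≤1 a u p .p | same refl rewrite precedes-irrefl a u p = z≤n
precedes≤1 zero u p b | before e e′ _ rewrite e | e′ | +-identityʳ ⟦ 0 <ᵇ u ⟧ | +-identityʳ ⟦ 0 <ᵇ u ⟧ = ⟦⟧≤1 (0 <ᵇ u)
precedes≤1 zero u p b | after e e′ _ rewrite e | e′ = ≤-refl
precedes≤1 (suc a) u p b | before e e′ _ rewrite e | e′ | +-identityʳ ⟦ a <ᵇ u ⟧ | +-identityʳ ⟦ a <ᵇ u ⟧ =
  ⟦⟧≤1 (a <ᵇ u)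
precedes≤1 (suc a) u p b | after e e′ _ rewrite e | e′ | +-identityʳ ⟦ suc a <ᵇ u ⟧ = ⟦⟧≤1 (suc a <ᵇ u)

blockRank<s : ∀ {s} (α : Vec ℕ s) p → blockRank α p < s
blockRank<s {s} α p = subst (blockRank α p <_) (∑-one s)
  (∑-mono-< (λ b → precedes≤1 (lookup α p) (lookup α b) p b) p
    (subst (_< 1) (sym (precedes-irrefl (lookup α p) (lookup α p) p)) ≤-refl))

-- `coinv`, `maxcode` and `expT` branch on a position or a column; `coinvOf`, `maxcodeOf` and
-- `boxesBelow` take the position as an argument, so that equal positions can be substituted.
coinvOf : ∀ {s} → Pos → Fin s → Fin s → Pos → Bool
coinvOf floating b c q = (b <F c) ∧ inRow q 1
coinvOf (box r)  b c q = ((b <F c) ∧ inRow q r) ∨ ((c <F b) ∧ inRow q (suc r))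

coinv-of : ∀ {n s} {α : Vec ℕ s} (σ : OP n s α) x y → coinv σ x y ≡ coinvOf (pos σ x) (bl σ x) (bl σ y) (pos σ y)
coinv-of σ x y with pos σ x
... | floating = refl
... | box r    = refl

floatTerm : ∀ {s} → Pos → Fin s → ℕ
floatTerm q b = if isFloating q then toℕ b else 0

maxcodeOf : ∀ {n} → ℕ → Vec ℕ n → Pos → (ℕ → ℕ) → ℕ
maxcodeOf s α floating c = s ∸ 1
maxcodeOf s α (box j)  c = conj α j ∸ suc (c j)

maxcode-of : ∀ {n s} {α : Vec ℕ s} (σ : OP n s α) x →
  maxcode σ x ≡ maxcodeOf s α (pos σ x) (λ j → count (λ y → (y <F x) ∧ inRow (pos σ y) j))
maxcode-of σ x with pos σ x
... | floating = refl
... | box j    = refl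

boxesBelow : ℕ → Pos → (ℕ → ℕ) → ℕ
boxesBelow s floating c = s ∸ 1
boxesBelow s (box j)  c = c j

expσ : ∀ {n s} {α : Vec ℕ s} → OP n s α → Fin n → ℕ
expσ {s = s} σ = expT s (tab σ)

sameCol-tab : ∀ {n s} {α : Vec ℕ s} (σ : OP n s α) y j → sameCol s (tab σ) (tab σ y) (just j) ≡ inRow (pos σ y) j
sameCol-tab σ y j with pos σ y
... | floating = refl
... | box r    = refl

expσ-of : ∀ {n s} {α : Vec ℕ s} (σ : OP n s α) x →
  expσ σ x ≡ boxesBelow s (pos σ x) (λ j → count (λ y → (x <F y) ∧ inRow (pos σ y) j))
expσ-of σ x with pos σ x
... | floating = refl
... | box j    = count-cong λ y → cong ((x <F y) ∧_) (sameCol-tab σ y j)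

module _ {n s} {α : Vec ℕ s} (p : Fin s) (τ : OP n s (α ⊖ p))
         (h : ∀ b → lookup α b ≤ blockSize (p ∷ blk τ) b) where

  private
    σ = σ⁺ p τ h

  -- A coinversion is recorded at its smaller element, so the smallest element of all never
  -- contributes to the code of another.
  code-suc : ∀ x → code σ (suc x) ≡ code τ x
  code-suc x = cong₂ _+_
    (trans (count-suc (λ y → (suc x <F y) ∧ coinv σ (suc x) y)) (count-cong λ y → cong ((x <F y) ∧_) (begin
       coinv σ (suc x) (suc y) ≡⟨ coinv-of σ (suc x) (suc y) ⟩
       coinvOf (pos σ (suc x)) (bl τ x) (bl τ y) (pos σ (suc y))
         ≡⟨ cong₂ (λ q q′ → coinvOf q (bl τ x) (bl τ y) q′) (pos-suc p τ h x) (pos-suc p τ h y) ⟩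
       coinvOf (pos τ x) (bl τ x) (bl τ y) (pos τ y) ≡⟨ coinv-of τ x y ⟨
       coinv τ x y ∎)))
    (cong (λ q → floatTerm q (bl τ x)) (pos-suc p τ h x))
    where open ≡-Reasoning

  -- The remaining elements fill α ⊖ p, which differs from α in block p only. The weight vanishes
  -- there because no coinversion joins two elements of one block.
  ∑-pos-suc : (g : Fin s → ℕ) (r : ℕ) → g p ≡ 0 →
    ∑ (λ y → g (bl τ y) * ⟦ inRow (pos σ (suc y)) (suc r) ⟧) ≡ ∑ (λ b → g b * ⟦ r <ᵇ lookup α b ⟧)
  ∑-pos-suc g r gp≡0 = begin
    ∑ (λ y → g (bl τ y) * ⟦ inRow (pos σ (suc y)) (suc r) ⟧)
      ≡⟨ ∑-cong (λ y → cong (λ q → g (bl τ y) * ⟦ inRow q (suc r) ⟧) (pos-suc p τ h y)) ⟩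
    ∑ (λ y → g (bl τ y) * ⟦ inRow (pos τ y) (suc r) ⟧)       ≡⟨ weighted-rowcount τ g r ⟩
    ∑ (λ b → g b * ⟦ r <ᵇ lookup (α ⊖ p) b ⟧)                ≡⟨ ∑-cong termwise ⟩
    ∑ (λ b → g b * ⟦ r <ᵇ lookup α b ⟧)                      ∎
    where
    open ≡-Reasoning
    termwise : ∀ b → g b * ⟦ r <ᵇ lookup (α ⊖ p) b ⟧ ≡ g b * ⟦ r <ᵇ lookup α b ⟧
    termwise b with p Fin.≟ b
    ... | yes refl rewrite gp≡0 = refl
    ... | no p≢b   = cong (λ u → g b * ⟦ r <ᵇ u ⟧) (lookup-⊖-≢ α p≢b)

  -- All other elements are larger, so whole rows are counted. In the lowest box, row a + 1, the
  -- smallest element meets its row in each block to the right with λ_b > a and the next row in each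
  -- block to the left with λ_b > a + 1. If it floats, it meets row 1 to the right, and the floating
  -- term counts the blocks to the left. These are the summands of `precedes`.
  code-zero : code σ zero ≡ blockRank α p
  code-zero = trans (cong₂ _+_
    (trans (count-suc (λ y → (zero {n} <F y) ∧ coinv σ zero y)) (count-∑ (λ y → coinv σ zero (suc y)))) refl)
    (trans (cong₂ _+_ (∑-cong λ y → cong ⟦_⟧ (trans (coinv-of σ zero (suc y))
                         (cong (λ q → coinvOf q p (bl τ y) (pos σ (suc y))) (pos-zero p τ h))))
                      (cong (λ q → floatTerm q p) (pos-zero p τ h)))
           (by-size (lookup α p)))
    where
    open ≡-Reasoning
    right left : Fin s → ℕ
    right b = ⟦ p <F b ⟧
    left b  = ⟦ b <F p ⟧
    right-p : right p ≡ 0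
    right-p = cong ⟦_⟧ (<F-irrefl p)
    left-p : left p ≡ 0
    left-p = cong ⟦_⟧ (<F-irrefl p)
    split : ∀ b u v → ⟦ ((p <F b) ∧ u) ∨ ((b <F p) ∧ v) ⟧ ≡ right b * ⟦ u ⟧ + left b * ⟦ v ⟧
    split b u v with compareF p b
    split b true  v | before e e′ _ rewrite e | e′ = refl
    split b false v | before e e′ _ rewrite e | e′ = refl
    split b u true  | after e e′ _ rewrite e | e′ = refl
    split b u false | after e e′ _ rewrite e | e′ = refl
    split .p u v    | same refl rewrite <F-irrefl p = refl
    ∑-left : ∀ {s} (q : Fin s) → toℕ q ≡ ∑ (λ b → ⟦ b <F q ⟧)
    ∑-left {suc s} zero    = sym (∑-zero {f = λ b → ⟦ b <F zero {s} ⟧} λ _ → refl)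
    ∑-left {suc s} (suc q) = cong suc (∑-left q)
    by-size : ∀ a → ∑ (λ y → ⟦ coinvOf (posOf 0 a) p (bl τ y) (pos σ (suc y)) ⟧) + floatTerm (posOf 0 a) p
                    ≡ ∑ (λ b → precedes a (lookup α b) p b)
    by-size zero = begin
      ∑ (λ y → ⟦ (p <F bl τ y) ∧ inRow (pos σ (suc y)) 1 ⟧) + toℕ p
        ≡⟨ cong₂ _+_ (trans (∑-cong λ y → ⟦∧⟧ (p <F bl τ y) _) (∑-pos-suc right 0 right-p)) (∑-left p) ⟩
      ∑ (λ b → right b * ⟦ 0 <ᵇ lookup α b ⟧) + ∑ left
        ≡⟨ ∑-+ (λ b → right b * ⟦ 0 <ᵇ lookup α b ⟧) left ⟨
      ∑ (λ b → precedes zero (lookup α b) p b) ∎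
    by-size (suc a) = begin
      ∑ (λ y → ⟦ coinvOf (box (suc a)) p (bl τ y) (pos σ (suc y)) ⟧) + 0
        ≡⟨ +-identityʳ _ ⟩
      ∑ (λ y → ⟦ coinvOf (box (suc a)) p (bl τ y) (pos σ (suc y)) ⟧)
        ≡⟨ ∑-cong (λ y → split (bl τ y) (inRow (pos σ (suc y)) (suc a)) (inRow (pos σ (suc y)) (suc (suc a)))) ⟩
      ∑ (λ y → right (bl τ y) * ⟦ inRow (pos σ (suc y)) (suc a) ⟧ + left (bl τ y) * ⟦ inRow (pos σ (suc y)) (suc (suc a)) ⟧)
        ≡⟨ ∑-+ (λ y → right (bl τ y) * ⟦ inRow (pos σ (suc y)) (suc a) ⟧) (λ y → left (bl τ y) * ⟦ inRow (pos σ (suc y)) (suc (suc a)) ⟧) ⟩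
      ∑ (λ y → right (bl τ y) * ⟦ inRow (pos σ (suc y)) (suc a) ⟧) + ∑ (λ y → left (bl τ y) * ⟦ inRow (pos σ (suc y)) (suc (suc a)) ⟧)
        ≡⟨ cong₂ _+_ (∑-pos-suc right a right-p) (∑-pos-suc left (suc a) left-p) ⟩
      ∑ (λ b → right b * ⟦ a <ᵇ lookup α b ⟧) + ∑ (λ b → left b * ⟦ suc a <ᵇ lookup α b ⟧)
        ≡⟨ ∑-+ (λ b → right b * ⟦ a <ᵇ lookup α b ⟧) (λ b → left b * ⟦ suc a <ᵇ lookup α b ⟧) ⟨
      ∑ (λ b → precedes (suc a) (lookup α b) p b) ∎

  expσ-suc : ∀ x → expσ σ (suc x) ≡ expσ τ x
  expσ-suc x = begin
    expσ σ (suc x) ≡⟨ expσ-of σ (suc x) ⟩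
    boxesBelow s (pos σ (suc x)) (λ j → count (λ y → (suc x <F y) ∧ inRow (pos σ y) j))
      ≡⟨ cong (λ q → boxesBelow s q (λ j → count (λ y → (suc x <F y) ∧ inRow (pos σ y) j))) (pos-suc p τ h x) ⟩
    boxesBelow s (pos τ x) (λ j → count (λ y → (suc x <F y) ∧ inRow (pos σ y) j)) ≡⟨ below (pos τ x) ⟩
    boxesBelow s (pos τ x) (λ j → count (λ y → (x <F y) ∧ inRow (pos τ y) j)) ≡⟨ expσ-of τ x ⟨
    expσ τ x ∎
    where
    open ≡-Reasoning
    below : ∀ q → boxesBelow s q (λ j → count (λ y → (suc x <F y) ∧ inRow (pos σ y) j))
                ≡ boxesBelow s q (λ j → count (λ y → (x <F y) ∧ inRow (pos τ y) j))
    below floating = refl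
    below (box j)  = trans (count-suc (λ y → (suc x <F y) ∧ inRow (pos σ y) j))
                           (count-cong λ y → cong (λ q → (x <F y) ∧ inRow q j) (pos-suc p τ h y))

  conj-⊖ : ∀ j → conj α j ≡ ⟦ inRow (posOf 0 (lookup α p)) j ⟧ + conj (α ⊖ p) j
  conj-⊖ j = begin
    conj α j ≡⟨ count-∑ (λ b → j ≤ᵇ lookup α b) ⟩
    ∑ (λ b → ⟦ j ≤ᵇ lookup α b ⟧) ≡⟨ ∑-cong termwise ⟩
    ∑ (λ b → ⟦ b ==F p ⟧ * I + ⟦ j ≤ᵇ lookup (α ⊖ p) b ⟧)
      ≡⟨ ∑-+ (λ b → ⟦ b ==F p ⟧ * I) (λ b → ⟦ j ≤ᵇ lookup (α ⊖ p) b ⟧) ⟩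
    ∑ (λ b → ⟦ b ==F p ⟧ * I) + ∑ (λ b → ⟦ j ≤ᵇ lookup (α ⊖ p) b ⟧)
      ≡⟨ cong₂ _+_ (∑-δ (λ _ → I) p) (sym (count-∑ (λ b → j ≤ᵇ lookup (α ⊖ p) b))) ⟩
    I + conj (α ⊖ p) j ∎
    where
    open ≡-Reasoning
    I : ℕ
    I = ⟦ inRow (posOf 0 (lookup α p)) j ⟧
    at-p : ∀ j a → ⟦ j ≤ᵇ a ⟧ ≡ ⟦ inRow (posOf 0 a) j ⟧ + ⟦ j ≤ᵇ ℕ.pred a ⟧
    at-p zero    zero    = refl
    at-p zero    (suc a) = refl
    at-p (suc r) a       = sym (⟦box⟧ a r)
    termwise : ∀ b → ⟦ j ≤ᵇ lookup α b ⟧ ≡ ⟦ b ==F p ⟧ * I + ⟦ j ≤ᵇ lookup (α ⊖ p) b ⟧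
    termwise b with b Fin.≟ p
    ... | yes refl = trans (at-p j (lookup α p)) (cong₂ _+_ (sym (+-identityʳ I)) (cong (λ u → ⟦ j ≤ᵇ u ⟧) (sym (lookup-⊖ α p))))
    ... | no b≢p   = cong (λ u → ⟦ j ≤ᵇ u ⟧) (sym (lookup-⊖-≢ α (b≢p ∘ sym)))

  maxcode-suc : ∀ x → maxcode σ (suc x) ≡ maxcode τ x
  maxcode-suc x = begin
    maxcode σ (suc x) ≡⟨ maxcode-of σ (suc x) ⟩
    maxcodeOf s α (pos σ (suc x)) c ≡⟨ cong (λ q → maxcodeOf s α q c) (pos-suc p τ h x) ⟩
    maxcodeOf s α (pos τ x) c ≡⟨ above (pos τ x) ⟩
    maxcodeOf s (α ⊖ p) (pos τ x) c′ ≡⟨ maxcode-of τ x ⟨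
    maxcode τ x ∎
    where
    open ≡-Reasoning
    c c′ : ℕ → ℕ
    c j  = count (λ y → (y <F suc x) ∧ inRow (pos σ y) j)
    c′ j = count (λ y → (y <F x) ∧ inRow (pos τ y) j)
    c-suc : ∀ j → c j ≡ ⟦ inRow (posOf 0 (lookup α p)) j ⟧ + c′ j
    c-suc j = trans (count-suc (λ y → (y <F suc x) ∧ inRow (pos σ y) j))
      (cong₂ _+_ (cong (λ q → ⟦ inRow q j ⟧) (pos-zero p τ h))
                 (count-cong λ y → cong (λ q → (y <F x) ∧ inRow q j) (pos-suc p τ h y)))
    above : ∀ q → maxcodeOf s α q c ≡ maxcodeOf s (α ⊖ p) q c′
    above floating = refl
    -- If the deleted element lies in row j, it accounts for one box of that row and for one smaller
    -- entry, and the two cancel.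
    above (box j) rewrite c-suc j | conj-⊖ j | sym (+-suc ⟦ inRow (posOf 0 (lookup α p)) j ⟧ (c′ j)) =
      [m+n]∸[m+o]≡n∸o ⟦ inRow (posOf 0 (lookup α p)) j ⟧ _ _

  -- The other entries of the row of the smallest element are all larger, hence lie below it in its
  -- column of the tableau.
  expσ-zero : ∀ q → posOf 0 (lookup α p) ≡ q → expσ σ zero ≡ boxesBelow s q (conj (α ⊖ p))
  expσ-zero q eq =
    trans (expσ-of σ zero) (trans (cong (λ q′ → boxesBelow s q′ c) (trans (pos-zero p τ h) eq)) (by-size (lookup α p) q eq))
    where
    c : ℕ → ℕ
    c j = count (λ y → (zero {n} <F y) ∧ inRow (pos σ y) j)
    by-size : ∀ a q → posOf 0 a ≡ q → boxesBelow s q c ≡ boxesBelow s q (conj (α ⊖ p))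
    by-size zero    .floating      refl = refl
    by-size (suc a) .(box (suc a)) refl = begin
      c (suc a) ≡⟨ count-suc (λ y → (zero {n} <F y) ∧ inRow (pos σ y) (suc a)) ⟩
      count (λ y → inRow (pos σ (suc y)) (suc a)) ≡⟨ count-∑ (λ y → inRow (pos σ (suc y)) (suc a)) ⟩
      ∑ (λ y → ⟦ inRow (pos σ (suc y)) (suc a) ⟧)
        ≡⟨ ∑-cong (λ y → trans (cong (λ q → ⟦ inRow q (suc a) ⟧) (pos-suc p τ h y)) (sym (+-identityʳ _))) ⟩
      ∑ (λ y → 1 * ⟦ inRow (pos τ y) (suc a) ⟧) ≡⟨ weighted-rowcount τ (λ _ → 1) a ⟩
      ∑ (λ b → 1 * ⟦ a <ᵇ lookup (α ⊖ p) b ⟧) ≡⟨ ∑-cong (λ b → +-identityʳ ⟦ a <ᵇ lookup (α ⊖ p) b ⟧) ⟩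
      ∑ (λ b → ⟦ a <ᵇ lookup (α ⊖ p) b ⟧) ≡⟨ count-∑ (λ b → suc a ≤ᵇ lookup (α ⊖ p) b) ⟨
      conj (α ⊖ p) (suc a) ∎
      where open ≡-Reasoning

  maxcode-zero : maxcode σ zero ≡ expσ σ zero
  maxcode-zero = begin
    maxcode σ zero ≡⟨ maxcode-of σ zero ⟩
    maxcodeOf s α (pos σ zero) c ≡⟨ cong (λ q → maxcodeOf s α q c) (pos-zero p τ h) ⟩
    maxcodeOf s α (posOf 0 (lookup α p)) c ≡⟨ by-pos (posOf 0 (lookup α p)) refl ⟩
    boxesBelow s (posOf 0 (lookup α p)) (conj (α ⊖ p)) ≡⟨ expσ-zero _ refl ⟨
    expσ σ zero ∎
    where
    open ≡-Reasoning
    c : ℕ → ℕ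
    c j = count (λ y → (y <F zero {n}) ∧ inRow (pos σ y) j)
    by-pos : ∀ q → posOf 0 (lookup α p) ≡ q → maxcodeOf s α q c ≡ boxesBelow s q (conj (α ⊖ p))
    by-pos floating eq = refl
    by-pos (box j)  eq rewrite count-false {p =
      λ y → (y <F zero {n}) ∧ inRow (pos σ y) j} (λ _ → refl) | conj-⊖ j | eq | ≡ᵇ-refl j = refl

  -- For a floating element the bound is s - 1, the largest possible rank. Otherwise a block that
  -- precedes p is at least as tall as p, so it has an entry in the row of the smallest element.
  code-zero≤expσ : code σ zero ≤ expσ σ zero
  code-zero≤expσ rewrite code-zero = by-size (lookup α p) refl
    where
    by-size : ∀ a → lookup α p ≡ a → blockRank α p ≤ expσ σ zero
    by-size zero eq rewrite expσ-zero floating (cong (posOf 0) eq) = <⇒≤pred (blockRank<s α p)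
    by-size (suc a) eq rewrite expσ-zero (box (suc a)) (cong (posOf 0) eq) | eq | count-∑ (λ b → suc a ≤ᵇ lookup (α ⊖ p) b) =
      ∑-mono termwise
      where
      termwise : ∀ b → precedes (suc a) (lookup α b) p b ≤ ⟦ a <ᵇ lookup (α ⊖ p) b ⟧
      termwise b with compareF p b
      termwise .p | same refl rewrite precedes-irrefl (suc a) (lookup α p) p = z≤n
      termwise b | before e e′ p≢b rewrite e | e′ | lookup-⊖-≢ α p≢b | +-identityʳ ⟦ a <ᵇ lookup α b ⟧ | +-identityʳ ⟦ a <ᵇ lookup α b ⟧ =
        ≤-refl
      termwise b | after e e′ p≢b rewrite e | e′ | lookup-⊖-≢ α p≢b | +-identityʳ ⟦ suc a <ᵇ lookup α b ⟧ =
        <ᵇ-weaken a (lookup α b)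

-- The m-th smallest entry of a row of length λ'_j has λ'_j - m entries below it once the row is
-- stood up as a column.
maxcode≡expσ : ∀ {n s} {α : Vec ℕ s} (σ : OP n s α) x → maxcode σ x ≡ expσ σ x
maxcode≡expσ {suc n} σ x with view σ
maxcode≡expσ σ zero    | cons p τ {h} = maxcode-zero p τ h
maxcode≡expσ σ (suc x) | cons p τ {h} =
  trans (maxcode-suc p τ h x) (trans (maxcode≡expσ τ x) (sym (expσ-suc p τ h x)))

-- Ensures that the truncated differences of `maxcode` and `code` in δ_σ are true differences.
code≤expσ : ∀ {n s} {α : Vec ℕ s} (σ : OP n s α) x → code σ x ≤ expσ σ x
code≤expσ {suc n} σ x with view σ
code≤expσ σ zero    | cons p τ {h} = code-zero≤expσ p τ h
code≤expσ σ (suc x) | cons p τ {h} = subst₂ _≤_ (sym (code-suc p τ h x)) (sym (expσ-suc p τ h x)) (code≤expσ τ x)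

-- Block b precedes block p exactly when its key is larger.
key : ∀ {s} → ℕ → Fin s → ℕ
key {s} zero    i = s ∸ suc (toℕ i)
key {s} (suc a) i = suc a * s + toℕ i

key-zero< : ∀ {s} (i : Fin s) → key zero i < s
key-zero< {s} i = ∸-monoʳ-< {s} {suc (toℕ i)} {0} (s≤s z≤n) (FinP.toℕ<n i)

s≤key-suc : ∀ {s} a (i : Fin s) → s ≤ key (suc a) i
s≤key-suc {s} a i = ≤-trans (m≤m+n s (a * s)) (m≤m+n _ _)

key-suc-< : ∀ {s} a u (p b : Fin s) → a < u → key (suc a) p < key (suc u) b
key-suc-< {s} a u p b a<u = begin-strict
  suc a * s + toℕ p       <⟨ +-monoʳ-< (suc a * s) (FinP.toℕ<n p) ⟩
  suc a * s + s           ≡⟨ +-comm (suc a * s) s ⟩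
  suc (suc a) * s         ≤⟨ *-monoˡ-≤ s (s≤s a<u) ⟩
  suc u * s               ≤⟨ m≤m+n _ _ ⟩
  suc u * s + toℕ b       ∎
  where open ≤-Reasoning

-- The key of a positive part reads size, then place, in base s; zero parts get the keys below s, in
-- reverse order of place. The sizes are separate arguments so that they can be split into cases,
-- and the hypothesis ties them together when p = b.
precedes-key : ∀ {s} a u (p b : Fin s) → (p ≡ b → a ≡ u) → precedes a u p b ≡ ⟦ key a p <ᵇ key u b ⟧
precedes-key a u p b p≡b⇒a≡u with compareF p b
precedes-key a u p .p p≡b⇒a≡u | same refl rewrite precedes-irrefl a u p | p≡b⇒a≡u refl =
  cong ⟦_⟧ (sym (≮⇒<ᵇ {key u p} (<-irrefl refl)))
precedes-key {s} zero zero p b _ | before e e′ _ rewrite e | e′ =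
  cong ⟦_⟧ (sym (≮⇒<ᵇ (≤⇒≯ (∸-monoʳ-≤ s (<⇒≤ (s≤s (<ᵇ⇒<′ (toℕ p) (toℕ b) e)))))))
precedes-key zero zero p b _ | after e e′ _ rewrite e | e′ =
  cong ⟦_⟧ (sym (<⇒<ᵇ′ (∸-monoʳ-< (s≤s (<ᵇ⇒<′ (toℕ b) (toℕ p) e′)) (FinP.toℕ<n p))))
precedes-key zero (suc u) p b _ | before e e′ _ rewrite e | e′ =
  cong ⟦_⟧ (sym (<⇒<ᵇ′ (<-≤-trans (key-zero< p) (s≤key-suc u b))))
precedes-key zero (suc u) p b _ | after e e′ _ rewrite e | e′ =
  cong ⟦_⟧ (sym (<⇒<ᵇ′ (<-≤-trans (key-zero< p) (s≤key-suc u b))))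
precedes-key (suc a) zero p b _ | before e e′ _ rewrite e | e′ =
  cong ⟦_⟧ (sym (≮⇒<ᵇ (<⇒≯ (<-≤-trans (key-zero< b) (s≤key-suc a p)))))
precedes-key (suc a) zero p b _ | after e e′ _ rewrite e | e′ =
  cong ⟦_⟧ (sym (≮⇒<ᵇ (<⇒≯ (<-≤-trans (key-zero< b) (s≤key-suc a p)))))
precedes-key {s} (suc a) (suc u) p b _ | before e e′ _ rewrite e | e′ | +-identityʳ ⟦ a <ᵇ suc u ⟧ | +-identityʳ ⟦ a <ᵇ suc u ⟧
  with a ≤? u
... | yes a≤u = cong ⟦_⟧ (trans (<⇒<ᵇ′ (s≤s a≤u)) (sym (<⇒<ᵇ′ (+-mono-≤-< (*-monoˡ-≤ s (s≤s a≤u)) (<ᵇ⇒<′ (toℕ p) (toℕ b) e)))))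
... | no a≰u  = cong ⟦_⟧ (trans (≮⇒<ᵇ (a≰u ∘ ℕ.s≤s⁻¹)) (sym (≮⇒<ᵇ (<⇒≯ (key-suc-< u a b p (≰⇒> a≰u))))))
precedes-key {s} (suc a) (suc u) p b _ | after e e′ _ rewrite e | e′ | +-identityʳ ⟦ a <ᵇ u ⟧
  with a <? u
... | yes a<u = cong ⟦_⟧ (trans (<⇒<ᵇ′ a<u) (sym (<⇒<ᵇ′ (key-suc-< a u p b a<u))))
... | no a≮u  = cong ⟦_⟧ (trans (≮⇒<ᵇ a≮u) (sym (≮⇒<ᵇ (≤⇒≯ (+-mono-≤ (*-monoˡ-≤ s (s≤s (≮⇒≥ a≮u))) (<⇒≤ (<ᵇ⇒<′ (toℕ b) (toℕ p) e′)))))))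

keyOf : ∀ {s} → Vec ℕ s → Fin s → ℕ
keyOf α b = key (lookup α b) b

blockRank-key : ∀ {s} (α : Vec ℕ s) p → blockRank α p ≡ ∑ (λ b → ⟦ keyOf α p <ᵇ keyOf α b ⟧)
blockRank-key α p = ∑-cong λ b → precedes-key (lookup α p) (lookup α b) p b (cong (lookup α))

key-injective : ∀ {s} a u (p b : Fin s) → key a p ≡ key u b → p ≡ b
key-injective zero    zero    p b eq =
  FinP.toℕ-injective (suc-injective (∸-cancelˡ-≡ (FinP.toℕ<n p) (FinP.toℕ<n b) eq))
key-injective zero    (suc u) p b eq = contradiction eq (<⇒≢ (<-≤-trans (key-zero< p) (s≤key-suc u b)))
key-injective (suc a) zero    p b eq = contradiction (sym eq) (<⇒≢ (<-≤-trans (key-zero< b) (s≤key-suc a p)))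
key-injective {s} (suc a) (suc u) p b eq with <-cmp a u
... | tri< a<u _ _  = contradiction eq (<⇒≢ (key-suc-< a u p b a<u))
... | tri≈ _ refl _ = FinP.toℕ-injective (+-cancelˡ-≡ (suc a * s) _ _ eq)
... | tri> _ _ u<a  = contradiction (sym eq) (<⇒≢ (key-suc-< u a b p u<a))

-- Everything that precedes b also precedes p, and so does b itself.
blockRank-< : ∀ {s} (α : Vec ℕ s) {p b} → keyOf α p < keyOf α b → blockRank α b < blockRank α p
blockRank-< α {p} {b} lt = subst₂ _<_ (sym (blockRank-key α b)) (sym (blockRank-key α p))
  (∑-mono-< termwise b (subst₂ (λ x y → ⟦ x ⟧ < ⟦ y ⟧) (sym (≮⇒<ᵇ {keyOf α b} (<-irrefl refl))) (sym (<⇒<ᵇ′ lt)) ≤-refl))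
  where
  termwise : ∀ c → ⟦ keyOf α b <ᵇ keyOf α c ⟧ ≤ ⟦ keyOf α p <ᵇ keyOf α c ⟧
  termwise c with keyOf α b <ᵇ keyOf α c in eq
  ... | false = z≤n
  ... | true  = ≤-reflexive (cong ⟦_⟧ (sym (<⇒<ᵇ′ (<-trans lt (<ᵇ⇒<′ (keyOf α b) (keyOf α c) eq)))))

blockRank-injective : ∀ {s} (α : Vec ℕ s) {p b} → blockRank α p ≡ blockRank α b → p ≡ b
blockRank-injective α {p} {b} eq with p Fin.≟ b
... | yes p≡b = p≡b
... | no p≢b with <-cmp (keyOf α p) (keyOf α b)
...   | tri< lt _ _ = contradiction (sym eq) (<⇒≢ (blockRank-< α lt))
...   | tri≈ _ e _  = key-injective (lookup α p) (lookup α b) p b e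
...   | tri> _ _ gt = contradiction eq (<⇒≢ (blockRank-< α gt))

blockRank-surjective : ∀ {s} (α : Vec ℕ s) {d} → d < s → ∃ λ p → blockRank α p ≡ d
blockRank-surjective α {d} d<s =
  let p , eq = injective⇒surjective (λ p → Fin.fromℕ< (blockRank<s α p))
                 (λ e → blockRank-injective α (FinP.fromℕ<-injective _ _ (blockRank<s α _) (blockRank<s α _) e))
                 (Fin.fromℕ< d<s)
  in p , FinP.fromℕ<-injective _ _ (blockRank<s α p) d<s eq

-- Provides the powers of x₁ that `harmonic-top` trades away: a strictly taller block precedes p
-- from either side.
blockRank-lower : ∀ {s} (α : Vec ℕ s) p u → lookup α p ≤ u → ∑ (λ b → ⟦ u <ᵇ lookup α b ⟧) ≤ blockRank α p
blockRank-lower α p u αp≤u = ∑-mono termwise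
  where
  larger : ∀ a v (b : Fin _) → p ≢ b → a < v → precedes a v p b ≡ 1
  larger a v b p≢b a<v with compareF p b
  ... | same p≡b = contradiction p≡b p≢b
  larger zero    (suc v) b _ _   | before e e′ _ rewrite e | e′ = refl
  larger (suc a) (suc v) b _ a<v | before e e′ _ rewrite e | e′ | <⇒<ᵇ′ (<-trans (n<1+n a) a<v) = refl
  larger zero    (suc v) b _ _   | after e e′ _ rewrite e | e′ = refl
  larger (suc a) (suc v) b _ a<v | after e e′ _ rewrite e | e′ | <⇒<ᵇ′ (ℕ.s≤s⁻¹ a<v) = refl
  termwise : ∀ b → ⟦ u <ᵇ lookup α b ⟧ ≤ precedes (lookup α p) (lookup α b) p b
  termwise b with u <ᵇ lookup α b in eq
  ... | false = z≤n
  ... | true  = ≤-reflexive (sym (larger (lookup α p) (lookup α b) b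
                  (λ p≡b → <⇒≱ (<ᵇ⇒<′ u _ eq) (subst (λ c → lookup α c ≤ u) p≡b αp≤u))
                  (≤-<-trans αp≤u (<ᵇ⇒<′ u _ eq))))

-- The first entry of the code is a rank and so determines the block of the smallest element; the
-- rest is the code of what remains after its deletion.
code-injective : ∀ {n s} {α : Vec ℕ s} (σ τ : OP n s α) → (∀ x → code σ x ≡ code τ x) → blk σ ≡ blk τ
code-injective {zero} σ τ h with blk σ | blk τ
... | [] | [] = refl
code-injective {suc n} {α = α} σ τ h with view σ | view τ
... | cons p σ′ {hσ} | cons q τ′ {hτ}
  with blockRank-injective α {p} {q} (trans (sym (code-zero p σ′ hσ)) (trans (h zero) (code-zero q τ′ hτ)))
...   | refl = cong (p ∷_) (code-injective σ′ τ′ λ x →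
                 trans (sym (code-suc p σ′ hσ x)) (trans (h (suc x)) (code-suc p τ′ hτ x)))

-- Harmonic spaces and their leading monomials

infixl 6 _⊕_
_⊕_ : ∀ {n} → Mon n → Mon n → Mon n
_⊕_ = zipWith _+_

-- ES d S F is the sum of F over the indicator vectors of the d-element subsets of S.
ES : ∀ {n} → ℕ → Subset n → (Mon n → ℚ) → ℚ
ES zero    []          F = F []
ES (suc d) []          F = 0ℚ
ES d       (false ∷ S) F = ES d S (F ∘ (0 ∷_))
ES zero    (true ∷ S)  F = ES zero S (F ∘ (0 ∷_))
ES (suc d) (true ∷ S)  F = ES d S (F ∘ (1 ∷_)) ℚ.+ ES (suc d) S (F ∘ (0 ∷_))

ES-cong : ∀ {n} d (S : Subset n) {F G : Mon n → ℚ} → (∀ A → F A ≡ G A) → ES d S F ≡ ES d S G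
ES-cong zero    []          h = h []
ES-cong (suc d) []          h = refl
ES-cong zero    (false ∷ S) h = ES-cong zero S (h ∘ (0 ∷_))
ES-cong (suc d) (false ∷ S) h = ES-cong (suc d) S (h ∘ (0 ∷_))
ES-cong zero    (true ∷ S)  h = ES-cong zero S (h ∘ (0 ∷_))
ES-cong (suc d) (true ∷ S)  h = cong₂ ℚ._+_ (ES-cong d S (h ∘ (1 ∷_))) (ES-cong (suc d) S (h ∘ (0 ∷_)))

-- Names the summation range of `ES`, so that vanishing need only be shown for exponents supported
-- on S.
data IndicatorIn : ∀ {n} → ℕ → Subset n → Mon n → Set where
  []   : IndicatorIn 0 [] []
  skip : ∀ {n d b} {S : Subset n} {A} → IndicatorIn d S A → IndicatorIn d (b ∷ S) (0 ∷ A)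
  take : ∀ {n d} {S : Subset n} {A} → IndicatorIn d S A → IndicatorIn (suc d) (true ∷ S) (1 ∷ A)

ES-zero : ∀ {n} d (S : Subset n) {F : Mon n → ℚ} → (∀ {A} → IndicatorIn d S A → F A ≡ 0ℚ) → ES d S F ≡ 0ℚ
ES-zero zero    []          h = h []
ES-zero (suc d) []          h = refl
ES-zero zero    (false ∷ S) h = ES-zero zero S (h ∘ skip)
ES-zero (suc d) (false ∷ S) h = ES-zero (suc d) S (h ∘ skip)
ES-zero zero    (true ∷ S)  h = ES-zero zero S (h ∘ skip)
ES-zero (suc d) (true ∷ S)  h = cong₂ ℚ._+_ (ES-zero d S (h ∘ take)) (ES-zero (suc d) S (h ∘ skip))

ES-linear : ∀ {n} d (S : Subset n) (c : ℚ) (F G : Mon n → ℚ) →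
  ES d S (λ A → F A ℚ.+ c ℚ.* G A) ≡ ES d S F ℚ.+ c ℚ.* ES d S G
ES-linear zero    []          c F G = refl
ES-linear (suc d) []          c F G = sym (trans (ℚP.+-identityˡ _) (ℚP.*-zeroʳ c))
ES-linear zero    (false ∷ S) c F G = ES-linear zero S c _ _
ES-linear (suc d) (false ∷ S) c F G = ES-linear (suc d) S c _ _
ES-linear zero    (true ∷ S)  c F G = ES-linear zero S c _ _
ES-linear (suc d) (true ∷ S)  c F G = trans
  (cong₂ ℚ._+_ (ES-linear d S c (F ∘ (1 ∷_)) (G ∘ (1 ∷_))) (ES-linear (suc d) S c (F ∘ (0 ∷_)) (G ∘ (0 ∷_))))
  (regroup c (ES d S (F ∘ (1 ∷_))) (ES d S (G ∘ (1 ∷_))) (ES (suc d) S (F ∘ (0 ∷_))) (ES (suc d) S (G ∘ (0 ∷_))))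
  where
  open Data.Rational.Solver.+-*-Solver
  regroup : ∀ c w x y z → (w ℚ.+ c ℚ.* x) ℚ.+ (y ℚ.+ c ℚ.* z) ≡ (w ℚ.+ y) ℚ.+ c ℚ.* (x ℚ.+ z)
  regroup = solve 5 (λ c w x y z → (w :+ c :* x) :+ (y :+ c :* z) := (w :+ y) :+ c :* (x :+ z)) refl

-- The number of boxes of λ outside the first u columns; for u = n ∸ m this is λ'_n + ⋯ + λ'_{n-m+1}.
excess : ∀ {s} → Vec ℕ s → ℕ → ℕ
excess α u = ∑ (λ b → lookup α b ∸ u)

-- The harmonic space in terms of the divided power coefficients F m = m! · [x^m] g, on which
-- differentiation acts by shifting the argument.
record Harmonic {n s} (α : Vec ℕ s) (F : Mon n → ℚ) : Set where
  field
    pow : ∀ i m → s ≤ lookup m i → F m ≡ 0ℚ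
    elem : ∀ S d → ∣ S ∣ < d + excess α (n ∸ ∣ S ∣) → ∀ a → ES d S (λ A → F (a ⊕ A)) ≡ 0ℚ

infix 4 _≺_
_≺_ : ∀ {n} → Mon n → Mon n → Set
_≺_ = Lex-< _≡_ _<_

IsLeading : ∀ {n} → (Mon n → ℚ) → Mon n → Set
IsLeading F m = F m ≢ 0ℚ × (∀ m′ → m ≺ m′ → F m′ ≡ 0ℚ)

excess-⊖-> : ∀ {s} (α : Vec ℕ s) p u → u < lookup α p → excess α u ≡ suc (excess (α ⊖ p) u)
excess-⊖-> α p u u<αp = begin
  excess α u ≡⟨ ∑-cong termwise ⟩
  ∑ (λ b → ⟦ b ==F p ⟧ * 1 + (lookup (α ⊖ p) b ∸ u)) ≡⟨ ∑-+ (λ b → ⟦ b ==F p ⟧ * 1) (λ b → lookup (α ⊖ p) b ∸ u) ⟩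
  ∑ (λ b → ⟦ b ==F p ⟧ * 1) + excess (α ⊖ p) u ≡⟨ cong (_+ excess (α ⊖ p) u) (∑-δ (λ _ → 1) p) ⟩
  suc (excess (α ⊖ p) u) ∎
  where
  open ≡-Reasoning
  pred-∸ : ∀ a u → u < a → a ∸ u ≡ suc (ℕ.pred a ∸ u)
  pred-∸ (suc a) u (s≤s u≤a) = +-∸-assoc 1 u≤a
  termwise : ∀ b → lookup α b ∸ u ≡ ⟦ b ==F p ⟧ * 1 + (lookup (α ⊖ p) b ∸ u)
  termwise b with b Fin.≟ p
  ... | yes refl = trans (pred-∸ (lookup α b) u u<αp) (cong (λ x → suc (x ∸ u)) (sym (lookup-⊖ α b)))
  ... | no b≢p   = cong (_∸ u) (sym (lookup-⊖-≢ α (b≢p ∘ sym)))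

excess-⊖-≤ : ∀ {s} (α : Vec ℕ s) p u → lookup α p ≤ u → excess (α ⊖ p) u ≡ excess α u
excess-⊖-≤ α p u αp≤u = ∑-cong termwise
  where
  termwise : ∀ b → lookup (α ⊖ p) b ∸ u ≡ lookup α b ∸ u
  termwise b with b Fin.≟ p
  ... | no b≢p   = cong (_∸ u) (lookup-⊖-≢ α (b≢p ∘ sym))
  ... | yes refl rewrite lookup-⊖ α b | m≤n⇒m∸n≡0 αp≤u = m≤n⇒m∸n≡0 (≤-trans pred[n]≤n αp≤u)

excess-suc : ∀ {s} (α : Vec ℕ s) u → excess α u ≡ ∑ (λ b → ⟦ u <ᵇ lookup α b ⟧) + excess α (suc u)
excess-suc α u = trans (∑-cong λ b → drop (lookup α b) u) (∑-+ (λ b → ⟦ u <ᵇ lookup α b ⟧) (λ b → lookup α b ∸ suc u))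
  where
  drop : ∀ v u → v ∸ u ≡ ⟦ u <ᵇ v ⟧ + (v ∸ suc u)
  drop zero    zero    = refl
  drop zero    (suc u) = refl
  drop (suc v) zero    = refl
  drop (suc v) (suc u) = drop v u

-- If d is the top degree of g ∈ V_α in x₁, its coefficient there is harmonic for α ⊖ p, where p is the block
-- of rank d. A generator e_r(S) for α ⊖ p with S ∌ 1 is checked as follows, u being the size of the complement
-- of S in the remaining variables. If λ_p > u, then x₁^d e_r(S) = x₁^d e_r(S ∪ 1) - x₁^{d+1} e_{r-1}(S).
-- If λ_p ≤ u, then the number c of parts exceeding u is at most d, and x₁^d e_r(S) = ± x₁^{d-c} e_{r+c}(S) = 0
-- modulo the ideal.
harmonic-top : ∀ {n s} {α : Vec ℕ s} {F : Mon (suc n) → ℚ} d p → blockRank α p ≡ d →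
  (∀ m → F (suc d ∷ m) ≡ 0ℚ) → Harmonic α F → Harmonic (α ⊖ p) (F ∘ (d ∷_))
harmonic-top {n} {s} {α} {F} d p rank≡d above H = record { pow = λ i m → H.pow (suc i) (d ∷ m) ; elem = symm }
  where
  module H = Harmonic H
  symm : ∀ S r → ∣ S ∣ < r + excess (α ⊖ p) (n ∸ ∣ S ∣) → ∀ a → ES r S (λ A → F (d ∷ (a ⊕ A))) ≡ 0ℚ
  symm S r cond a with lookup α p ≤? n ∸ ∣ S ∣
  ... | no αp≰u = top r (H.elem (true ∷ S) r cond′ (d ∷ a))
    where
    cond′ : suc ∣ S ∣ < r + excess α (n ∸ ∣ S ∣)
    cond′ =
      subst (suc ∣ S ∣ <_) (trans (sym (+-suc r _)) (cong (r +_) (sym (excess-⊖-> α p (n ∸ ∣ S ∣) (≰⇒> αp≰u))))) (s≤s cond)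
    at-d : ∀ A → F ((d + 0) ∷ (a ⊕ A)) ≡ F (d ∷ (a ⊕ A))
    at-d A = cong (λ x → F (x ∷ (a ⊕ A))) (+-identityʳ d)
    top : ∀ r → ES r (true ∷ S) (λ A → F ((d ∷ a) ⊕ A)) ≡ 0ℚ → ES r S (λ A → F (d ∷ (a ⊕ A))) ≡ 0ℚ
    top zero    eq = trans (sym (ES-cong zero S at-d)) eq
    top (suc r) eq = begin
      ES (suc r) S (λ A → F (d ∷ (a ⊕ A)))       ≡⟨ ES-cong (suc r) S at-d ⟨
      ES (suc r) S (λ A → F ((d + 0) ∷ (a ⊕ A))) ≡⟨ ℚP.+-identityˡ _ ⟨
      0ℚ ℚ.+ ES (suc r) S (λ A → F ((d + 0) ∷ (a ⊕ A)))
        ≡⟨ cong (ℚ._+ ES (suc r) S (λ A → F ((d + 0) ∷ (a ⊕ A)))) (ES-zero r S (λ {A} _ → trans (cong (λ x → F (x ∷ (a ⊕ A))) (+-comm d 1)) (above (a ⊕ A)))) ⟨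
      ES r S (λ A → F ((d + 1) ∷ (a ⊕ A))) ℚ.+ ES (suc r) S (λ A → F ((d + 0) ∷ (a ⊕ A))) ≡⟨ eq ⟩
      0ℚ ∎
      where open ≡-Reasoning
  ... | yes αp≤u = descend c d r (subst (c ≤_) rank≡d (blockRank-lower α p u αp≤u)) cond₀
    (subst (∣ S ∣ <_) (trans (cong (r +_) (excess-suc α u)) (sym (+-assoc r c _))) cond₀)
    where
    u c : ℕ
    u = n ∸ ∣ S ∣
    c = ∑ (λ b → ⟦ u <ᵇ lookup α b ⟧)
    cond₀ : ∣ S ∣ < r + excess α u
    cond₀ = subst (λ e → ∣ S ∣ < r + e) (excess-⊖-≤ α p u αp≤u) cond
    G : ℕ → ℕ → ℚ
    G i r = ES r S (λ A → F (i ∷ (a ⊕ A)))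
    at : ∀ i r → ES r S (λ A → F ((i + 0) ∷ (a ⊕ A))) ≡ G i r
    at i r = ES-cong r S λ A → cong (λ x → F (x ∷ (a ⊕ A))) (+-identityʳ i)
    -- One trade: x₁^i e_{r+1}(S ∪ 1) splits into x₁^{i+1} e_r(S) and x₁^i e_{r+1}(S). Both the set
    -- and the degree have grown by one and the complement still has size u, so the generator is
    -- available.
    exchange : ∀ i r → ∣ S ∣ < r + excess α u → G (suc i) r ℚ.+ G i (suc r) ≡ 0ℚ
    exchange i r lt = trans (cong₂ ℚ._+_
      (sym (ES-cong r S λ A → cong (λ x → F (x ∷ (a ⊕ A))) (+-comm i 1))) (sym (at i (suc r))))
      (H.elem (true ∷ S) (suc r) (s≤s lt) (i ∷ a))
    -- Among all n + 1 variables the complement of S has u + 1 elements, so the bound for a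
    -- generator without x₁ involves `excess α (suc u)`. This is smaller than `excess α u` by c,
    -- which the c trades make up for.
    final : ∀ i r → ∣ S ∣ < r + excess α (suc u) → G i r ≡ 0ℚ
    final i r lt = trans (sym (at i r)) (drop r (H.elem (false ∷ S) r
      (subst (λ v → ∣ S ∣ < r + excess α v) (sym (+-∸-assoc 1 (SubsetP.∣p∣≤n S))) lt) (i ∷ a)))
      where
      drop : ∀ r → ES r (false ∷ S) (λ A → F ((i ∷ a) ⊕ A)) ≡ 0ℚ → ES r S (λ A → F ((i + 0) ∷ (a ⊕ A))) ≡ 0ℚ
      drop zero    eq = eq
      drop (suc r) eq = eq
    descend : ∀ c i r → c ≤ i → ∣ S ∣ < r + excess α u → ∣ S ∣ < r + c + excess α (suc u) → G i r ≡ 0ℚ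
    descend zero    i       r _         _  lt =
      final i r (subst (λ x → ∣ S ∣ < x + excess α (suc u)) (+-identityʳ r) lt)
    descend (suc c) (suc i) r (s≤s c≤i) l₀ lt = begin
      G (suc i) r                     ≡⟨ ℚP.+-identityʳ _ ⟨
      G (suc i) r ℚ.+ 0ℚ
        ≡⟨ cong (G (suc i) r ℚ.+_) (descend c i (suc r) c≤i (m<n⇒m<1+n l₀) (subst (λ x → ∣ S ∣ < x + excess α (suc u)) (+-suc r c) lt)) ⟨
      G (suc i) r ℚ.+ G i (suc r)     ≡⟨ exchange i r l₀ ⟩
      0ℚ                              ∎
      where open ≡-Reasoning

leading-is-code : ∀ {n s} {α : Vec ℕ s} {F : Mon n → ℚ} {m} → Harmonic α F → IsLeading F m →
  ∃ λ (σ : OP n s α) → ∀ x → code σ x ≡ lookup m x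
leading-is-code {zero} {s} {α} {F} {[]} H (nonzero , _) with find (λ b → 0 <ᵇ lookup α b)
... | inj₁ h = record { blk = [] ; big = λ b → ≮⇒≥ (<ᵇ⇒≮ 0 _ (h b)) } , λ ()
-- A positive part makes e_0(∅) = 1 a generator.
... | inj₂ (b , h) = contradiction
  (Harmonic.elem H [] 0 (<-≤-trans (<ᵇ⇒<′ 0 (lookup α b) h) (∑-term (λ b → lookup α b ∸ 0) b)) []) nonzero
leading-is-code {suc n} {s} {α} {F} {d ∷ m} H (nonzero , above) with d <? s
... | no d≮s  = contradiction (Harmonic.pow H zero (d ∷ m) (≮⇒≥ d≮s)) nonzero
... | yes d<s with blockRank-surjective α d<s
-- An exponent whose first entry exceeds d is lexicographically larger than d ∷ m, so d is the top
-- degree in x₁.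
...   | p , rank≡d with leading-is-code {m = m} (harmonic-top d p rank≡d (λ m′ → above _ (this ≤-refl refl)) H)
                          (nonzero , λ m′ lt → above _ (next refl lt))
...     | τ , eq = σ⁺ p τ h , λ { zero → trans (code-zero p τ h) rank≡d ; (suc x) → trans (code-suc p τ h x) (eq x) }
  where h = big (consOP {α = α} p τ)

-- Polynomials as linear functionals

Σℚ : ∀ {A : Set} → List A → (A → ℚ) → ℚ
Σℚ []       f = 0ℚ
Σℚ (x ∷ xs) f = f x ℚ.+ Σℚ xs f

Σℚ-cong : ∀ {A : Set} (xs : List A) {f g : A → ℚ} → (∀ x → f x ≡ g x) → Σℚ xs f ≡ Σℚ xs g
Σℚ-cong []       h = refl
Σℚ-cong (x ∷ xs) h = cong₂ ℚ._+_ (h x) (Σℚ-cong xs h)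

Σℚ-zero : ∀ {A : Set} (xs : List A) {f : A → ℚ} → (∀ x → x ∈ xs → f x ≡ 0ℚ) → Σℚ xs f ≡ 0ℚ
Σℚ-zero []       h = refl
Σℚ-zero (x ∷ xs) h = cong₂ ℚ._+_ (h x (here refl)) (Σℚ-zero xs λ y y∈ → h y (there y∈))

Σℚ-++ : ∀ {A : Set} (xs ys : List A) (f : A → ℚ) → Σℚ (xs ++ ys) f ≡ Σℚ xs f ℚ.+ Σℚ ys f
Σℚ-++ []       ys f = sym (ℚP.+-identityˡ _)
Σℚ-++ (x ∷ xs) ys f = trans (cong (f x ℚ.+_) (Σℚ-++ xs ys f)) (sym (ℚP.+-assoc (f x) _ _))

Σℚ-map : ∀ {A B : Set} (g : A → B) (xs : List A) (f : B → ℚ) → Σℚ (map g xs) f ≡ Σℚ xs (f ∘ g)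
Σℚ-map g []       f = refl
Σℚ-map g (x ∷ xs) f = cong (f (g x) ℚ.+_) (Σℚ-map g xs f)

Σℚ-concatMap : ∀ {A B : Set} (g : A → List B) (xs : List A) (f : B → ℚ) →
  Σℚ (concatMap g xs) f ≡ Σℚ xs (λ x → Σℚ (g x) f)
Σℚ-concatMap g []       f = refl
Σℚ-concatMap g (x ∷ xs) f = trans (Σℚ-++ (g x) (concatMap g xs) f) (cong (Σℚ (g x) f ℚ.+_) (Σℚ-concatMap g xs f))

Σℚ-*ˡ : ∀ {A : Set} c (xs : List A) (f : A → ℚ) → Σℚ xs (λ x → c ℚ.* f x) ≡ c ℚ.* Σℚ xs f
Σℚ-*ˡ c []       f = sym (ℚP.*-zeroʳ c)
Σℚ-*ˡ c (x ∷ xs) f = trans (cong (c ℚ.* f x ℚ.+_) (Σℚ-*ˡ c xs f)) (sym (ℚP.*-distribˡ-+ c (f x) _))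

Σℚ-+ : ∀ {A : Set} (xs : List A) (f g : A → ℚ) → Σℚ xs (λ x → f x ℚ.+ g x) ≡ Σℚ xs f ℚ.+ Σℚ xs g
Σℚ-+ []       f g = refl
Σℚ-+ (x ∷ xs) f g = trans (cong (f x ℚ.+ g x ℚ.+_) (Σℚ-+ xs f g)) (interchange (f x) (g x) (Σℚ xs f) (Σℚ xs g))
  where
  open Data.Rational.Solver.+-*-Solver
  interchange : ∀ a b c d → (a ℚ.+ b) ℚ.+ (c ℚ.+ d) ≡ (a ℚ.+ c) ℚ.+ (b ℚ.+ d)
  interchange = solve 4 (λ a b c d → (a :+ b) :+ (c :+ d) := (a :+ c) :+ (b :+ d)) refl

infix 4 _≟ᵐ_
_≟ᵐ_ : ∀ {n} (u v : Mon n) → Dec (u ≡ v)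
_≟ᵐ_ = VecP.≡-dec ℕ._≟_

at : ∀ {n} → Mon n → ℚ × Mon n → ℚ
at m t = if ⌊ proj₂ t ≟ᵐ m ⌋ then proj₁ t else 0ℚ

at-≡ : ∀ {n} (m : Mon n) c {e} → e ≡ m → at m (c , e) ≡ c
at-≡ m c {e} eq with e ≟ᵐ m
... | yes _ = refl
... | no ne = contradiction eq ne

at-≢ : ∀ {n} (m : Mon n) c {e} → e ≢ m → at m (c , e) ≡ 0ℚ
at-≢ m c {e} ne with e ≟ᵐ m
... | yes eq = contradiction eq ne
... | no _   = refl

coeff-Σ : ∀ {n} (p : Poly n) m → coeff p m ≡ Σℚ p (at m)
coeff-Σ []            m = refl
coeff-Σ ((c , e) ∷ p) m with e ≟ᵐ m
... | yes _ = cong (c ℚ.+_) (coeff-Σ p m)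
... | no _  = trans (coeff-Σ p m) (sym (ℚP.+-identityˡ _))

coeff-∷ : ∀ {n} t (p : Poly n) m → coeff (t ∷ p) m ≡ at m t ℚ.+ coeff p m
coeff-∷ t p m = trans (coeff-Σ (t ∷ p) m) (cong (at m t ℚ.+_) (sym (coeff-Σ p m)))

coeff-++ : ∀ {n} (p q : Poly n) m → coeff (p ++ q) m ≡ coeff p m ℚ.+ coeff q m
coeff-++ p q m = trans (coeff-Σ (p ++ q) m) (trans (Σℚ-++ p q (at m)) (sym (cong₂ ℚ._+_ (coeff-Σ p m) (coeff-Σ q m))))

coeff-scale : ∀ {n} c (p : Poly n) m → coeff (scaleₚ c p) m ≡ c ℚ.* coeff p m
coeff-scale c p m = begin
  coeff (scaleₚ c p) m                                  ≡⟨ coeff-Σ (scaleₚ c p) m ⟩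
  Σℚ (scaleₚ c p) (at m)                                ≡⟨ Σℚ-map _ p (at m) ⟩
  Σℚ p (λ t → at m (c ℚ.* proj₁ t , proj₂ t))           ≡⟨ Σℚ-cong p scale-at ⟩
  Σℚ p (λ t → c ℚ.* at m t)                             ≡⟨ Σℚ-*ˡ c p (at m) ⟩
  c ℚ.* Σℚ p (at m)                                     ≡⟨ cong (c ℚ.*_) (coeff-Σ p m) ⟨
  c ℚ.* coeff p m                                       ∎
  where
  open ≡-Reasoning
  scale-at : ∀ t → at m (c ℚ.* proj₁ t , proj₂ t) ≡ c ℚ.* at m t
  scale-at (x , e) with e ≟ᵐ m
  ... | yes _ = refl
  ... | no _  = sym (ℚP.*-zeroʳ c)

coeff-sum : ∀ {n} {A : Set} (f : A → Poly n) (xs : List A) m → coeff (sumₚ (map f xs)) m ≡ Σℚ xs (λ x → coeff (f x) m)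
coeff-sum f []       m = refl
coeff-sum f (x ∷ xs) m = trans (coeff-++ (f x) (sumₚ (map f xs)) m) (cong (coeff (f x) m ℚ.+_) (coeff-sum f xs m))

-- The linear functional on polynomials with x^e ↦ F e.
eval : ∀ {n} → Poly n → (Mon n → ℚ) → ℚ
eval p F = Σℚ p (λ t → proj₁ t ℚ.* F (proj₂ t))

-- Exponents may recur in the list of terms. Summing over a duplicate-free list of exponents
-- regroups the terms into coefficients, whence `eval` depends on the polynomial only up to ≈ₚ.
eval-support : ∀ {n} (U : List (Mon n)) → Unique U → (p : Poly n) → (∀ t → t ∈ p → proj₂ t ∈ U) → ∀ F →
  eval p F ≡ Σℚ U (λ u → coeff p u ℚ.* F u)
eval-support U uniq [] sub F = sym (Σℚ-zero U λ u _ → ℚP.*-zeroˡ (F u))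
eval-support U uniq (t ∷ p) sub F = begin
  proj₁ t ℚ.* F (proj₂ t) ℚ.+ eval p F
    ≡⟨ cong₂ ℚ._+_ (sym (single U uniq (sub t (here refl)))) (eval-support U uniq p (λ t′ t′∈ → sub t′ (there t′∈)) F) ⟩
  Σℚ U (λ u → at u t ℚ.* F u) ℚ.+ Σℚ U (λ u → coeff p u ℚ.* F u)
    ≡⟨ Σℚ-+ U (λ u → at u t ℚ.* F u) (λ u → coeff p u ℚ.* F u) ⟨
  Σℚ U (λ u → at u t ℚ.* F u ℚ.+ coeff p u ℚ.* F u)
    ≡⟨ Σℚ-cong U (λ u → sym (trans (cong (ℚ._* F u) (coeff-∷ t p u)) (ℚP.*-distribʳ-+ (F u) (at u t) (coeff p u)))) ⟩
  Σℚ U (λ u → coeff (t ∷ p) u ℚ.* F u) ∎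
  where
  open ≡-Reasoning
  away : ∀ U → All (proj₂ t ≢_) U → Σℚ U (λ u → at u t ℚ.* F u) ≡ 0ℚ
  away []      []        = refl
  away (u ∷ U) (ne ∷ al) = cong₂ ℚ._+_ (trans (cong (ℚ._* F u) (at-≢ u (proj₁ t) ne)) (ℚP.*-zeroˡ (F u))) (away U al)
  single : ∀ U → Unique U → proj₂ t ∈ U → Σℚ U (λ u → at u t ℚ.* F u) ≡ proj₁ t ℚ.* F (proj₂ t)
  single (u ∷ U) (u∉ ∷ _) (here refl) =
    trans (cong₂ ℚ._+_ (cong (ℚ._* F u) (at-≡ u (proj₁ t) refl)) (away U u∉)) (ℚP.+-identityʳ _)
  single (u ∷ U) (u∉ ∷ uniq) (there t∈) =
    trans (cong₂ ℚ._+_ (trans (cong (ℚ._* F u) (at-≢ u (proj₁ t) (λ eq → All.lookup u∉ t∈ (sym eq)))) (ℚP.*-zeroˡ (F u)))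
                       (single U uniq t∈)) (ℚP.+-identityˡ _)

eval-≈ : ∀ {n} (p q : Poly n) → p ≈ₚ q → ∀ F → eval p F ≡ eval q F
eval-≈ p q p≈q F = begin
  eval p F                           ≡⟨ eval-support U uniq p (λ t t∈ → covers (∈-++⁺ˡ t∈)) F ⟩
  Σℚ U (λ u → coeff p u ℚ.* F u)     ≡⟨ Σℚ-cong U (λ u → cong (ℚ._* F u) (p≈q u)) ⟩
  Σℚ U (λ u → coeff q u ℚ.* F u)     ≡⟨ eval-support U uniq q (λ t t∈ → covers (∈-++⁺ʳ p t∈)) F ⟨
  eval q F                           ∎
  where
  open ≡-Reasoning
  U = List.deduplicate _≟ᵐ_ (map proj₂ (p ++ q))
  uniq : Unique U
  uniq = UniqueP.deduplicate-! _≟ᵐ_ (map proj₂ (p ++ q))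
  covers : ∀ {t} → t ∈ p ++ q → proj₂ t ∈ U
  covers t∈ = ∈-deduplicate⁺ _≟ᵐ_ (∈-map⁺ proj₂ t∈)

eval-sum : ∀ {n} {A : Set} (f : A → Poly n) (xs : List A) F → eval (sumₚ (map f xs)) F ≡ Σℚ xs (λ x → eval (f x) F)
eval-sum f []       F = refl
eval-sum f (x ∷ xs) F = trans (Σℚ-++ (f x) (sumₚ (map f xs)) _) (cong (eval (f x) F ℚ.+_) (eval-sum f xs F))

eval-monomial : ∀ {n} (e : Mon n) F → eval (monomial e) F ≡ F e
eval-monomial e F = trans (ℚP.+-identityʳ _) (ℚP.*-identityˡ (F e))

eval-* : ∀ {n} (p q : Poly n) F → eval (p *ₚ q) F ≡ eval p (λ a → eval q (λ e → F (a ⊕ e)))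
eval-* p q F = trans (Σℚ-concatMap _ p _) (Σℚ-cong p λ t → begin
  Σℚ (map (λ u → proj₁ t ℚ.* proj₁ u , proj₂ t ⊕ proj₂ u) q) (λ v → proj₁ v ℚ.* F (proj₂ v))
    ≡⟨ Σℚ-map _ q _ ⟩
  Σℚ q (λ u → proj₁ t ℚ.* proj₁ u ℚ.* F (proj₂ t ⊕ proj₂ u))
    ≡⟨ Σℚ-cong q (λ u → ℚP.*-assoc (proj₁ t) (proj₁ u) _) ⟩
  Σℚ q (λ u → proj₁ t ℚ.* (proj₁ u ℚ.* F (proj₂ t ⊕ proj₂ u)))
    ≡⟨ Σℚ-*ˡ (proj₁ t) q _ ⟩
  proj₁ t ℚ.* eval q (λ e → F (proj₂ t ⊕ e)) ∎)
  where open ≡-Reasoning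

-- Differentiation and divided power coefficients

ℕ→ℚ-* : ∀ a b → ℕ→ℚ (a * b) ≡ ℕ→ℚ a ℚ.* ℕ→ℚ b
ℕ→ℚ-* a b = ℚP.toℚᵘ-injective (begin
  ℚ.toℚᵘ (ℕ→ℚ (a * b))                       ≈⟨ ℚP.toℚᵘ-fromℚᵘ (ℚᵘ.mkℚᵘ (ℤ.+ (a * b)) 0) ⟩
  ℚᵘ.mkℚᵘ (ℤ.+ (a * b)) 0                     ≡⟨ cong (λ x → ℚᵘ.mkℚᵘ x 0) (ℤP.pos-* a b) ⟩
  ℚᵘ.mkℚᵘ (ℤ.+ a) 0 ℚᵘ.* ℚᵘ.mkℚᵘ (ℤ.+ b) 0     ≈⟨ ℚᵘP.*-cong (ℚP.toℚᵘ-fromℚᵘ (ℚᵘ.mkℚᵘ (ℤ.+ a) 0)) (ℚP.toℚᵘ-fromℚᵘ (ℚᵘ.mkℚᵘ (ℤ.+ b) 0)) ⟨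
  ℚ.toℚᵘ (ℕ→ℚ a) ℚᵘ.* ℚ.toℚᵘ (ℕ→ℚ b)           ≈⟨ ℚP.toℚᵘ-homo-* (ℕ→ℚ a) (ℕ→ℚ b) ⟨
  ℚ.toℚᵘ (ℕ→ℚ a ℚ.* ℕ→ℚ b)                   ∎)
  where open ℚᵘP.≃-Reasoning

ℕ→ℚ≢0 : ∀ a → ℕ→ℚ (suc a) ≢ 0ℚ
ℕ→ℚ≢0 a eq with ℚᵘP.≃-trans (ℚᵘP.≃-sym (ℚP.toℚᵘ-fromℚᵘ (ℚᵘ.mkℚᵘ (ℤ.+ suc a) 0))) (ℚᵘP.≃-reflexive (cong ℚ.toℚᵘ eq))
... | ℚᵘ.*≡* e with () ← ℤP.+-injective e

facℕ : ∀ {n} → Mon n → ℕ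
facℕ []      = 1
facℕ (x ∷ m) = x ! * facℕ m

facℕ>0 : ∀ {n} (m : Mon n) → 0 < facℕ m
facℕ>0 []      = s≤s z≤n
facℕ>0 (x ∷ m) = *-mono-< (1≤n! x) (facℕ>0 m)

fac : ∀ {n} → Mon n → ℚ
fac m = ℕ→ℚ (facℕ m)

fac≢0 : ∀ {n} (m : Mon n) → fac m ≢ 0ℚ
fac≢0 m with facℕ m | facℕ>0 m
... | suc k | _ = ℕ→ℚ≢0 k

fac-replicate : ∀ n → facℕ (replicate n 0) ≡ 1
fac-replicate zero    = refl
fac-replicate (suc n) = trans (+-identityʳ _) (fac-replicate n)

falling : ∀ {n} → Mon n → Mon n → ℕ
falling e f = product (Vec.toList (zipWith _P_ f e))

P-! : ∀ x y → ((x + y) P y) * x ! ≡ (x + y) !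
P-! x y = begin
  ((x + y) P y) * x !                 ≡⟨ cong₂ _*_ (nPk≡n!/[n∸k]! (m≤n+m y x)) (cong _! (sym (m+n∸n≡m x y))) ⟩
  ((x + y) ! / (x + y ∸ y) !) * (x + y ∸ y) ! ≡⟨ m/n*n≡m (m≤n⇒m!∣n! (m∸n≤m (x + y) y)) ⟩
  (x + y) !                           ∎
  where
  open ≡-Reasoning
  instance _ = (x + y ∸ y) !≢0

falling-fac : ∀ {n} (m e : Mon n) → falling e (m ⊕ e) * facℕ m ≡ facℕ (m ⊕ e)
falling-fac []      []      = refl
falling-fac (x ∷ m) (y ∷ e) = trans ([m*n]*[o*p]≡[m*o]*[n*p] ((x + y) P y) (falling e (m ⊕ e)) (x !) (facℕ m))
  (cong₂ _*_ (P-! x y) (falling-fac m e))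

-- Truncated subtraction loses something only if some e_i exceeds f_i, and then the i-th factor is a
-- falling factorial that has run through 0.
falling-zero : ∀ {n} (e f : Mon n) → zipWith _∸_ f e ⊕ e ≢ f → falling e f ≡ 0
falling-zero []      []      ne = contradiction refl ne
falling-zero (y ∷ e) (x ∷ f) ne with y ≤? x
... | yes y≤x = trans (cong ((x P y) *_) (falling-zero e f λ eq → ne (cong₂ _∷_ (m∸n+n≡m y≤x) eq))) (*-zeroʳ (x P y))
... | no y≰x  = cong (_* falling e f) (k>n⇒nPk≡0 (≰⇒> y≰x))

⊕-∸ : ∀ {n} (m e : Mon n) → zipWith _∸_ (m ⊕ e) e ≡ m
⊕-∸ []      []      = refl
⊕-∸ (x ∷ m) (y ∷ e) = cong₂ _∷_ (m+n∸n≡m x y) (⊕-∸ m e)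

D : ∀ {n} → Poly n → Mon n → ℚ
D g m = fac m ℚ.* coeff g m

-- The factor (m+e)!/m! produced by ∂^e turns m! into (m+e)!, the normalisation at the shifted
-- exponent. A term of g that reaches x^m only through truncation has coefficient 0.
D-⊙ : ∀ {n} (f g : Poly n) m → D (f ⊙ g) m ≡ eval f (λ e → D g (m ⊕ e))
D-⊙ f g m = begin
  fac m ℚ.* coeff (f ⊙ g) m
    ≡⟨ cong (fac m ℚ.*_) (trans (coeff-Σ (f ⊙ g) m) (Σℚ-concatMap _ f (at m))) ⟩
  fac m ℚ.* Σℚ f (λ t → Σℚ (map (der t) g) (at m))
    ≡⟨ Σℚ-*ˡ (fac m) f _ ⟨
  Σℚ f (λ t → fac m ℚ.* Σℚ (map (der t) g) (at m))
    ≡⟨ Σℚ-cong f inner ⟩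
  eval f (λ e → D g (m ⊕ e)) ∎
  where
  open ≡-Reasoning
  der : ℚ × Mon _ → ℚ × Mon _ → ℚ × Mon _
  der t u = proj₁ t ℚ.* proj₁ u ℚ.* proj₁ (dmon (proj₂ t) (proj₂ u)) , proj₂ (dmon (proj₂ t) (proj₂ u))
  open Data.Rational.Solver.+-*-Solver
  shuffle : ∀ a c x p → a ℚ.* (c ℚ.* x ℚ.* p) ≡ c ℚ.* (p ℚ.* a ℚ.* x)
  shuffle = solve 4 (λ a c x p → a :* (c :* x :* p) := c :* (p :* a :* x)) refl
  term : ∀ t u → fac m ℚ.* at m (der t u) ≡ proj₁ t ℚ.* (fac (m ⊕ proj₂ t) ℚ.* at (m ⊕ proj₂ t) u)
  term (c , e) (x , f) with f ≟ᵐ m ⊕ e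
  ... | yes refl = begin
    fac m ℚ.* at m (c ℚ.* x ℚ.* ℕ→ℚ (falling e (m ⊕ e)) , zipWith _∸_ (m ⊕ e) e)
      ≡⟨ cong (fac m ℚ.*_) (at-≡ m _ (⊕-∸ m e)) ⟩
    fac m ℚ.* (c ℚ.* x ℚ.* ℕ→ℚ (falling e (m ⊕ e)))  ≡⟨ shuffle (fac m) c x _ ⟩
    c ℚ.* (ℕ→ℚ (falling e (m ⊕ e)) ℚ.* fac m ℚ.* x)
      ≡⟨ cong (λ y → c ℚ.* (y ℚ.* x)) (trans (sym (ℕ→ℚ-* (falling e (m ⊕ e)) (facℕ m))) (cong ℕ→ℚ (falling-fac m e))) ⟩
    c ℚ.* (fac (m ⊕ e) ℚ.* x) ∎
  ... | no ne with zipWith _∸_ f e ≟ᵐ m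
  ...   | no _ = trans (ℚP.*-zeroʳ (fac m)) (sym (trans (cong (c ℚ.*_) (ℚP.*-zeroʳ (fac (m ⊕ e)))) (ℚP.*-zeroʳ c)))
  ...   | yes refl rewrite falling-zero e f (λ eq → ne (sym eq)) =
    trans (shuffle (fac m) c x 0ℚ) (cong (c ℚ.*_) (trans (cong (ℚ._* x) (ℚP.*-zeroˡ (fac m))) (trans (ℚP.*-zeroˡ x) (sym (ℚP.*-zeroʳ (fac (m ⊕ e)))))))
  inner : ∀ t → fac m ℚ.* Σℚ (map (der t) g) (at m) ≡ proj₁ t ℚ.* D g (m ⊕ proj₂ t)
  inner t = begin
    fac m ℚ.* Σℚ (map (der t) g) (at m)                     ≡⟨ cong (fac m ℚ.*_) (Σℚ-map (der t) g (at m)) ⟩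
    fac m ℚ.* Σℚ g (λ u → at m (der t u))                   ≡⟨ Σℚ-*ˡ (fac m) g _ ⟨
    Σℚ g (λ u → fac m ℚ.* at m (der t u))                   ≡⟨ Σℚ-cong g (term t) ⟩
    Σℚ g (λ u → proj₁ t ℚ.* (fac (m ⊕ proj₂ t) ℚ.* at (m ⊕ proj₂ t) u)) ≡⟨ Σℚ-*ˡ (proj₁ t) g _ ⟩
    proj₁ t ℚ.* Σℚ g (λ u → fac (m ⊕ proj₂ t) ℚ.* at (m ⊕ proj₂ t) u)
      ≡⟨ cong (proj₁ t ℚ.*_) (Σℚ-*ˡ (fac (m ⊕ proj₂ t)) g _) ⟩
    proj₁ t ℚ.* (fac (m ⊕ proj₂ t) ℚ.* Σℚ g (at (m ⊕ proj₂ t)))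
      ≡⟨ cong (λ y → proj₁ t ℚ.* (fac (m ⊕ proj₂ t) ℚ.* y)) (coeff-Σ g (m ⊕ proj₂ t)) ⟨
    proj₁ t ℚ.* D g (m ⊕ proj₂ t)                           ∎

⊕-identityˡ : ∀ {n} (m : Mon n) → replicate n 0 ⊕ m ≡ m
⊕-identityˡ = VecP.zipWith-identityˡ +-identityˡ

⊕-identityʳ : ∀ {n} (m : Mon n) → m ⊕ replicate n 0 ≡ m
⊕-identityʳ = VecP.zipWith-identityʳ +-identityʳ

pairing-eval : ∀ {n} (f g : Poly n) → ⟨ f , g ⟩ ≡ eval f (D g)
pairing-eval {n} f g = begin
  ⟨ f , g ⟩                                    ≡⟨ ℚP.*-identityˡ _ ⟨
  1ℚ ℚ.* ⟨ f , g ⟩                             ≡⟨ cong (λ k → ℕ→ℚ k ℚ.* ⟨ f , g ⟩) (fac-replicate n) ⟨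
  D (f ⊙ g) (replicate n 0)                    ≡⟨ D-⊙ f g (replicate n 0) ⟩
  eval f (λ e → D g (replicate n 0 ⊕ e))
    ≡⟨ Σℚ-cong f (λ t → cong (λ e → proj₁ t ℚ.* D g e) (⊕-identityˡ (proj₂ t))) ⟩
  eval f (D g)                                 ∎
  where open ≡-Reasoning

-- Monomial multiples x^a γ of the generators span the ideal linearly, so orthogonality to them is
-- all of InV; multiplication by x^a becomes the shift by a.
InV⇒ : ∀ {n s} {α : Vec ℕ s} {g} → InV n s α g → (γ : Gen n s α) → ∀ a → eval (genPoly γ) (λ e → D g (a ⊕ e)) ≡ 0ℚ
InV⇒ {g = g} g∈V γ a = begin
  eval (genPoly γ) (λ e → D g (a ⊕ e))
    ≡⟨ eval-monomial a (λ a → eval (genPoly γ) (λ e → D g (a ⊕ e))) ⟨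
  eval (monomial a) (λ a → eval (genPoly γ) (λ e → D g (a ⊕ e))) ≡⟨ eval-* (monomial a) (genPoly γ) (D g) ⟨
  eval (monomial a *ₚ genPoly γ) (D g)                       ≡⟨ pairing-eval (monomial a *ₚ genPoly γ) g ⟨
  ⟨ monomial a *ₚ genPoly γ , g ⟩
    ≡⟨ g∈V (monomial a *ₚ genPoly γ) ((monomial a , γ) ∷ [] , λ m → cong (λ p → coeff p m) (sym (ListP.++-identityʳ (monomial a *ₚ genPoly γ)))) ⟩
  0ℚ                                                         ∎
  where open ≡-Reasoning

InV⇐ : ∀ {n s} {α : Vec ℕ s} {g} → (∀ (γ : Gen n s α) a → eval (genPoly γ) (λ e → D g (a ⊕ e)) ≡ 0ℚ) → InV n s α g
InV⇐ {g = g} h f (L , f≈) = begin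
  ⟨ f , g ⟩                                                            ≡⟨ pairing-eval f g ⟩
  eval f (D g)
    ≡⟨ eval-≈ f (sumₚ (map (λ t → proj₁ t *ₚ genPoly (proj₂ t)) L)) f≈ (D g) ⟩
  eval (sumₚ (map (λ t → proj₁ t *ₚ genPoly (proj₂ t)) L)) (D g)
    ≡⟨ eval-sum (λ t → proj₁ t *ₚ genPoly (proj₂ t)) L (D g) ⟩
  Σℚ L (λ t → eval (proj₁ t *ₚ genPoly (proj₂ t)) (D g))               ≡⟨ Σℚ-zero L (λ t _ → trans (eval-* (proj₁ t) (genPoly (proj₂ t)) (D g))
      (Σℚ-zero (proj₁ t) λ u _ → trans (cong (proj₁ u ℚ.*_) (h (proj₂ t) (proj₂ u))) (ℚP.*-zeroʳ (proj₁ u)))) ⟩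
  0ℚ                                                                   ∎
  where open ≡-Reasoning

-- Generators of the ideal as functionals

filterᵇ-tabulate : ∀ {A B : Set} {n} (p : B → Bool) (g : A → B) (f : Fin n → A) →
  filterᵇ p (List.tabulate (g ∘ f)) ≡ map g (filterᵇ (p ∘ g) (List.tabulate f))
filterᵇ-tabulate {n = zero}  p g f = refl
filterᵇ-tabulate {n = suc n} p g f with p (g (f zero))
... | true  = cong (g (f zero) ∷_) (filterᵇ-tabulate p g (f ∘ suc))
... | false = filterᵇ-tabulate p g (f ∘ suc)

elems-true : ∀ {n} (S : Subset n) → elems (true ∷ S) ≡ zero ∷ map suc (elems S)
elems-true S = cong (zero ∷_) (filterᵇ-tabulate (λ i → lookup (true ∷ S) i) suc id)

elems-false : ∀ {n} (S : Subset n) → elems (false ∷ S) ≡ map suc (elems S)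
elems-false S = filterᵇ-tabulate (λ i → lookup (false ∷ S) i) suc id

choose-map : ∀ {A B : Set} (g : A → B) d xs → choose d (map g xs) ≡ map (map g) (choose d xs)
choose-map g zero    xs       = refl
choose-map g (suc d) []       = refl
choose-map g (suc d) (x ∷ xs) = begin
  map (g x ∷_) (choose d (map g xs)) ++ choose (suc d) (map g xs)
    ≡⟨ cong₂ _++_ (cong (map (g x ∷_)) (choose-map g d xs)) (choose-map g (suc d) xs) ⟩
  map (g x ∷_) (map (map g) (choose d xs)) ++ map (map g) (choose (suc d) xs)
    ≡⟨ cong (_++ map (map g) (choose (suc d) xs)) (trans (sym (ListP.map-∘ (choose d xs))) (ListP.map-∘ (choose d xs))) ⟩
  map (map g) (map (x ∷_) (choose d xs)) ++ map (map g) (choose (suc d) xs)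
    ≡⟨ ListP.map-++ (map g) (map (x ∷_) (choose d xs)) (choose (suc d) xs) ⟨
  map (map g) (map (x ∷_) (choose d xs) ++ choose (suc d) xs) ∎
  where open ≡-Reasoning

ε : ∀ {n} → Fin n → ℕ → Mon n
ε i d = tabulate (λ j → if i ==F j then d else 0)

expo : ∀ {n} {A : Set} → (A → Mon n) → List A → Mon n
expo e []      = replicate _ 0
expo e (x ∷ T) = e x ⊕ expo e T

prod-monomial : ∀ {n} {A : Set} (e : A → Mon n) T → prodₚ (map (λ x → monomial (e x)) T) ≡ monomial (expo e T)
prod-monomial e []      = refl
prod-monomial e (x ∷ T) rewrite prod-monomial e T = refl

replicate-tabulate : ∀ n {x : ℕ} → tabulate {n = n} (λ _ → x) ≡ replicate n x
replicate-tabulate zero    = refl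
replicate-tabulate (suc n) = cong (_ ∷_) (replicate-tabulate n)

ε-zero : ∀ {n} d → ε (zero {n}) d ≡ d ∷ replicate n 0
ε-zero d = cong (d ∷_) (replicate-tabulate _)

ε-suc : ∀ {n} (i : Fin n) d → ε (suc i) d ≡ 0 ∷ ε i d
ε-suc i d = cong (0 ∷_) (VecP.tabulate-cong λ j → cong (λ b → if b then d else 0) (==F-suc i j))

expo-suc : ∀ {n} (T : List (Fin n)) → expo (λ i → ε i 1) (map suc T) ≡ 0 ∷ expo (λ i → ε i 1) T
expo-suc []      = refl
expo-suc (i ∷ T) = cong₂ _⊕_ (ε-suc i 1) (expo-suc T)

expo-zero : ∀ {n} (T : List (Fin n)) → expo (λ i → ε i 1) (zero ∷ map suc T) ≡ 1 ∷ expo (λ i → ε i 1) T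
expo-zero T = trans (cong₂ _⊕_ (ε-zero 1) (expo-suc T)) (cong (1 ∷_) (⊕-identityˡ _))

-- `choose` branches on whether the first element is taken, which is the recursion of `ES` along S;
-- the elements that follow are successors, hence the mutual induction with `Σ-choose-suc`.
Σ-choose : ∀ {n} d (S : Subset n) F → Σℚ (choose d (elems S)) (F ∘ expo (λ i → ε i 1)) ≡ ES d S F

Σ-choose-suc : ∀ {n} d (S : Subset n) F → Σℚ (choose d (map suc (elems S))) (F ∘ expo (λ i → ε i 1)) ≡ ES d S (F ∘ (0 ∷_))
Σ-choose-suc d S F = begin
  Σℚ (choose d (map suc (elems S))) (F ∘ expo (λ i → ε i 1))
    ≡⟨ cong (λ Ts → Σℚ Ts (F ∘ expo (λ i → ε i 1))) (choose-map suc d (elems S)) ⟩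
  Σℚ (map (map suc) (choose d (elems S))) (F ∘ expo (λ i → ε i 1)) ≡⟨ Σℚ-map (map suc) (choose d (elems S)) _ ⟩
  Σℚ (choose d (elems S)) (λ T → F (expo (λ i → ε i 1) (map suc T)))
    ≡⟨ Σℚ-cong (choose d (elems S)) (λ T → cong F (expo-suc T)) ⟩
  Σℚ (choose d (elems S)) ((F ∘ (0 ∷_)) ∘ expo (λ i → ε i 1)) ≡⟨ Σ-choose d S (F ∘ (0 ∷_)) ⟩
  ES d S (F ∘ (0 ∷_)) ∎
  where open ≡-Reasoning

Σ-choose zero    []          F = ℚP.+-identityʳ _
Σ-choose (suc d) []          F = refl
Σ-choose zero    (false ∷ S) F = Σ-choose-suc zero S F
Σ-choose (suc d) (false ∷ S) F =
  trans (cong (λ xs → Σℚ (choose (suc d) xs) (F ∘ expo (λ i → ε i 1))) (elems-false S)) (Σ-choose-suc (suc d) S F)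
Σ-choose zero    (true ∷ S)  F = Σ-choose-suc zero S F
Σ-choose (suc d) (true ∷ S)  F = begin
  Σℚ (choose (suc d) (elems (true ∷ S))) (F ∘ e)
    ≡⟨ cong (λ xs → Σℚ (choose (suc d) xs) (F ∘ e)) (elems-true S) ⟩
  Σℚ (map (zero ∷_) (choose d (map suc (elems S))) ++ choose (suc d) (map suc (elems S))) (F ∘ e)
    ≡⟨ Σℚ-++ (map (zero ∷_) (choose d (map suc (elems S)))) _ (F ∘ e) ⟩
  Σℚ (map (zero ∷_) (choose d (map suc (elems S)))) (F ∘ e) ℚ.+ Σℚ (choose (suc d) (map suc (elems S))) (F ∘ e)
    ≡⟨ cong₂ ℚ._+_ first (Σ-choose-suc (suc d) S F) ⟩
  ES d S (F ∘ (1 ∷_)) ℚ.+ ES (suc d) S (F ∘ (0 ∷_)) ∎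
  where
  open ≡-Reasoning
  e : ∀ {n} → List (Fin n) → Mon n
  e = expo (λ i → ε i 1)
  first : Σℚ (map (zero ∷_) (choose d (map suc (elems S)))) (F ∘ e) ≡ ES d S (F ∘ (1 ∷_))
  first = begin
    Σℚ (map (zero ∷_) (choose d (map suc (elems S)))) (F ∘ e)
      ≡⟨ Σℚ-map (zero ∷_) (choose d (map suc (elems S))) (F ∘ e) ⟩
    Σℚ (choose d (map suc (elems S))) (λ T → F (e (zero ∷ T)))
      ≡⟨ cong (λ Ts → Σℚ Ts (λ T → F (e (zero ∷ T)))) (choose-map suc d (elems S)) ⟩
    Σℚ (map (map suc) (choose d (elems S))) (λ T → F (e (zero ∷ T))) ≡⟨ Σℚ-map (map suc) (choose d (elems S)) _ ⟩
    Σℚ (choose d (elems S)) (λ T → F (e (zero ∷ map suc T)))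
      ≡⟨ Σℚ-cong (choose d (elems S)) (λ T → cong F (expo-zero T)) ⟩
    Σℚ (choose d (elems S)) (λ T → F (1 ∷ e T)) ≡⟨ Σ-choose d S (F ∘ (1 ∷_)) ⟩
    ES d S (F ∘ (1 ∷_)) ∎

eval-esym : ∀ {n} d (S : Subset n) F → eval (esym d S) F ≡ ES d S F
eval-esym d S F = begin
  eval (esym d S) F ≡⟨ eval-sum (λ T → prodₚ (map (λ i → xpow i 1) T)) (choose d (elems S)) F ⟩
  Σℚ (choose d (elems S)) (λ T → eval (prodₚ (map (λ i → xpow i 1) T)) F)
    ≡⟨ Σℚ-cong (choose d (elems S)) (λ T → trans (cong (λ p → eval p F) (prod-monomial (λ i → ε i 1) T)) (eval-monomial _ F)) ⟩
  Σℚ (choose d (elems S)) (F ∘ expo (λ i → ε i 1)) ≡⟨ Σ-choose d S F ⟩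
  ES d S F ∎
  where open ≡-Reasoning

-- Columns n, n - 1, ... are added one at a time. The bound on the parts says that no box lies
-- beyond column n, which settles m = 0.
tailConj-excess : ∀ {s} n (α : Vec ℕ s) → (∀ b → lookup α b ≤ n) → ∀ m → m ≤ n → tailConj n α m ≡ excess α (n ∸ m)
tailConj-excess n α α≤n zero    _   = sym (∑-zero λ b → m≤n⇒m∸n≡0 (α≤n b))
tailConj-excess n α α≤n (suc m) m<n = begin
  sum (map g (List.upTo (suc m)))           ≡⟨ cong (sum ∘ map g) (ListP.upTo-∷ʳ m) ⟨
  sum (map g (List.upTo m ++ m ∷ []))       ≡⟨ cong sum (ListP.map-++ g (List.upTo m) (m ∷ [])) ⟩
  sum (map g (List.upTo m) ++ g m ∷ [])     ≡⟨ sum-++ (map g (List.upTo m)) (g m ∷ []) ⟩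
  sum (map g (List.upTo m)) + (g m + 0)     ≡⟨ cong₂ _+_ (tailConj-excess n α α≤n m (<⇒≤ m<n)) (+-identityʳ (g m)) ⟩
  excess α (n ∸ m) + conj α (n ∸ m)         ≡⟨ +-comm (excess α (n ∸ m)) _ ⟩
  conj α (n ∸ m) + excess α (n ∸ m)         ≡⟨ cong (λ u → conj α u + excess α u) (+-∸-assoc 1 m<n) ⟩
  conj α (suc u) + excess α (suc u)         ≡⟨ cong (_+ excess α (suc u)) (count-∑ (λ b → suc u ≤ᵇ lookup α b)) ⟩
  ∑ (λ b → ⟦ u <ᵇ lookup α b ⟧) + excess α (suc u) ≡⟨ excess-suc α u ⟨
  excess α u                                ∎
  where
  open ≡-Reasoning
  g : ℕ → ℕ
  g t = conj α (n ∸ t)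
  u : ℕ
  u = n ∸ suc m

lookup-ε : ∀ {n} (i : Fin n) d → lookup (ε i d) i ≡ d
lookup-ε i d = trans (VecP.lookup∘tabulate _ i) (cong (λ b → if b then d else 0) (==F-refl i))

split-ε : ∀ {n} (m : Mon n) i s → s ≤ lookup m i → ∃ λ a → a ⊕ ε i s ≡ m
split-ε (x ∷ m) zero s s≤x = (x ∸ s) ∷ m , (begin
  ((x ∸ s) ∷ m) ⊕ ε zero s                   ≡⟨ cong (((x ∸ s) ∷ m) ⊕_) (ε-zero s) ⟩
  (x ∸ s + s) ∷ (m ⊕ replicate _ 0)          ≡⟨ cong₂ _∷_ (m∸n+n≡m s≤x) (⊕-identityʳ m) ⟩
  x ∷ m                                      ∎)
  where open ≡-Reasoning
split-ε (x ∷ m) (suc i) s s≤ with split-ε m i s s≤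
... | a , eq = x ∷ a , trans (cong ((x ∷ a) ⊕_) (ε-suc i s)) (cong₂ _∷_ (+-identityʳ x) eq)

lookup≤sum : ∀ {s} (α : Vec ℕ s) b → lookup α b ≤ Vec.sum α
lookup≤sum (x ∷ α) zero    = m≤m+n x _
lookup≤sum (x ∷ α) (suc b) = ≤-trans (lookup≤sum α b) (m≤n+m _ x)

module _ {n s} {α : Vec ℕ s} (α≤n : ∀ b → lookup α b ≤ n) where

  private
    tail≡ : ∀ (S : Subset n) → tailConj n α ∣ S ∣ ≡ excess α (n ∸ ∣ S ∣)
    tail≡ S = tailConj-excess n α α≤n ∣ S ∣ (SubsetP.∣p∣≤n S)

  InV⇒Harmonic : ∀ {g} → InV n s α g → Harmonic α (D g)
  InV⇒Harmonic {g} g∈V = record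
    { pow  = λ i m s≤ → let a , eq = split-ε m i s s≤ in
               trans (cong (D g) (sym eq)) (trans (sym (eval-monomial (ε i s) (λ e → D g (a ⊕ e)))) (InV⇒ {g =
                 g} g∈V (powGen i) a))
    ; elem = λ S d cond a → trans (sym (eval-esym d S (λ e → D g (a ⊕ e))))
               (InV⇒ {g = g} g∈V (eGen S d (subst (λ e → ∣ S ∣ < d + e) (sym (tail≡ S)) cond)) a)
    }

  Harmonic⇒InV : ∀ {g} → Harmonic α (D g) → InV n s α g
  Harmonic⇒InV {g} H = InV⇐ {g = g} λ where
    (powGen i) a → trans (eval-monomial (ε i s) (λ e → D g (a ⊕ e))) (Harmonic.pow H i (a ⊕ ε i s)
      (subst (s ≤_) (sym (trans (VecP.lookup-zipWith _+_ i a (ε i s)) (cong (lookup a i +_) (lookup-ε i s)))) (m≤n+m s _)))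
    (eGen S d cond) a → trans (eval-esym d S (λ e → D g (a ⊕ e)))
      (Harmonic.elem H S d (subst (λ e → ∣ S ∣ < d + e) (tail≡ S) cond) a)

-- Signs of permutations

less : ∀ {m} → ℕ → Vec ℕ m → ℕ
less a []      = 0
less a (b ∷ t) = ⟦ b <ᵇ a ⟧ + less a t

inv : ∀ {m} → Vec ℕ m → ℕ
inv []      = 0
inv (a ∷ t) = less a t + inv t

odd : ℕ → Bool
odd zero    = false
odd (suc m) = not (odd m)

odd-double : ∀ x y → odd (x + (y + y)) ≡ odd x
odd-double x zero    = cong odd (+-identityʳ x)
odd-double x (suc y) = begin
  odd (x + suc (y + suc y)) ≡⟨ cong (λ z → odd (x + suc z)) (+-suc y y) ⟩
  odd (x + suc (suc (y + y))) ≡⟨ cong odd (trans (+-suc x _) (cong suc (+-suc x _))) ⟩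
  not (not (odd (x + (y + y)))) ≡⟨ not-involutive _ ⟩
  odd (x + (y + y)) ≡⟨ odd-double x y ⟩
  odd x ∎
  where open ≡-Reasoning

less-update : ∀ {m} c (t : Vec ℕ m) k a → less c (t Vec.[ k ]≔ a) + ⟦ lookup t k <ᵇ c ⟧ ≡ less c t + ⟦ a <ᵇ c ⟧
less-update c (b ∷ t) zero    a = rotate ⟦ a <ᵇ c ⟧ (less c t) ⟦ b <ᵇ c ⟧
  where
  open Data.Nat.Solver.+-*-Solver using (solve; _:+_; _:*_; _:=_)
  rotate : ∀ x y z → x + y + z ≡ z + y + x
  rotate = solve 3 (λ x y z → x :+ y :+ z := z :+ y :+ x) refl
less-update c (b ∷ t) (suc k) a = trans (+-assoc ⟦ b <ᵇ c ⟧ _ _)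
  (trans (cong (⟦ b <ᵇ c ⟧ +_) (less-update c t k a)) (sym (+-assoc ⟦ b <ᵇ c ⟧ _ _)))

<ᵇ-total : ∀ {a b} → a ≢ b → ⟦ a <ᵇ b ⟧ + ⟦ b <ᵇ a ⟧ ≡ 1
<ᵇ-total {a} {b} a≢b with <-cmp a b
... | tri< lt _ gt rewrite <⇒<ᵇ′ lt | ≮⇒<ᵇ gt = refl
... | tri≈ _ eq _  = contradiction eq a≢b
... | tri> lt _ gt rewrite ≮⇒<ᵇ lt | <⇒<ᵇ′ gt = refl

-- If the exchanged entries are adjacent, every comparison except their own occurs twice in the sum.
-- Each entry c between them contributes an even number, which is the inductive step.
odd-exchange : ∀ {m} (t : Vec ℕ m) k a → (∀ i → lookup t i ≢ a) → (∀ i → i ≢ k → lookup t i ≢ lookup t k) →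
  odd (inv (a ∷ t) + inv (lookup t k ∷ t Vec.[ k ]≔ a)) ≡ true
odd-exchange (b ∷ t) zero a ≢a ≢b = begin
  odd (⟦ b <ᵇ a ⟧ + less a t + (less b t + inv t) + (⟦ a <ᵇ b ⟧ + less b t + (less a t + inv t)))
    ≡⟨ cong odd (regroup ⟦ b <ᵇ a ⟧ (less a t) (less b t) (inv t) ⟦ a <ᵇ b ⟧) ⟩
  odd ((⟦ b <ᵇ a ⟧ + ⟦ a <ᵇ b ⟧) + (less a t + less b t + inv t + (less a t + less b t + inv t)))
    ≡⟨ odd-double (⟦ b <ᵇ a ⟧ + ⟦ a <ᵇ b ⟧) (less a t + less b t + inv t) ⟩
  odd (⟦ b <ᵇ a ⟧ + ⟦ a <ᵇ b ⟧) ≡⟨ cong odd (<ᵇ-total (≢a zero)) ⟩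
  true ∎
  where
  open ≡-Reasoning
  open Data.Nat.Solver.+-*-Solver using (solve; _:+_; _:*_; _:=_)
  regroup : ∀ u la lb i v → u + la + (lb + i) + (v + lb + (la + i)) ≡ (u + v) + (la + lb + i + (la + lb + i))
  regroup =
    solve 5 (λ u la lb i v → u :+ la :+ (lb :+ i) :+ (v :+ lb :+ (la :+ i)) := (u :+ v) :+ (la :+ lb :+ i :+ (la :+ lb :+ i))) refl
odd-exchange (c ∷ t) (suc k) a ≢a ≢b = begin
  -- Adding 2⟦b < c⟧ completes the comparisons of c with a and of c with b, in both orders, to 1
  -- each; c then contributes 2 + 2 `less c t`.
  odd X ≡⟨ odd-double X ⟦ b <ᵇ c ⟧ ⟨
  odd (X + (⟦ b <ᵇ c ⟧ + ⟦ b <ᵇ c ⟧))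
    ≡⟨ cong odd (regroup ⟦ c <ᵇ a ⟧ (less a t) (less c t) (inv t) ⟦ c <ᵇ b ⟧ (less b t′) (less c t′) (inv t′) ⟦ b <ᵇ c ⟧) ⟩
  odd (Y + ((⟦ c <ᵇ b ⟧ + ⟦ b <ᵇ c ⟧) + (⟦ c <ᵇ a ⟧ + (less c t + (less c t′ + ⟦ b <ᵇ c ⟧)))))
    ≡⟨ cong (λ z → odd (Y + z)) (cong₂ _+_ (<ᵇ-total (≢b zero λ ())) (cong (λ z → ⟦ c <ᵇ a ⟧ + (less c t + z)) (less-update c t k a))) ⟩
  odd (Y + (1 + (⟦ c <ᵇ a ⟧ + (less c t + (less c t + ⟦ a <ᵇ c ⟧)))))
    ≡⟨ cong (λ z → odd (Y + (1 + z))) (shuffle ⟦ c <ᵇ a ⟧ (less c t) ⟦ a <ᵇ c ⟧) ⟩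
  odd (Y + (1 + ((⟦ c <ᵇ a ⟧ + ⟦ a <ᵇ c ⟧) + (less c t + less c t))))
    ≡⟨ cong (λ z → odd (Y + z)) (trans (cong (λ z → 1 + (z + (less c t + less c t))) (<ᵇ-total (≢a zero))) (sym (cong suc (+-suc (less c t) (less c t))))) ⟩
  odd (Y + (suc (less c t) + suc (less c t))) ≡⟨ odd-double Y (suc (less c t)) ⟩
  odd Y ≡⟨ odd-exchange t k a (≢a ∘ suc) (λ i i≢k → ≢b (suc i) (i≢k ∘ FinP.suc-injective)) ⟩
  true ∎
  where
  open ≡-Reasoning
  b = lookup t k
  t′ = t Vec.[ k ]≔ a
  X Y : ℕ
  X = ⟦ c <ᵇ a ⟧ + less a t + (less c t + inv t) + (⟦ c <ᵇ b ⟧ + less b t′ + (less c t′ + inv t′))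
  Y = less a t + inv t + (less b t′ + inv t′)
  open Data.Nat.Solver.+-*-Solver using (solve; _:+_; _:*_; _:=_)
  regroup : ∀ ca la lc i cb lb lc′ i′ bc → ca + la + (lc + i) + (cb + lb + (lc′ + i′)) + (bc + bc)
              ≡ (la + i + (lb + i′)) + ((cb + bc) + (ca + (lc + (lc′ + bc))))
  regroup = solve 9 (λ ca la lc i cb lb lc′ i′ bc → ca :+ la :+ (lc :+ i) :+ (cb :+ lb :+ (lc′ :+ i′)) :+ (bc :+ bc)
              := (la :+ i :+ (lb :+ i′)) :+ ((cb :+ bc) :+ (ca :+ (lc :+ (lc′ :+ bc))))) refl
  shuffle : ∀ ca lc ac → ca + (lc + (lc + ac)) ≡ (ca + ac) + (lc + lc)
  shuffle = solve 3 (λ ca lc ac → ca :+ (lc :+ (lc :+ ac)) := (ca :+ ac) :+ (lc :+ lc)) refl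

swapAt : ∀ {A : Set} {m} → Vec A m → Fin m → Fin m → Vec A m
swapAt t i j = (t Vec.[ i ]≔ lookup t j) Vec.[ j ]≔ lookup t i

less-swapAt : ∀ {m} c (t : Vec ℕ m) i j → toℕ i < toℕ j → less c (swapAt t i j) ≡ less c t
less-swapAt c (a ∷ t) zero (suc k) _ = begin
  ⟦ lookup t k <ᵇ c ⟧ + less c (t Vec.[ k ]≔ a) ≡⟨ +-comm ⟦ lookup t k <ᵇ c ⟧ _ ⟩
  less c (t Vec.[ k ]≔ a) + ⟦ lookup t k <ᵇ c ⟧ ≡⟨ less-update c t k a ⟩
  less c t + ⟦ a <ᵇ c ⟧ ≡⟨ +-comm (less c t) _ ⟩
  ⟦ a <ᵇ c ⟧ + less c t ∎
  where open ≡-Reasoning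
less-swapAt c (a ∷ t) (suc i) (suc j) (s≤s lt) = cong (⟦ a <ᵇ c ⟧ +_) (less-swapAt c t i j lt)

odd-swapAt : ∀ {m} (t : Vec ℕ m) → (∀ {i j} → lookup t i ≡ lookup t j → i ≡ j) → ∀ i j → toℕ i < toℕ j →
  odd (inv t + inv (swapAt t i j)) ≡ true
odd-swapAt (a ∷ t) t-inj zero (suc k) _ = odd-exchange t k a
  (λ i eq → case t-inj {suc i} {zero} eq of λ ()) (λ i i≢k eq → i≢k (FinP.suc-injective (t-inj {suc i} {suc k} eq)))
odd-swapAt (a ∷ t) t-inj (suc i) (suc j) (s≤s lt) = begin
  odd (less a t + inv t + (less a (swapAt t i j) + inv (swapAt t i j)))
    ≡⟨ cong (λ l → odd (less a t + inv t + (l + inv (swapAt t i j)))) (less-swapAt a t i j lt) ⟩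
  odd (less a t + inv t + (less a t + inv (swapAt t i j)))
    ≡⟨ cong odd (regroup (less a t) (inv t) (inv (swapAt t i j))) ⟩
  odd (inv t + inv (swapAt t i j) + (less a t + less a t))
    ≡⟨ odd-double (inv t + inv (swapAt t i j)) (less a t) ⟩
  odd (inv t + inv (swapAt t i j))
    ≡⟨ odd-swapAt t (λ eq → FinP.suc-injective (t-inj eq)) i j lt ⟩
  true ∎
  where
  open ≡-Reasoning
  open Data.Nat.Solver.+-*-Solver using (solve; _:+_; _:*_; _:=_)
  regroup : ∀ l x y → l + x + (l + y) ≡ x + y + (l + l)
  regroup = solve 3 (λ l x y → l :+ x :+ (l :+ y) := x :+ y :+ (l :+ l)) refl

inversions-inv : ∀ {m} (f : Fin m → ℕ) → ∑ (λ i → ∑ λ j → ⟦ (i <F j) ∧ (f j <ᵇ f i) ⟧) ≡ inv (tabulate f)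
inversions-inv {zero}  f = refl
inversions-inv {suc m} f = cong₂ _+_ (head-less (f zero) (f ∘ suc)) (inversions-inv (f ∘ suc))
  where
  head-less : ∀ {m} a (g : Fin m → ℕ) → ∑ (λ j → ⟦ g j <ᵇ a ⟧) ≡ less a (tabulate g)
  head-less {zero}  a g = refl
  head-less {suc m} a g = cong (⟦ g zero <ᵇ a ⟧ +_) (head-less a (g ∘ suc))

%2-odd : ∀ m → (m % 2 ≡ᵇ 0) ≡ not (odd m)
%2-odd zero          = refl
%2-odd (suc zero)    = refl
%2-odd (suc (suc m)) = begin
  (suc (suc m) % 2 ≡ᵇ 0)   ≡⟨ cong (λ x → x % 2 ≡ᵇ 0) (+-comm 2 m) ⟩
  ((m + 2) % 2 ≡ᵇ 0)       ≡⟨ cong (_≡ᵇ 0) ([m+n]%n≡m%n m 2) ⟩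
  (m % 2 ≡ᵇ 0)             ≡⟨ %2-odd m ⟩
  not (odd m)              ≡⟨ cong not (not-involutive (odd m)) ⟨
  not (not (not (odd m)))  ∎
  where open ≡-Reasoning

transpose : ∀ {n} → Fin n → Fin n → Fin n → Fin n
transpose p q k = if k ==F p then q else if k ==F q then p else k

transpose-p : ∀ {n} (p q : Fin n) → transpose p q p ≡ q
transpose-p p q rewrite ==F-refl p = refl

transpose-q : ∀ {n} (p q : Fin n) → transpose p q q ≡ p
transpose-q p q with q Fin.≟ p
... | yes q≡p = q≡p
... | no _ rewrite ==F-refl q = refl

transpose-≢ : ∀ {n} {p q k : Fin n} → k ≢ p → k ≢ q → transpose p q k ≡ k
transpose-≢ k≢p k≢q rewrite ==F-≢ k≢p | ==F-≢ k≢q = refl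

data Transposed {n} (p q k : Fin n) : Set where
  at-p : k ≡ p → transpose p q k ≡ q → Transposed p q k
  at-q : k ≡ q → transpose p q k ≡ p → Transposed p q k
  away : k ≢ p → k ≢ q → transpose p q k ≡ k → Transposed p q k

transposed : ∀ {n} (p q k : Fin n) → Transposed p q k
transposed p q k with k Fin.≟ p | k Fin.≟ q
... | yes refl | _        = at-p refl (transpose-p p q)
... | no _     | yes refl = at-q refl (transpose-q p q)
... | no k≢p   | no k≢q   = away k≢p k≢q (transpose-≢ k≢p k≢q)

transpose-involutive : ∀ {n} (p q k : Fin n) → transpose p q (transpose p q k) ≡ k
transpose-involutive p q k with transposed p q k
... | at-p refl eq    = trans (cong (transpose p q) eq) (transpose-q p q)
... | at-q refl eq    = trans (cong (transpose p q) eq) (transpose-p p q)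
... | away _ _ eq     = trans (cong (transpose p q) eq) eq

transpose-injective : ∀ {n} (p q : Fin n) {k l} → transpose p q k ≡ transpose p q l → k ≡ l
transpose-injective p q {k} {l} eq =
  trans (sym (transpose-involutive p q k)) (trans (cong (transpose p q) eq) (transpose-involutive p q l))

transpose-sym : ∀ {n} (p q k : Fin n) → transpose p q k ≡ transpose q p k
transpose-sym p q k with transposed p q k
... | at-p refl eq      = trans eq (sym (transpose-q q p))
... | at-q refl eq      = trans eq (sym (transpose-p q p))
... | away k≢p k≢q eq   = trans eq (sym (transpose-≢ k≢q k≢p))

lookup-swapAt : ∀ {A : Set} {m} (t : Vec A m) i j → i ≢ j → ∀ l → lookup (swapAt t i j) l ≡ lookup t (transpose i j l)
lookup-swapAt t i j i≢j l with transposed i j l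
... | at-q refl eq = trans (VecP.lookup∘updateAt j (t Vec.[ i ]≔ lookup t j)) (cong (lookup t) (sym eq))
... | at-p refl eq = trans (VecP.lookup∘updateAt′ i j i≢j (t Vec.[ i ]≔ lookup t j))
                       (trans (VecP.lookup∘updateAt i t) (cong (lookup t) (sym eq)))
... | away l≢i l≢j eq = trans (VecP.lookup∘updateAt′ l j l≢j (t Vec.[ i ]≔ lookup t j))
                       (trans (VecP.lookup∘updateAt′ l i l≢i t) (cong (lookup t) (sym eq)))

module _ {n : ℕ} (s : ℕ) (T : Fin n → Maybe ℕ) where

  signOf : Bool → ℚ
  signOf b = if not b then 1ℚ else ℚ.- 1ℚ

  sign-inv : ∀ w → sign s T w ≡ signOf (odd (inv (Vec.map toℕ w)))
  sign-inv w = begin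
    (if (inversions s T w % 2) ≡ᵇ 0 then 1ℚ else ℚ.- 1ℚ)
      ≡⟨ cong (λ b → if b then 1ℚ else ℚ.- 1ℚ) (%2-odd (inversions s T w)) ⟩
    signOf (odd (inversions s T w)) ≡⟨ cong (signOf ∘ odd) inversions≡ ⟩
    signOf (odd (inv (Vec.map toℕ w))) ∎
    where
    open ≡-Reasoning
    inversions≡ : inversions s T w ≡ inv (Vec.map toℕ w)
    inversions≡ = begin
      inversions s T w ≡⟨ sum-allFin (λ i → count (λ j → (i <F j) ∧ (lookup w j <F lookup w i))) ⟩
      ∑ (λ i → count (λ j → (i <F j) ∧ (lookup w j <F lookup w i)))
        ≡⟨ ∑-cong (λ i → count-∑ (λ j → (i <F j) ∧ (lookup w j <F lookup w i))) ⟩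
      ∑ (λ i → ∑ λ j → ⟦ (i <F j) ∧ (lookup w j <F lookup w i) ⟧) ≡⟨ inversions-inv (λ i → toℕ (lookup w i)) ⟩
      inv (tabulate (λ i → toℕ (lookup w i)))
        ≡⟨ cong inv (trans (VecP.tabulate-∘ toℕ (lookup w)) (cong (Vec.map toℕ) (VecP.tabulate∘lookup w))) ⟩
      inv (Vec.map toℕ w) ∎

  Injective : Vec (Fin n) n → Set
  Injective w = ∀ {i j} → lookup w i ≡ lookup w j → i ≡ j

  -- Transposing the values p and q amounts to exchanging the entries at the places x and y where
  -- they occur, which reduces the claim to `odd-swapAt`.
  sign-transpose : ∀ w → Injective w → ∀ p q → p ≢ q → sign s T (Vec.map (transpose p q) w) ≡ ℚ.- sign s T w
  sign-transpose w w-inj p q p≢q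
    with injective⇒surjective (lookup w) w-inj p | injective⇒surjective (lookup w) w-inj q
  ... | x , refl | y , refl = begin
    sign s T (Vec.map (transpose p q) w)                        ≡⟨ sign-inv (Vec.map (transpose p q) w) ⟩
    signOf (odd (inv (Vec.map toℕ (Vec.map (transpose p q) w)))) ≡⟨ flip (inv (Vec.map toℕ w)) _ flips ⟩
    ℚ.- signOf (odd (inv (Vec.map toℕ w)))                      ≡⟨ cong ℚ.-_ (sign-inv w) ⟨
    ℚ.- sign s T w ∎
    where
    open ≡-Reasoning
    t = Vec.map toℕ w
    t-inj : ∀ {i j} → lookup t i ≡ lookup t j → i ≡ j
    t-inj {i} {j} eq =
      w-inj (FinP.toℕ-injective (trans (sym (VecP.lookup-map i toℕ w)) (trans eq (VecP.lookup-map j toℕ w))))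
    x≢y : x ≢ y
    x≢y x≡y = p≢q (cong (lookup w) x≡y)
    flip : ∀ a b → odd (a + b) ≡ true → signOf (odd b) ≡ ℚ.- signOf (odd a)
    flip zero    b e rewrite e = refl
    flip (suc a) b e with odd a | odd b | flip a (suc b) (trans (cong odd (+-suc a b)) e)
    ... | true  | true  | _ = refl
    ... | true  | false | ()
    ... | false | true  | ()
    ... | false | false | _ = refl
    positions : ∀ l → transpose p q (lookup w l) ≡ lookup w (transpose x y l)
    positions l with transposed x y l
    ... | at-p refl eq = trans (transpose-p p q) (cong (lookup w) (sym eq))
    ... | at-q refl eq = trans (transpose-q p q) (cong (lookup w) (sym eq))
    ... | away l≢x l≢y eq = trans (transpose-≢ (l≢x ∘ w-inj) (l≢y ∘ w-inj)) (cong (lookup w) (sym eq))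
    swapped : ∀ i j → i ≢ j → (∀ l → transpose x y l ≡ transpose i j l) → Vec.map toℕ (Vec.map (transpose p q) w) ≡ swapAt t i j
    swapped i j i≢j agree = vec-ext λ l → begin
      lookup (Vec.map toℕ (Vec.map (transpose p q) w)) l ≡⟨ VecP.lookup-map l toℕ (Vec.map (transpose p q) w) ⟩
      toℕ (lookup (Vec.map (transpose p q) w) l)
        ≡⟨ cong toℕ (trans (VecP.lookup-map l (transpose p q) w) (positions l)) ⟩
      toℕ (lookup w (transpose x y l))                   ≡⟨ cong (toℕ ∘ lookup w) (agree l) ⟩
      toℕ (lookup w (transpose i j l))                   ≡⟨ VecP.lookup-map (transpose i j l) toℕ w ⟨
      lookup t (transpose i j l)                         ≡⟨ lookup-swapAt t i j i≢j l ⟨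
      lookup (swapAt t i j) l                            ∎
    flips : odd (inv t + inv (Vec.map toℕ (Vec.map (transpose p q) w))) ≡ true
    flips with <-cmp (toℕ x) (toℕ y)
    ... | tri< lt _ _ rewrite swapped x y x≢y (λ _ → refl) = odd-swapAt t t-inj x y lt
    ... | tri≈ _ eq _ = contradiction (FinP.toℕ-injective eq) x≢y
    ... | tri> _ _ gt rewrite swapped y x (x≢y ∘ sym) (transpose-sym x y) = odd-swapAt t t-inj y x gt

-- The polynomial δ_T

module PSum = Algebra.Properties.CommutativeMonoid.Sum *-1-commutativeMonoid

Σℚ-filter : ∀ {A : Set} (p : A → Bool) (xs : List A) (f : A → ℚ) → Σℚ (filterᵇ p xs) f ≡ Σℚ xs (λ x → if p x then f x else 0ℚ)
Σℚ-filter p []       f = refl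
Σℚ-filter p (x ∷ xs) f with p x
... | true  = cong (f x ℚ.+_) (Σℚ-filter p xs f)
... | false = trans (Σℚ-filter p xs f) (sym (ℚP.+-identityˡ _))

Σℚ-tabulate : ∀ {A : Set} {n} (g : Fin n → A) (f : A → ℚ) → Σℚ (List.tabulate g) f ≡ QSum.sum (f ∘ g)
Σℚ-tabulate {n = zero}  g f = refl
Σℚ-tabulate {n = suc n} g f = cong (f (g zero) ℚ.+_) (Σℚ-tabulate (g ∘ suc) f)

transposeᵖ : ∀ {n} → Fin n → Fin n → Permutation′ n
transposeᵖ p q = permutation (transpose p q) (transpose p q) (transpose-involutive p q) (transpose-involutive p q)

Σℚ-transpose : ∀ {n} (p q : Fin n) (f : Fin n → ℚ) → Σℚ (List.allFin n) f ≡ Σℚ (List.allFin n) (f ∘ transpose p q)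
Σℚ-transpose p q f =
  trans (Σℚ-tabulate id f) (trans (QSum.sum-permute f (transposeᵖ p q)) (sym (Σℚ-tabulate id (f ∘ transpose p q))))

Σℚ-neg : ∀ {A : Set} (xs : List A) (f : A → ℚ) → Σℚ xs (λ x → ℚ.- f x) ≡ ℚ.- Σℚ xs f
Σℚ-neg []       f = refl
Σℚ-neg (x ∷ xs) f = trans (cong (ℚ.- f x ℚ.+_) (Σℚ-neg xs f)) (sym (ℚP.neg-distrib-+ (f x) (Σℚ xs f)))

Σℚ-nonneg : ∀ {A : Set} (xs : List A) (f : A → ℚ) → (∀ x → 0ℚ ℚ.≤ f x) → 0ℚ ℚ.≤ Σℚ xs f
Σℚ-nonneg []       f h = ℚP.≤-refl
Σℚ-nonneg (x ∷ xs) f h = ℚP.+-mono-≤ (h x) (Σℚ-nonneg xs f h)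

Σℚ-term : ∀ {A : Set} (xs : List A) (f : A → ℚ) → (∀ x → 0ℚ ℚ.≤ f x) → ∀ {x} → x ∈ xs → f x ℚ.≤ Σℚ xs f
Σℚ-term (x ∷ xs) f h (here refl) =
  subst (ℚ._≤ f x ℚ.+ Σℚ xs f) (ℚP.+-identityʳ (f x)) (ℚP.+-mono-≤ (ℚP.≤-refl {f x}) (Σℚ-nonneg xs f h))
Σℚ-term (x ∷ xs) f h {y} (there y∈) =
  subst (ℚ._≤ f x ℚ.+ Σℚ xs f) (ℚP.+-identityˡ (f y)) (ℚP.+-mono-≤ (h x) (Σℚ-term xs f h y∈))

permute : ∀ {n} → Fin n → Fin n → Mon n → Mon n
permute p q m = tabulate (λ i → lookup m (transpose p q i))

lookup-permute : ∀ {n} (p q : Fin n) m i → lookup (permute p q m) i ≡ lookup m (transpose p q i)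
lookup-permute p q m i = VecP.lookup∘tabulate _ i

permute-involutive : ∀ {n} (p q : Fin n) m → permute p q (permute p q m) ≡ m
permute-involutive p q m = vec-ext λ i → trans (lookup-permute p q (permute p q m) i)
  (trans (lookup-permute p q m (transpose p q i)) (cong (lookup m) (transpose-involutive p q i)))

fac-permute : ∀ {n} (p q : Fin n) (m : Mon n) → fac (permute p q m) ≡ fac m
fac-permute p q m = cong ℕ→ℚ (begin
  facℕ (permute p q m)                            ≡⟨ facℕ-∏ (permute p q m) ⟩
  PSum.sum (λ i → lookup (permute p q m) i !)     ≡⟨ PSum.sum-cong-≗ (λ i → cong _! (lookup-permute p q m i)) ⟩
  PSum.sum (λ i → lookup m (transpose p q i) !)   ≡⟨ PSum.sum-permute (λ i → lookup m i !) (transposeᵖ p q) ⟨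
  PSum.sum (λ i → lookup m i !)                   ≡⟨ facℕ-∏ m ⟨
  facℕ m                                          ∎)
  where
  open ≡-Reasoning
  facℕ-∏ : ∀ {n} (m : Mon n) → facℕ m ≡ PSum.sum (λ i → lookup m i !)
  facℕ-∏ []      = refl
  facℕ-∏ (x ∷ m) = cong (x ! *_) (facℕ-∏ m)

Bool-ext : ∀ {a b : Bool} → (a ≡ true → b ≡ true) → (b ≡ true → a ≡ true) → a ≡ b
Bool-ext {true}  {b}     f g = sym (f refl)
Bool-ext {false} {true}  f g = g refl
Bool-ext {false} {false} f g = refl

≺-irrefl : ∀ {n} {m : Mon n} → ¬ m ≺ m
≺-irrefl (this lt _) = <-irrefl refl lt
≺-irrefl (next _ lt) = ≺-irrefl lt

≺-asym : ∀ {n} {m m′ : Mon n} → m ≺ m′ → ¬ m′ ≺ m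
≺-asym (this lt _)   (this gt _)   = <-asym lt gt
≺-asym (this lt _)   (next refl _) = <-irrefl refl lt
≺-asym (next refl _) (this gt _)   = <-irrefl refl gt
≺-asym (next _ lt)   (next _ gt)   = ≺-asym lt gt

-- As long as P holds the entries agree, and the first failure of P decides the comparison. If there
-- is none, the outcome is P everywhere, which says more than u = v.
≺-first-difference : ∀ {n} (P : Fin n → Set) {u v : Mon n} →
  (∀ i → (∀ j → toℕ j < toℕ i → P j) → (P i × lookup u i ≡ lookup v i) ⊎ lookup u i < lookup v i) →
  u ≺ v ⊎ (∀ i → P i)
≺-first-difference P {[]}    {[]}    h = inj₂ λ ()
≺-first-difference P {x ∷ u} {y ∷ v} h with h zero (λ _ ())
... | inj₂ x<y = inj₁ (this x<y refl)
... | inj₁ (P0 , x≡y)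
  with ≺-first-difference (P ∘ suc) {u} {v} (λ i fixed → h (suc i) λ { zero _ → P0 ; (suc j) (s≤s lt) → fixed j lt })
...   | inj₁ u≺v = inj₁ (next x≡y u≺v)
...   | inj₂ all = inj₂ λ { zero → P0 ; (suc i) → all i }

module _ {n : ℕ} (s : ℕ) (T : Fin n → Maybe ℕ) where

  sameCol⇒ : ∀ t c → sameCol s T t (just c) ≡ true → t ≡ just c
  sameCol⇒ (just d) c eq = cong just (≡ᵇ⇒≡′ d c eq)

  sameCol-refl : ∀ c → sameCol s T (just c) (just c) ≡ true
  sameCol-refl c = ≡ᵇ-refl c

  collisions : Vec (Fin n) n → Fin n → ℕ
  collisions w i = count (λ j → (i <F j) ∧ (lookup w i ==F lookup w j))

  isPerm⇒≢ : ∀ w → isPerm s T w ≡ true → ∀ i j → (i <F j) ≡ true → lookup w i ≢ lookup w j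
  isPerm⇒≢ w perm i j i<j eq = true≢false (cong₂ _∧_ i<j (trans (cong (_==F lookup w j) eq) (==F-refl (lookup w j))))
    (count≡0⇒false (λ j → (i <F j) ∧ (lookup w i ==F lookup w j)) (cong (_≡ᵇ 0) (none i)) j)
    where
    none : ∀ i → collisions w i ≡ 0
    none =
      ∑≡0⇒≡0 (collisions w) (trans (sym (sum-allFin (collisions w))) (≡ᵇ⇒≡′ (sum (map (collisions w) (List.allFin n))) 0 perm))

  isPerm⇒ : ∀ w → isPerm s T w ≡ true → Injective s T w
  isPerm⇒ w perm {i} {j} eq with compareF i j
  ... | same i≡j       = i≡j
  ... | before i<j _ _ = contradiction eq (isPerm⇒≢ w perm i j i<j)
  ... | after _ j<i _  = contradiction (sym eq) (isPerm⇒≢ w perm j i j<i)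

  isPerm⇐ : ∀ w → Injective s T w → isPerm s T w ≡ true
  isPerm⇐ w w-inj =
    cong (_≡ᵇ 0) (trans (sum-allFin (collisions w)) (∑-zero {f = collisions w} λ i → count-false (distinct i)))
    where
    distinct : ∀ i j → (i <F j) ∧ (lookup w i ==F lookup w j) ≡ false
    distinct i j with i <F j in lt | lookup w i Fin.≟ lookup w j
    ... | false | _      = refl
    ... | true  | no _   = refl
    ... | true  | yes eq with refl ← w-inj eq = ⊥-elim (true≢false lt (<F-irrefl i))

  Stabilizes : Vec (Fin n) n → Set
  Stabilizes w = ∀ x → T (lookup w x) ≡ T x × (T x ≡ nothing → lookup w x ≡ x)

  inCT⇒ : ∀ w → inCT s T w ≡ true → Stabilizes w
  inCT⇒ w h x with T x in eq | count≡0⇒false _ h x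
  ... | just c  | e = sameCol⇒ (T (lookup w x)) c (not-false e) , λ ()
    where
    not-false : ∀ {b} → not b ≡ false → b ≡ true
    not-false {true} _ = refl
  ... | nothing | e with lookup w x Fin.≟ x
  ...   | yes fixed = trans (cong T fixed) eq , λ _ → fixed
  inCT⇒ w h x | nothing | () | no _

  inCT⇐ : ∀ w → Stabilizes w → inCT s T w ≡ true
  inCT⇐ w st with inCT s T w in h
  ... | true  = refl
  ... | false with count≢0⇒true _ h
  ...   | x , e with T x | e | st x
  ...     | just c  | e′ | Tw≡ , _ rewrite Tw≡ | ≡ᵇ-refl c with () ← e′
  ...     | nothing | e′ | _ , fixed rewrite fixed refl | ==F-refl x with () ← e′

  expVec : Vec (Fin n) n → Mon n
  expVec w = expo (λ i → ε (lookup w i) (expT s T i)) (List.allFin n)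

  lookup-expo : ∀ {A : Set} (e : A → Mon n) {k} (g : Fin k → A) j → lookup (expo e (List.tabulate g)) j ≡ ∑ (λ i → lookup (e (g i)) j)
  lookup-expo e {zero}  g j = VecP.lookup-replicate j 0
  lookup-expo e {suc k} g j =
    trans (VecP.lookup-zipWith _+_ j (e (g zero)) _) (cong (lookup (e (g zero)) j +_) (lookup-expo e (g ∘ suc) j))

  lookup-expVec : ∀ w j → lookup (expVec w) j ≡ ∑ (λ i → ⟦ lookup w i ==F j ⟧ * expT s T i)
  lookup-expVec w j = trans (lookup-expo (λ i → ε (lookup w i) (expT s T i)) id j)
    (∑-cong λ i → trans (VecP.lookup∘tabulate _ j) (if-* (lookup w i ==F j) (expT s T i)))
    where
    if-* : ∀ b x → (if b then x else 0) ≡ ⟦ b ⟧ * x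
    if-* true  x = sym (+-identityʳ x)
    if-* false x = refl

  lookup-expVec-image : ∀ w → Injective s T w → ∀ x → lookup (expVec w) (lookup w x) ≡ expT s T x
  lookup-expVec-image w w-inj x = begin
    lookup (expVec w) (lookup w x) ≡⟨ lookup-expVec w (lookup w x) ⟩
    ∑ (λ i → ⟦ lookup w i ==F lookup w x ⟧ * expT s T i)
      ≡⟨ ∑-cong (λ i → cong (λ b → ⟦ b ⟧ * expT s T i) (==F-inj (lookup w) w-inj i x)) ⟩
    ∑ (λ i → ⟦ i ==F x ⟧ * expT s T i) ≡⟨ ∑-δ (expT s T) x ⟩
    expT s T x ∎
    where open ≡-Reasoning

  -- The contribution of w to the coefficient of x^m, extended by zero from C_T to all vectors,
  -- because a reindexing by a transposition is carried out on the full list.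
  term : Mon n → Vec (Fin n) n → ℚ
  term m w = if isPerm s T w ∧ inCT s T w then sign s T w ℚ.* at m (1ℚ , expVec w) else 0ℚ

  coeff-δT : ∀ m → coeff (δT s T) m ≡ Σℚ (allVecs s T (List.allFin n) n) (term m)
  coeff-δT m = begin
    coeff (δT s T) m ≡⟨ coeff-sum (λ w → scaleₚ (sign s T w) (actXT s T w)) (CT s T) m ⟩
    Σℚ (CT s T) (λ w → coeff (scaleₚ (sign s T w) (actXT s T w)) m) ≡⟨ Σℚ-cong (CT s T) single ⟩
    Σℚ (CT s T) (λ w → sign s T w ℚ.* at m (1ℚ , expVec w))
      ≡⟨ Σℚ-filter (λ w → isPerm s T w ∧ inCT s T w) (allVecs s T (List.allFin n) n) _ ⟩
    Σℚ (allVecs s T (List.allFin n) n) (term m) ∎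
    where
    open ≡-Reasoning
    single : ∀ w → coeff (scaleₚ (sign s T w) (actXT s T w)) m ≡ sign s T w ℚ.* at m (1ℚ , expVec w)
    single w = trans (coeff-scale (sign s T w) (actXT s T w) m) (cong (sign s T w ℚ.*_)
      (trans (cong (λ p → coeff p m) (prod-monomial (λ i → ε (lookup w i) (expT s T i)) (List.allFin n)))
             (trans (coeff-∷ (1ℚ , expVec w) [] m) (ℚP.+-identityʳ _))))

  term-zero : ∀ m w → (isPerm s T w ≡ true → inCT s T w ≡ true → expVec w ≢ m) → term m w ≡ 0ℚ
  term-zero m w h with isPerm s T w | inCT s T w
  ... | false | _     = refl
  ... | true  | false = refl
  ... | true  | true  = trans (cong (sign s T w ℚ.*_) (at-≢ m 1ℚ (h refl refl))) (ℚP.*-zeroʳ (sign s T w))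

  coeff-δT-zero : ∀ m → (∀ w → Injective s T w → Stabilizes w → expVec w ≢ m) → coeff (δT s T) m ≡ 0ℚ
  coeff-δT-zero m h =
    trans (coeff-δT m) (Σℚ-zero (allVecs s T (List.allFin n) n) λ w _ → term-zero m w λ perm ct → h w (isPerm⇒ w perm) (inCT⇒ w ct))

  Σ-allVecs-transpose : ∀ p q k (F : Vec (Fin n) k → ℚ) →
    Σℚ (allVecs s T (List.allFin n) k) F ≡ Σℚ (allVecs s T (List.allFin n) k) (F ∘ Vec.map (transpose p q))
  Σ-allVecs-transpose p q zero    F = refl
  Σ-allVecs-transpose p q (suc k) F = begin
    Σℚ (allVecs s T (List.allFin n) (suc k)) F ≡⟨ Σℚ-concatMap (λ a → map (a ∷_) vs) (List.allFin n) F ⟩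
    Σℚ (List.allFin n) (λ a → Σℚ (map (a ∷_) vs) F)
      ≡⟨ Σℚ-cong (List.allFin n) (λ a → trans (Σℚ-map (a ∷_) vs F) (Σ-allVecs-transpose p q k (F ∘ (a ∷_)))) ⟩
    Σℚ (List.allFin n) (λ a → Σℚ vs (λ v → F (a ∷ Vec.map (transpose p q) v)))
      ≡⟨ Σℚ-transpose p q (λ a → Σℚ vs (λ v → F (a ∷ Vec.map (transpose p q) v))) ⟩
    Σℚ (List.allFin n) (λ a → Σℚ vs (λ v → F (transpose p q a ∷ Vec.map (transpose p q) v)))
      ≡⟨ Σℚ-cong (List.allFin n) (λ a → Σℚ-map (a ∷_) vs (F ∘ Vec.map (transpose p q))) ⟨
    Σℚ (List.allFin n) (λ a → Σℚ (map (a ∷_) vs) (F ∘ Vec.map (transpose p q)))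
      ≡⟨ Σℚ-concatMap (λ a → map (a ∷_) vs) (List.allFin n) (F ∘ Vec.map (transpose p q)) ⟨
    Σℚ (allVecs s T (List.allFin n) (suc k)) (F ∘ Vec.map (transpose p q)) ∎
    where
    open ≡-Reasoning
    vs = allVecs s T (List.allFin n) k

  module _ (p q : Fin n) (p≢q : p ≢ q) {c : ℕ} (Tp : T p ≡ just c) (Tq : T q ≡ just c) where

    private
      τ : Fin n → Fin n
      τ = transpose p q

    map-τ-involutive : (w : Vec (Fin n) n) → Vec.map τ (Vec.map τ w) ≡ w
    map-τ-involutive w = vec-ext {n = n} λ i → trans (VecP.lookup-map i τ (Vec.map τ w))
      (trans (cong τ (VecP.lookup-map i τ w)) (transpose-involutive p q (lookup w i)))

    T-τ : ∀ k → T (τ k) ≡ T k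
    T-τ k with transposed p q k
    ... | at-p refl eq  = trans (cong T eq) (trans Tq (sym Tp))
    ... | at-q refl eq  = trans (cong T eq) (trans Tp (sym Tq))
    ... | away _ _ eq   = cong T eq

    Injective-τ : ∀ w → Injective s T w → Injective s T (Vec.map τ w)
    Injective-τ w w-inj {i} {j} eq = w-inj (transpose-injective p q
      (trans (sym (VecP.lookup-map i τ w)) (trans eq (VecP.lookup-map j τ w))))

    Stabilizes-τ : ∀ w → Stabilizes w → Stabilizes (Vec.map τ w)
    Stabilizes-τ w st x rewrite VecP.lookup-map x τ w = trans (T-τ (lookup w x)) (proj₁ (st x)) ,
      λ Tx → trans (cong τ (proj₂ (st x) Tx)) (transpose-≢ (λ x≡p → apart Tx (trans (cong T x≡p) Tp)) (λ x≡q → apart Tx (trans (cong T x≡q) Tq)))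
      where
      apart : ∀ {t : Maybe ℕ} → t ≡ nothing → t ≡ just c → ⊥
      apart refl ()

    isPerm-τ : ∀ w → isPerm s T (Vec.map τ w) ≡ isPerm s T w
    isPerm-τ w = Bool-ext
      (λ h → isPerm⇐ w (subst (λ v → ∀ {i j} → lookup v i ≡ lookup v j → i ≡ j) {Vec.map τ (Vec.map τ w)} {w} (map-τ-involutive w) (Injective-τ (Vec.map τ w) (isPerm⇒ (Vec.map τ w) h))))
      (λ h → isPerm⇐ (Vec.map τ w) (Injective-τ w (isPerm⇒ w h)))

    inCT-τ : ∀ w → inCT s T (Vec.map τ w) ≡ inCT s T w
    inCT-τ w = Bool-ext
      (λ h → inCT⇐ w (subst Stabilizes {Vec.map τ (Vec.map τ w)} {w} (map-τ-involutive w) (Stabilizes-τ (Vec.map τ w) (inCT⇒ (Vec.map τ w) h))))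
      (λ h → inCT⇐ (Vec.map τ w) (Stabilizes-τ w (inCT⇒ w h)))

    expVec-τ : ∀ w → expVec (Vec.map τ w) ≡ permute p q (expVec w)
    expVec-τ w = vec-ext λ j → begin
      lookup (expVec (Vec.map τ w)) j ≡⟨ lookup-expVec (Vec.map τ w) j ⟩
      ∑ (λ i → ⟦ lookup (Vec.map τ w) i ==F j ⟧ * expT s T i)
        ≡⟨ ∑-cong (λ i → cong (λ b → ⟦ b ⟧ * expT s T i) (hits i j)) ⟩
      ∑ (λ i → ⟦ lookup w i ==F τ j ⟧ * expT s T i) ≡⟨ lookup-expVec w (τ j) ⟨
      lookup (expVec w) (τ j) ≡⟨ lookup-permute p q (expVec w) j ⟨
      lookup (permute p q (expVec w)) j ∎
      where
      open ≡-Reasoning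
      hits : ∀ i j → (lookup (Vec.map τ w) i ==F j) ≡ (lookup w i ==F τ j)
      hits i j = begin
        (lookup (Vec.map τ w) i ==F j) ≡⟨ cong₂ _==F_ (VecP.lookup-map i τ w) (sym (transpose-involutive p q j)) ⟩
        (τ (lookup w i) ==F τ (τ j))   ≡⟨ ==F-inj τ (transpose-injective p q) (lookup w i) (τ j) ⟩
        (lookup w i ==F τ j)           ∎

    at-permute : ∀ m e → at (permute p q m) (1ℚ , permute p q e) ≡ at m (1ℚ , e)
    at-permute m e with e ≟ᵐ m
    ... | yes refl = at-≡ (permute p q m) 1ℚ refl
    ... | no ne    = at-≢ (permute p q m) 1ℚ λ eq →
      ne (trans (sym (permute-involutive p q e)) (trans (cong (permute p q) eq) (permute-involutive p q m)))

    term-τ : ∀ m w → term (permute p q m) (Vec.map τ w) ≡ ℚ.- term m w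
    term-τ m w rewrite isPerm-τ w | inCT-τ w | expVec-τ w | at-permute m (expVec w) with isPerm s T w in perm | inCT s T w
    ... | false | _     = refl
    ... | true  | false = refl
    ... | true  | true  = trans (cong (ℚ._* at m (1ℚ , expVec w)) (sign-transpose s T w (isPerm⇒ w perm) p q p≢q))
                                (sym (ℚP.neg-distribˡ-* (sign s T w) (at m (1ℚ , expVec w))))

    -- Composition with the transposition of two entries of one column preserves C_T, permutes the
    -- exponents and reverses the sign. The factor m! is symmetric, so antisymmetry passes from
    -- coefficients to `D`.
    D-δT-antisymmetric : ∀ m → D (δT s T) (permute p q m) ≡ ℚ.- D (δT s T) m
    D-δT-antisymmetric m = begin
      fac (permute p q m) ℚ.* coeff (δT s T) (permute p q m) ≡⟨ cong₂ ℚ._*_ (fac-permute p q m) coeff-permute ⟩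
      fac m ℚ.* (ℚ.- coeff (δT s T) m)                       ≡⟨ ℚP.neg-distribʳ-* (fac m) (coeff (δT s T) m) ⟨
      ℚ.- D (δT s T) m                                       ∎
      where
      open ≡-Reasoning
      vs = allVecs s T (List.allFin n) n
      coeff-permute : coeff (δT s T) (permute p q m) ≡ ℚ.- coeff (δT s T) m
      coeff-permute = begin
        coeff (δT s T) (permute p q m)                  ≡⟨ coeff-δT (permute p q m) ⟩
        Σℚ vs (term (permute p q m))                    ≡⟨ Σ-allVecs-transpose p q n (term (permute p q m)) ⟩
        Σℚ vs (λ w → term (permute p q m) (Vec.map τ w)) ≡⟨ Σℚ-cong vs (term-τ m) ⟩
        Σℚ vs (λ w → ℚ.- term m w)                      ≡⟨ Σℚ-neg vs (term m) ⟩
        ℚ.- Σℚ vs (term m)                              ≡⟨ cong ℚ.-_ (coeff-δT m) ⟨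
        ℚ.- coeff (δT s T) m                            ∎

  inColumn : ℕ → Fin n → ℕ
  inColumn c x = ⟦ sameCol s T (T x) (just c) ⟧

  -- w moves every exponent within its column, which preserves the degree in the variables of that
  -- column.
  expVec-column : ∀ w → Stabilizes w → ∀ c → ∑ (λ j → inColumn c j * lookup (expVec w) j) ≡ ∑ (λ i → inColumn c i * expT s T i)
  expVec-column w st c = begin
    ∑ (λ j → inColumn c j * lookup (expVec w) j)
      ≡⟨ ∑-cong (λ j → trans (cong (inColumn c j *_) (lookup-expVec w j)) (sym (∑-*ˡ (inColumn c j) (λ i → ⟦ lookup w i ==F j ⟧ * expT s T i)))) ⟩
    ∑ (λ j → ∑ λ i → inColumn c j * (⟦ lookup w i ==F j ⟧ * expT s T i))
      ≡⟨ ∑-comm (λ j i → inColumn c j * (⟦ lookup w i ==F j ⟧ * expT s T i)) ⟩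
    ∑ (λ i → ∑ λ j → inColumn c j * (⟦ lookup w i ==F j ⟧ * expT s T i))
      ≡⟨ ∑-cong (λ i → ∑-cong λ j → *-exchange (inColumn c j) ⟦ lookup w i ==F j ⟧ (expT s T i)) ⟩
    ∑ (λ i → ∑ λ j → ⟦ lookup w i ==F j ⟧ * (inColumn c j * expT s T i))
      ≡⟨ ∑-cong (λ i → ∑-δ′ (λ j → inColumn c j * expT s T i) (lookup w i)) ⟩
    ∑ (λ i → inColumn c (lookup w i) * expT s T i)
      ≡⟨ ∑-cong (λ i → cong (λ t → ⟦ sameCol s T t (just c) ⟧ * expT s T i) (proj₁ (st i))) ⟩
    ∑ (λ i → inColumn c i * expT s T i) ∎
    where
    open ≡-Reasoning

  coeff-δT-column : ∀ c m → ∑ (λ j → inColumn c j * lookup m j) ≢ ∑ (λ i → inColumn c i * expT s T i) → coeff (δT s T) m ≡ 0ℚ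
  coeff-δT-column c m ne =
    coeff-δT-zero m λ w _ st eq → ne (trans (cong (λ v → ∑ (λ j → inColumn c j * lookup v j)) (sym eq)) (expVec-column w st c))

  coeff-δT-bounded : (∀ x → expT s T x < s) → ∀ i m → s ≤ lookup m i → coeff (δT s T) m ≡ 0ℚ
  coeff-δT-bounded b<s i m s≤ = coeff-δT-zero m λ w w-inj _ eq →
    let x , wx≡i = injective⇒surjective (lookup w) w-inj i
    in <⇒≱ (b<s x) (subst (s ≤_) (trans (cong₂ lookup (sym eq) (sym wx≡i)) (lookup-expVec-image w w-inj x)) s≤)

  leadExp : Mon n
  leadExp = tabulate (expT s T)

  expT-just : ∀ x c → T x ≡ just c → expT s T x ≡ ∑ (λ y → ⟦ (x <F y) ∧ sameCol s T (T y) (just c) ⟧)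
  expT-just x c eq with T x
  expT-just x c refl | just .c = count-∑ (λ y → (x <F y) ∧ sameCol s T (T y) (just c))

  -- Let i be the first entry not fixed by w, and w x = i. Then x > i, since smaller entries are
  -- fixed, and x shares the column of i. Being further down, x has fewer boxes below it, so the
  -- exponent at i drops.
  expVec-≺ : ∀ w → Injective s T w → Stabilizes w → expVec w ≺ leadExp ⊎ (∀ i → lookup w i ≡ i)
  expVec-≺ w w-inj st = ≺-first-difference (λ i → lookup w i ≡ i) step
    where
    step : ∀ i → (∀ j → toℕ j < toℕ i → lookup w j ≡ j) →
      (lookup w i ≡ i × lookup (expVec w) i ≡ lookup leadExp i) ⊎ lookup (expVec w) i < lookup leadExp i
    step i fixed with injective⇒surjective (lookup w) w-inj i
    ... | x , refl with compareF (lookup w x) x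
    ...   | same wx≡x = inj₁ (cong (lookup w) wx≡x , trans (lookup-expVec-image w w-inj x)
                          (trans (sym (VecP.lookup∘tabulate (expT s T) x)) (cong (lookup leadExp) (sym wx≡x))))
    ...   | after _ x<wx ne = contradiction (fixed x (<ᵇ⇒<′ _ _ x<wx)) ne
    ...   | before wx<x _ ne = inj₂ (subst₂ _<_ (sym (lookup-expVec-image w w-inj x)) (sym (VecP.lookup∘tabulate (expT s T) (lookup w x))) (smaller (T x) refl))
      where
      smaller : ∀ t → T x ≡ t → expT s T x < expT s T (lookup w x)
      smaller nothing  Tx = contradiction (proj₂ (st x) Tx) ne
      smaller (just c) Tx rewrite expT-just x c Tx | expT-just (lookup w x) c (trans (proj₁ (st x)) Tx) =
        ∑-mono-< termwise x (subst₂ (λ a b → ⟦ a ⟧ < ⟦ b ⟧) (sym (cong (_∧ sameCol s T (T x) (just c)) (<F-irrefl x)))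
          (sym (cong₂ _∧_ wx<x (trans (cong (λ t → sameCol s T t (just c)) Tx) (sameCol-refl c)))) ≤-refl)
        where
        termwise : ∀ y → ⟦ (x <F y) ∧ sameCol s T (T y) (just c) ⟧ ≤ ⟦ (lookup w x <F y) ∧ sameCol s T (T y) (just c) ⟧
        termwise y with x <F y in x<y
        ... | false = z≤n
        ... | true rewrite <⇒<ᵇ′ (<-trans (<ᵇ⇒<′ (toℕ (lookup w x)) (toℕ x) wx<x) (<ᵇ⇒<′ (toℕ x) (toℕ y) x<y)) = ≤-refl

  identity : Vec (Fin n) n
  identity = tabulate id

  lookup-identity : ∀ i → lookup identity i ≡ i
  lookup-identity = VecP.lookup∘tabulate id

  expVec-identity : expVec identity ≡ leadExp
  expVec-identity = vec-ext λ j → begin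
    lookup (expVec identity) j ≡⟨ lookup-expVec identity j ⟩
    ∑ (λ i → ⟦ lookup identity i ==F j ⟧ * expT s T i)
      ≡⟨ ∑-cong (λ i → cong (λ k → ⟦ k ==F j ⟧ * expT s T i) (lookup-identity i)) ⟩
    ∑ (λ i → ⟦ i ==F j ⟧ * expT s T i) ≡⟨ ∑-δ (expT s T) j ⟩
    expT s T j ≡⟨ VecP.lookup∘tabulate (expT s T) j ⟨
    lookup leadExp j ∎
    where open ≡-Reasoning

  no-inversions : inversions s T identity ≡ 0
  no-inversions = trans (sum-allFin (λ i → count (λ j → (i <F j) ∧ (lookup identity j <F lookup identity i))))
                        (∑-zero λ i → count-false (increasing i))
    where
    increasing : ∀ i j → (i <F j) ∧ (lookup identity j <F lookup identity i) ≡ false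
    increasing i j rewrite lookup-identity i | lookup-identity j with compareF i j
    ... | same refl rewrite <F-irrefl i = refl
    ... | before i<j j≮i _ rewrite i<j = j≮i
    ... | after i≮j _ _ rewrite i≮j = refl

  term-identity : term leadExp identity ≡ 1ℚ
  term-identity
    rewrite isPerm⇐ identity (λ {i} {j} eq → trans (sym (lookup-identity i)) (trans eq (lookup-identity j)))
          | inCT⇐ identity (λ x → cong T (lookup-identity x) , λ _ → lookup-identity x)
          | at-≡ leadExp 1ℚ expVec-identity
          | no-inversions = refl

  allVecs-complete : ∀ {k} (v : Vec (Fin n) k) → v ∈ allVecs s T (List.allFin n) k
  allVecs-complete []      = here refl
  allVecs-complete (x ∷ v) =
    ∈-concatMap⁺ (λ a → map (a ∷_) (allVecs s T (List.allFin n) _)) (lose (∈-allFin x) (∈-map⁺ (x ∷_) (allVecs-complete v)))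

  -- Elements of C_T other than the identity give smaller exponents. Non-vanishing follows by
  -- positivity: all terms at `leadExp` are nonnegative and that of the identity is 1, which bounds
  -- the sum from below without counting occurrences.
  coeff-δT-leading : coeff (δT s T) leadExp ≢ 0ℚ × (∀ m → leadExp ≺ m → coeff (δT s T) m ≡ 0ℚ)
  coeff-δT-leading =
    nonzero , λ m lt → coeff-δT-zero m λ w w-inj st eq → not-above w w-inj st (subst (leadExp ≺_) (sym eq) lt)
    where
    ≡identity : ∀ w → (∀ i → lookup w i ≡ i) → w ≡ identity
    ≡identity w fixed = vec-ext λ i → trans (fixed i) (sym (lookup-identity i))
    expVec-fixed : ∀ w → (∀ i → lookup w i ≡ i) → expVec w ≡ leadExp
    expVec-fixed w fixed = vec-ext λ j → begin
      lookup (expVec w) j ≡⟨ cong (lookup (expVec w)) (fixed j) ⟨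
      lookup (expVec w) (lookup w j)
        ≡⟨ lookup-expVec-image w (λ {i} {k} eq → trans (sym (fixed i)) (trans eq (fixed k))) j ⟩
      expT s T j ≡⟨ VecP.lookup∘tabulate (expT s T) j ⟨
      lookup leadExp j ∎
      where open ≡-Reasoning
    not-above : ∀ w → Injective s T w → Stabilizes w → ¬ leadExp ≺ expVec w
    not-above w w-inj st lt with expVec-≺ w w-inj st
    ... | inj₁ gt    = ≺-asym lt gt
    ... | inj₂ fixed = ≺-irrefl (subst (leadExp ≺_) (expVec-fixed w fixed) lt)
    nonneg : ∀ w → 0ℚ ℚ.≤ term leadExp w
    nonneg w with VecP.≡-dec Fin._≟_ w identity
    ... | yes refl = subst (0ℚ ℚ.≤_) (sym term-identity) (ℚP.nonNegative⁻¹ 1ℚ)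
    ... | no ne    = ℚP.≤-reflexive (sym (term-zero leadExp w λ perm ct eq → case expVec-≺ w (isPerm⇒ w perm) (inCT⇒ w ct) of λ where
        (inj₁ lt)    → ≺-irrefl (subst (_≺ leadExp) eq lt)
        (inj₂ fixed) → ne (≡identity w fixed)))
    nonzero : coeff (δT s T) leadExp ≢ 0ℚ
    nonzero eq =
      ℚP.<-irrefl refl (ℚP.<-≤-trans (ℚP.positive⁻¹ 1ℚ) (subst₂ ℚ._≤_ term-identity (trans (sym (coeff-δT leadExp)) eq)
      (Σℚ-term (allVecs s T (List.allFin n) n) (term leadExp) nonneg (allVecs-complete identity))))

-- Elementary symmetric sums of antisymmetric functions

infixl 20 _∖_
_∖_ : ∀ {n} → Subset n → Fin n → Subset n
S ∖ p = S Vec.[ p ]≔ false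

ES-false : ∀ {n} d (S : Subset n) F → ES d (false ∷ S) F ≡ ES d S (F ∘ (0 ∷_))
ES-false zero    S F = refl
ES-false (suc d) S F = refl

⊕-ε-zero : ∀ {n} x (A : Mon n) → (x ∷ A) ⊕ ε zero 1 ≡ (x + 1) ∷ A
⊕-ε-zero x A = cong ((x + 1) ∷_) (trans (cong (A ⊕_) (replicate-tabulate _)) (⊕-identityʳ A))

⊕-ε-suc : ∀ {n} x (A : Mon n) p → (x ∷ A) ⊕ ε (suc p) 1 ≡ x ∷ (A ⊕ ε p 1)
⊕-ε-suc x A p = trans (cong ((x ∷ A) ⊕_) (ε-suc p 1)) (cong (_∷ (A ⊕ ε p 1)) (+-identityʳ x))

ES-remove-zero : ∀ {n} (S : Subset n) p F → ES 0 S F ≡ ES 0 (S ∖ p) F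
ES-remove-zero (false ∷ S) zero    F = refl
ES-remove-zero (true ∷ S)  zero    F = refl
ES-remove-zero (false ∷ S) (suc p) F = ES-remove-zero S p (F ∘ (0 ∷_))
ES-remove-zero (true ∷ S)  (suc p) F = ES-remove-zero S p (F ∘ (0 ∷_))

-- The recursion that defines `ES`, at an arbitrary place p instead of the first: subsets containing
-- p, then those avoiding it.
ES-remove-suc : ∀ {n} d (S : Subset n) p → lookup S p ≡ true → ∀ F →
  ES (suc d) S F ≡ ES d (S ∖ p) (λ A → F (A ⊕ ε p 1)) ℚ.+ ES (suc d) (S ∖ p) F
ES-remove-suc d (true ∷ S) zero _ F = cong (ℚ._+ ES (suc d) S (F ∘ (0 ∷_)))
  (sym (trans (ES-false d S (λ A → F (A ⊕ ε zero 1))) (ES-cong d S λ A → cong F (⊕-ε-zero 0 A))))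
ES-remove-suc d (false ∷ S) (suc p) Sp F = trans (ES-remove-suc d S p Sp (F ∘ (0 ∷_)))
  (cong (ℚ._+ ES (suc d) (S ∖ p) (F ∘ (0 ∷_)))
    (sym (trans (ES-false d (S ∖ p) (λ A → F (A ⊕ ε (suc p) 1))) (ES-cong d (S ∖ p) λ A → cong F (⊕-ε-suc 0 A p)))))
ES-remove-suc zero (true ∷ S) (suc p) Sp F = begin
  ES 0 S (F ∘ (1 ∷_)) ℚ.+ ES 1 S (F ∘ (0 ∷_))
    ≡⟨ cong₂ ℚ._+_ (ES-remove-zero S p (F ∘ (1 ∷_))) (ES-remove-suc 0 S p Sp (F ∘ (0 ∷_))) ⟩
  x ℚ.+ (ES 0 (S ∖ p) (λ A → F (0 ∷ (A ⊕ ε p 1))) ℚ.+ y)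
    ≡⟨ cong (λ z → x ℚ.+ (z ℚ.+ y)) (ES-cong 0 (S ∖ p) λ A → cong F (sym (⊕-ε-suc 0 A p))) ⟩
  x ℚ.+ (z ℚ.+ y) ≡⟨ rotate x y z ⟩
  z ℚ.+ (x ℚ.+ y) ∎
  where
  open ≡-Reasoning
  x = ES 0 (S ∖ p) (F ∘ (1 ∷_))
  y = ES 1 (S ∖ p) (F ∘ (0 ∷_))
  z = ES 0 (S ∖ p) (λ A → F ((0 ∷ A) ⊕ ε (suc p) 1))
  open Data.Rational.Solver.+-*-Solver using (solve; _:+_; _:=_)
  rotate : ∀ x y z → x ℚ.+ (z ℚ.+ y) ≡ z ℚ.+ (x ℚ.+ y)
  rotate = solve 3 (λ x y z → x :+ (z :+ y) := z :+ (x :+ y)) refl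
ES-remove-suc (suc d) (true ∷ S) (suc p) Sp F = begin
  ES (suc d) S (F ∘ (1 ∷_)) ℚ.+ ES (suc (suc d)) S (F ∘ (0 ∷_))
    ≡⟨ cong₂ ℚ._+_ (ES-remove-suc d S p Sp (F ∘ (1 ∷_))) (ES-remove-suc (suc d) S p Sp (F ∘ (0 ∷_))) ⟩
  (ES d (S ∖ p) (λ A → F (1 ∷ (A ⊕ ε p 1))) ℚ.+ x) ℚ.+ (ES (suc d) (S ∖ p) (λ A → F (0 ∷ (A ⊕ ε p 1))) ℚ.+ y)
    ≡⟨ cong₂ (λ z w → (z ℚ.+ x) ℚ.+ (w ℚ.+ y)) (ES-cong d (S ∖ p) λ A → cong F (sym (⊕-ε-suc 1 A p)))
                                               (ES-cong (suc d) (S ∖ p) λ A → cong F (sym (⊕-ε-suc 0 A p))) ⟩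
  (z ℚ.+ x) ℚ.+ (w ℚ.+ y) ≡⟨ interchange z x w y ⟩
  (z ℚ.+ w) ℚ.+ (x ℚ.+ y) ∎
  where
  open ≡-Reasoning
  x = ES (suc d) (S ∖ p) (F ∘ (1 ∷_))
  y = ES (suc (suc d)) (S ∖ p) (F ∘ (0 ∷_))
  z = ES d (S ∖ p) (λ A → F ((1 ∷ A) ⊕ ε (suc p) 1))
  w = ES (suc d) (S ∖ p) (λ A → F ((0 ∷ A) ⊕ ε (suc p) 1))
  open Data.Rational.Solver.+-*-Solver using (solve; _:+_; _:=_)
  interchange : ∀ a b c d → (a ℚ.+ b) ℚ.+ (c ℚ.+ d) ≡ (a ℚ.+ c) ℚ.+ (b ℚ.+ d)
  interchange = solve 4 (λ a b c d → (a :+ b) :+ (c :+ d) := (a :+ c) :+ (b :+ d)) refl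

indicator-outside : ∀ {n d} {S : Subset n} {A} → IndicatorIn d S A → ∀ i → lookup S i ≡ false → lookup A i ≡ 0
indicator-outside (skip I) zero    _  = refl
indicator-outside (skip I) (suc i) Si = indicator-outside I i Si
indicator-outside (take I) (suc i) Si = indicator-outside I i Si

indicator-≤ : ∀ {n d} {S : Subset n} {A} → IndicatorIn d S A → ∀ i → lookup A i ≤ ⟦ lookup S i ⟧
indicator-≤ (skip I) zero    = z≤n
indicator-≤ (skip I) (suc i) = indicator-≤ I i
indicator-≤ (take I) zero    = ≤-refl
indicator-≤ (take I) (suc i) = indicator-≤ I i

indicator-sum : ∀ {n d} {S : Subset n} {A} → IndicatorIn d S A → ∑ (lookup A) ≡ d
indicator-sum []       = refl
indicator-sum (skip I) = indicator-sum I
indicator-sum (take I) = cong suc (indicator-sum I)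

neg-self : ∀ x → x ≡ ℚ.- x → x ≡ 0ℚ
neg-self x eq = begin
  x                              ≡⟨ ℚP.*-identityˡ x ⟨
  (ℚ.½ ℚ.+ ℚ.½) ℚ.* x            ≡⟨ ℚP.*-distribʳ-+ x ℚ.½ ℚ.½ ⟩
  ℚ.½ ℚ.* x ℚ.+ ℚ.½ ℚ.* x        ≡⟨ ℚP.*-distribˡ-+ ℚ.½ x x ⟨
  ℚ.½ ℚ.* (x ℚ.+ x)              ≡⟨ cong (λ y → ℚ.½ ℚ.* (x ℚ.+ y)) eq ⟩
  ℚ.½ ℚ.* (x ℚ.+ ℚ.- x)          ≡⟨ cong (ℚ.½ ℚ.*_) (ℚP.+-inverseʳ x) ⟩
  ℚ.½ ℚ.* 0ℚ                     ≡⟨ ℚP.*-zeroʳ ℚ.½ ⟩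
  0ℚ                             ∎
  where open ≡-Reasoning

permute-fixed : ∀ {n} (p q : Fin n) m → lookup m p ≡ lookup m q → permute p q m ≡ m
permute-fixed p q m eq = vec-ext λ i → trans (lookup-permute p q m i) (go i)
  where
  go : ∀ i → lookup m (transpose p q i) ≡ lookup m i
  go i with transposed p q i
  ... | at-p refl e = trans (cong (lookup m) e) (sym eq)
  ... | at-q refl e = trans (cong (lookup m) e) eq
  ... | away _ _ e  = cong (lookup m) e

permute-⊕ : ∀ {n} (p q : Fin n) a b → permute p q (a ⊕ b) ≡ permute p q a ⊕ permute p q b
permute-⊕ p q a b = vec-ext λ i → begin
  lookup (permute p q (a ⊕ b)) i                             ≡⟨ lookup-permute p q (a ⊕ b) i ⟩
  lookup (a ⊕ b) (transpose p q i)                           ≡⟨ VecP.lookup-zipWith _+_ (transpose p q i) a b ⟩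
  lookup a (transpose p q i) + lookup b (transpose p q i)
    ≡⟨ cong₂ _+_ (lookup-permute p q a i) (lookup-permute p q b i) ⟨
  lookup (permute p q a) i + lookup (permute p q b) i
    ≡⟨ VecP.lookup-zipWith _+_ i (permute p q a) (permute p q b) ⟨
  lookup (permute p q a ⊕ permute p q b) i                   ∎
  where open ≡-Reasoning

lookup-ε-≢ : ∀ {n} {i j : Fin n} d → i ≢ j → lookup (ε i d) j ≡ 0
lookup-ε-≢ {i = i} {j} d i≢j = trans (VecP.lookup∘tabulate _ j) (cong (λ b → if b then d else 0) (==F-≢ i≢j))

permute-ε : ∀ {n} (p q : Fin n) d → permute p q (ε p d) ≡ ε q d
permute-ε p q d = vec-ext λ i → trans (lookup-permute p q (ε p d) i) (go i)
  where
  go : ∀ i → lookup (ε p d) (transpose p q i) ≡ lookup (ε q d) i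
  go i with transposed p q i
  ... | at-q refl e      = trans (cong (lookup (ε p d)) e) (trans (lookup-ε p d) (sym (lookup-ε q d)))
  ... | away i≢p i≢q e   = trans (cong (lookup (ε p d)) e) (trans (lookup-ε-≢ d (i≢p ∘ sym)) (sym (lookup-ε-≢ d (i≢q ∘ sym))))
  ... | at-p refl e with p Fin.≟ q
  ...   | yes refl = cong (lookup (ε p d)) e
  ...   | no p≢q   = trans (cong (lookup (ε p d)) e) (trans (lookup-ε-≢ d p≢q) (sym (lookup-ε-≢ d (p≢q ∘ sym))))

-- Subsets containing both or neither of p and q have indicators fixed by the swap, where G equals
-- its own negative. The others come in pairs exchanged by the swap, whose values cancel.
ES-antisymmetric : ∀ {n} (S : Subset n) p q → p ≢ q → lookup S p ≡ true → lookup S q ≡ true →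
  (G : Mon n → ℚ) → (∀ A → G (permute p q A) ≡ ℚ.- G A) → ∀ d → ES d S G ≡ 0ℚ
ES-antisymmetric {n} S p q p≢q Sp Sq G anti = cases
  where
  open ≡-Reasoning
  S₁ S₂ : Subset n
  S₁ = S ∖ p
  S₂ = S₁ ∖ q
  S₁q : lookup S₁ q ≡ true
  S₁q = trans (VecP.lookup∘updateAt′ q p (p≢q ∘ sym) S) Sq
  S₂q : lookup S₂ q ≡ false
  S₂q = VecP.lookup∘updateAt q S₁
  S₂p : lookup S₂ p ≡ false
  S₂p = trans (VecP.lookup∘updateAt′ p q p≢q S₁) (VecP.lookup∘updateAt p S)
  fixed : ∀ A → lookup A p ≡ lookup A q → G A ≡ 0ℚ
  fixed A eq = neg-self (G A) (trans (cong G (sym (permute-fixed p q A eq))) (anti A))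
  equal : ∀ {d A} → IndicatorIn d S₂ A → lookup A p ≡ lookup A q
  equal I = trans (indicator-outside I p S₂p) (sym (indicator-outside I q S₂q))
  none : ∀ d → ES d S₂ G ≡ 0ℚ
  none d = ES-zero d S₂ λ {A} I → fixed A (equal I)
  both : ∀ d → ES d S₂ (λ A → G ((A ⊕ ε q 1) ⊕ ε p 1)) ≡ 0ℚ
  both d = ES-zero d S₂ λ {A} I → fixed _ (begin
    lookup ((A ⊕ ε q 1) ⊕ ε p 1) p
      ≡⟨ trans (VecP.lookup-zipWith _+_ p (A ⊕ ε q 1) (ε p 1)) (cong (_+ lookup (ε p 1) p) (VecP.lookup-zipWith _+_ p A (ε q 1))) ⟩
    lookup A p + lookup (ε q 1) p + lookup (ε p 1) p
      ≡⟨ cong₂ _+_ (cong₂ _+_ (equal I) (lookup-ε-≢ 1 (p≢q ∘ sym))) (lookup-ε p 1) ⟩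
    lookup A q + 0 + 1 ≡⟨ swap (lookup A q) ⟩
    lookup A q + 1 + 0
      ≡⟨ cong₂ _+_ (cong (lookup A q +_) (lookup-ε q 1)) (lookup-ε-≢ 1 p≢q) ⟨
    lookup A q + lookup (ε q 1) q + lookup (ε p 1) q
      ≡⟨ trans (VecP.lookup-zipWith _+_ q (A ⊕ ε q 1) (ε p 1)) (cong (_+ lookup (ε p 1) q) (VecP.lookup-zipWith _+_ q A (ε q 1))) ⟨
    lookup ((A ⊕ ε q 1) ⊕ ε p 1) q ∎)
    where
    swap : ∀ x → x + 0 + 1 ≡ x + 1 + 0
    swap x = trans (cong (_+ 1) (+-identityʳ x)) (sym (+-identityʳ (x + 1)))
  one : ∀ d → ES d S₂ (λ A → G (A ⊕ ε p 1)) ℚ.+ ES d S₂ (λ A → G (A ⊕ ε q 1)) ≡ 0ℚ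
  one d = begin
    ES d S₂ (λ A → G (A ⊕ ε p 1)) ℚ.+ ES d S₂ (λ A → G (A ⊕ ε q 1))
      ≡⟨ cong (ES d S₂ (λ A → G (A ⊕ ε p 1)) ℚ.+_) (sym (ℚP.*-identityˡ _)) ⟩
    ES d S₂ (λ A → G (A ⊕ ε p 1)) ℚ.+ 1ℚ ℚ.* ES d S₂ (λ A → G (A ⊕ ε q 1))
      ≡⟨ ES-linear d S₂ 1ℚ (λ A → G (A ⊕ ε p 1)) (λ A → G (A ⊕ ε q 1)) ⟨
    ES d S₂ (λ A → G (A ⊕ ε p 1) ℚ.+ 1ℚ ℚ.* G (A ⊕ ε q 1))
      ≡⟨ ES-zero d S₂ (λ {A} I → trans (cong (G (A ⊕ ε p 1) ℚ.+_) (trans (ℚP.*-identityˡ _) (trans (cong G (sym (moved A (equal I)))) (anti (A ⊕ ε p 1)))))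
                                       (ℚP.+-inverseʳ (G (A ⊕ ε p 1)))) ⟩
    0ℚ ∎
    where
    moved : ∀ A → lookup A p ≡ lookup A q → permute p q (A ⊕ ε p 1) ≡ A ⊕ ε q 1
    moved A eq = trans (permute-⊕ p q A (ε p 1)) (cong₂ _⊕_ (permute-fixed p q A eq) (permute-ε p q 1))
  q-part : ∀ d → ES (suc d) S₁ G ≡ ES d S₂ (λ A → G (A ⊕ ε q 1))
  q-part d =
    trans (ES-remove-suc d S₁ q S₁q G) (trans (cong (ES d S₂ (λ A → G (A ⊕ ε q 1)) ℚ.+_) (none (suc d))) (ℚP.+-identityʳ _))
  p-part : ∀ d → ES d S₁ (λ A → G (A ⊕ ε p 1)) ≡ ES d S₂ (λ A → G (A ⊕ ε p 1))
  p-part zero    = ES-remove-zero S₁ q _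
  p-part (suc d) = trans (ES-remove-suc d S₁ q S₁q (λ A → G (A ⊕ ε p 1)))
    (trans (cong (ℚ._+ ES (suc d) S₂ (λ A → G (A ⊕ ε p 1))) (both d)) (ℚP.+-identityˡ _))
  cases : ∀ d → ES d S G ≡ 0ℚ
  cases zero    = trans (ES-remove-zero S p G) (trans (ES-remove-zero S₁ q G) (none 0))
  cases (suc d) = trans (ES-remove-suc d S p Sp G) (trans (cong₂ ℚ._+_ (p-part d) (q-part d)) (one d))

-- Induction on k: each further value is taken at most once.
pigeonhole-∑ : ∀ {n} (Q : Fin n → Bool) (a : Fin n → ℕ) → (∀ {x y} → Q x ≡ true → Q y ≡ true → a x ≡ a y → x ≡ y) →
  ∀ k → ∑ (λ y → ⟦ Q y ∧ (a y <ᵇ k) ⟧) ≤ k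
pigeonhole-∑ Q a a-inj zero = ≤-reflexive (∑-zero λ y → cong ⟦_⟧ (∧-zeroʳ (Q y)))
pigeonhole-∑ Q a a-inj (suc k) = begin
  ∑ (λ y → ⟦ Q y ∧ (a y <ᵇ suc k) ⟧) ≤⟨ ∑-mono (λ y → split (Q y) (a y)) ⟩
  ∑ (λ y → ⟦ Q y ∧ (a y ≡ᵇ k) ⟧ + ⟦ Q y ∧ (a y <ᵇ k) ⟧)
    ≡⟨ ∑-+ (λ y → ⟦ Q y ∧ (a y ≡ᵇ k) ⟧) (λ y → ⟦ Q y ∧ (a y <ᵇ k) ⟧) ⟩
  ∑ (λ y → ⟦ Q y ∧ (a y ≡ᵇ k) ⟧) + ∑ (λ y → ⟦ Q y ∧ (a y <ᵇ k) ⟧)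
    ≤⟨ +-mono-≤ (∑-at-most-one (λ y → Q y ∧ (a y ≡ᵇ k)) unique) (pigeonhole-∑ Q a a-inj k) ⟩
  suc k ∎
  where
  open ≤-Reasoning
  split : ∀ b x → ⟦ b ∧ (x <ᵇ suc k) ⟧ ≤ ⟦ b ∧ (x ≡ᵇ k) ⟧ + ⟦ b ∧ (x <ᵇ k) ⟧
  split false x = z≤n
  split true  x with <-cmp x k
  ... | tri< lt _ _ rewrite <⇒<ᵇ′ lt = ≤-trans (⟦⟧≤1 (x <ᵇ suc k)) (m≤n+m 1 _)
  ... | tri≈ _ refl _ rewrite ≡ᵇ-refl k = ≤-trans (⟦⟧≤1 (k <ᵇ suc k)) (m≤m+n 1 _)
  ... | tri> _ _ gt rewrite ≮⇒<ᵇ (≤⇒≯ gt) = z≤n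
  unique : ∀ {x y} → Q x ∧ (a x ≡ᵇ k) ≡ true → Q y ∧ (a y ≡ᵇ k) ≡ true → x ≡ y
  unique {x} {y} ex ey = let px , ax = ∧-true (Q x) _ ex ; py , ay = ∧-true (Q y) _ ey in
    a-inj px py (trans (≡ᵇ⇒≡′ (a x) k ax) (sym (≡ᵇ⇒≡′ (a y) k ay)))

-- By pigeonhole a x is at least the number of y ∈ Q with a y < a x, and both this count and the left-hand side
-- count every pair in Q once.
distinct-sum : ∀ {n} (Q : Fin n → Bool) (a : Fin n → ℕ) → (∀ {x y} → Q x ≡ true → Q y ≡ true → a x ≡ a y → x ≡ y) →
  ∑ (λ x → ⟦ Q x ⟧ * ∑ (λ y → ⟦ (x <F y) ∧ Q y ⟧)) ≤ ∑ (λ x → ⟦ Q x ⟧ * a x)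
distinct-sum {n} Q a a-inj = begin
  ∑ (λ x → ⟦ Q x ⟧ * ∑ (λ y → ⟦ (x <F y) ∧ Q y ⟧)) ≡⟨ ∑-cong (λ x → sym (∑-*ˡ ⟦ Q x ⟧ (λ y → ⟦ (x <F y) ∧ Q y ⟧))) ⟩
  ∑∑ g ≡⟨ double-cancel (trans (sym (symmetrize g)) (trans (∑-cong λ x → ∑-cong λ y → pairs x y) (symmetrize f))) ⟩
  ∑∑ f ≡⟨ ∑-cong (λ x → ∑-*ˡ ⟦ Q x ⟧ (λ y → ⟦ Q y ∧ (a y <ᵇ a x) ⟧)) ⟩
  ∑ (λ x → ⟦ Q x ⟧ * ∑ (λ y → ⟦ Q y ∧ (a y <ᵇ a x) ⟧))
    ≤⟨ ∑-mono (λ x → *-monoʳ-≤ ⟦ Q x ⟧ (pigeonhole-∑ Q a a-inj (a x))) ⟩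
  ∑ (λ x → ⟦ Q x ⟧ * a x) ∎
  where
  open ≤-Reasoning
  f g : Fin n → Fin n → ℕ
  f x y = ⟦ Q x ⟧ * ⟦ Q y ∧ (a y <ᵇ a x) ⟧
  g x y = ⟦ Q x ⟧ * ⟦ (x <F y) ∧ Q y ⟧
  ∑∑ : (Fin n → Fin n → ℕ) → ℕ
  ∑∑ h = ∑ λ x → ∑ (h x)
  symmetrize : ∀ h → ∑∑ (λ x y → h x y + h y x) ≡ ∑∑ h + ∑∑ h
  symmetrize h = trans (∑-cong λ x → ∑-+ (h x) (λ y → h y x)) (trans (∑-+ (λ x → ∑ (h x)) (λ x → ∑ λ y → h y x))
    (cong (∑∑ h +_) (∑-comm λ x y → h y x)))
  double-cancel : ∀ {x y} → x + x ≡ y + y → x ≡ y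
  double-cancel {x} {y} eq =
    *-cancelˡ-≡ x y 2 (trans (cong (x +_) (+-identityʳ x)) (trans eq (sym (cong (y +_) (+-identityʳ y)))))
  pairs : ∀ x y → g x y + g y x ≡ f x y + f y x
  pairs x y with Q x in Px | Q y in Py | compareF x y
  ... | false | false | _ = refl
  ... | false | true  | _ rewrite ∧-zeroʳ (y <F x) = refl
  ... | true  | false | _ rewrite ∧-zeroʳ (x <F y) = refl
  ... | true  | true  | same refl rewrite <F-irrefl x | ≮⇒<ᵇ {a x} (<-irrefl refl) = refl
  ... | true  | true  | before x<y y≮x x≢y rewrite x<y | y≮x | +-identityʳ ⟦ a y <ᵇ a x ⟧ | +-identityʳ ⟦ a x <ᵇ a y ⟧ =
    sym (<ᵇ-total λ eq → x≢y (sym (a-inj Py Px eq)))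
  ... | true  | true  | after x≮y y<x x≢y rewrite x≮y | y<x | +-identityʳ ⟦ a y <ᵇ a x ⟧ | +-identityʳ ⟦ a x <ᵇ a y ⟧ =
    sym (<ᵇ-total λ eq → x≢y (sym (a-inj Py Px eq)))

-- Harmonicity of δ_T

expσ<s : ∀ {n s} {α : Vec ℕ s} (σ : OP n s α) x → expσ σ x < s
expσ<s {suc n} {s} {α} σ x with view σ
expσ<s σ (suc x) | cons p τ {h} = subst (_< _) (sym (expσ-suc p τ h x)) (expσ<s τ x)
expσ<s {s = s} {α} σ zero | cons p τ {h} = by-pos (posOf 0 (lookup α p)) refl
  where
  0<s : 0 < s
  0<s = ≤-<-trans z≤n (FinP.toℕ<n p)
  conj≤s : ∀ j → conj α j ≤ s
  conj≤s j rewrite count-∑ (λ b → j ≤ᵇ lookup α b) =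
    subst (∑ (λ b → ⟦ j ≤ᵇ lookup α b ⟧) ≤_) (∑-one s) (∑-mono λ b → ⟦⟧≤1 (j ≤ᵇ lookup α b))
  by-pos : ∀ q → posOf 0 (lookup α p) ≡ q → expσ (σ⁺ p τ h) zero < s
  by-pos floating eq rewrite expσ-zero p τ h floating eq = ∸-monoʳ-< {s} {1} {0} (s≤s z≤n) 0<s
  by-pos (box j)  eq rewrite expσ-zero p τ h (box j) eq =
    subst (_≤ s) (trans (conj-⊖ p τ h j) (cong (_+ conj (α ⊖ p) j) (trans (cong (λ q → ⟦ inRow q j ⟧) eq) (cong ⟦_⟧ (≡ᵇ-refl j))))) (conj≤s j)

isBox : Pos → Bool
isBox q = not (isFloating q)

boxes-in-block : ∀ {n s} {α : Vec ℕ s} (σ : OP n s α) b → lookup α b ≤ ∑ (λ x → ⟦ bl σ x ==F b ⟧ * ⟦ isBox (pos σ x) ⟧)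
boxes-in-block {zero}  σ b = big σ b
boxes-in-block {suc n} {s} {α} σ b with view σ
... | cons p τ {h} = begin
  lookup α b ≤⟨ step ⟩
  ⟦ p ==F b ⟧ * ⟦ isBox (posOf 0 (lookup α p)) ⟧ + lookup (α ⊖ p) b
    ≤⟨ +-monoʳ-≤ (⟦ p ==F b ⟧ * ⟦ isBox (posOf 0 (lookup α p)) ⟧) (boxes-in-block τ b) ⟩
  ⟦ p ==F b ⟧ * ⟦ isBox (posOf 0 (lookup α p)) ⟧ + ∑ (λ x → ⟦ bl τ x ==F b ⟧ * ⟦ isBox (pos τ x) ⟧)
    ≡⟨ cong₂ _+_ (cong (λ q → ⟦ p ==F b ⟧ * ⟦ isBox q ⟧) (pos-zero p τ h))
                 (∑-cong λ x → cong (λ q → ⟦ bl τ x ==F b ⟧ * ⟦ isBox q ⟧) (pos-suc p τ h x)) ⟨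
  ∑ (λ x → ⟦ bl (σ⁺ p τ h) x ==F b ⟧ * ⟦ isBox (pos (σ⁺ p τ h) x) ⟧) ∎
  where
  open ≤-Reasoning
  top : ∀ a → a ≤ ⟦ isBox (posOf 0 a) ⟧ + 0 + ℕ.pred a
  top zero    = z≤n
  top (suc a) = ≤-refl
  step : lookup α b ≤ ⟦ p ==F b ⟧ * ⟦ isBox (posOf 0 (lookup α p)) ⟧ + lookup (α ⊖ p) b
  step with p Fin.≟ b
  ... | no p≢b   = ≤-reflexive (sym (lookup-⊖-≢ α p≢b))
  ... | yes refl rewrite lookup-⊖ α p = top (lookup α p)

pos-box-suc : ∀ {n s} {α : Vec ℕ s} (σ : OP n s α) x {j} → pos σ x ≡ box j → ∃ λ r → j ≡ suc r
pos-box-suc {α = α} σ x eq = positive (rank σ x) (lookup α (bl σ x)) eq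
  where
  positive : ∀ r a {j} → posOf r a ≡ box j → ∃ λ r′ → j ≡ suc r′
  positive zero    (suc a) refl = a , refl
  positive (suc r) (suc a) eq   = positive r a eq

inRow⇒ : ∀ q j → inRow q j ≡ true → q ≡ box j
inRow⇒ (box r) j eq = cong box (≡ᵇ⇒≡′ r j eq)

size-∑ : ∀ {n} (S : Subset n) → ∣ S ∣ ≡ ∑ (λ x → ⟦ lookup S x ⟧)
size-∑ []          = refl
size-∑ (true ∷ S)  = cong suc (size-∑ S)
size-∑ (false ∷ S) = size-∑ S

complement-∑ : ∀ {n} (S : Subset n) → n ∸ ∣ S ∣ ≡ ∑ (λ x → ⟦ not (lookup S x) ⟧)
complement-∑ []          = refl
complement-∑ (true ∷ S)  = complement-∑ S
complement-∑ {suc n} (false ∷ S) = trans (+-∸-assoc 1 (SubsetP.∣p∣≤n S)) (cong suc (complement-∑ S))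

module _ {n s} {α : Vec ℕ s} (σ : OP n s α) (S : Subset n) where

  -- The rows contained in S are the columns of T(σ) whose antisymmetry survives the action of
  -- e_d(S), since e_d(S) is symmetric in the variables of S.
  rowInside : ℕ → Bool
  rowInside c = count (λ y → inRow (pos σ y) c ∧ not (lookup S y)) ≡ᵇ 0

  insideOf : Pos → Bool
  insideOf floating = false
  insideOf (box c)  = rowInside c

  inside : Fin n → Bool
  inside x = insideOf (pos σ x)

  rowInside⇒ : ∀ c → rowInside c ≡ true → ∀ y → inRow (pos σ y) c ≡ true → lookup S y ≡ true
  rowInside⇒ c h y inr with lookup S y | count≡0⇒false (λ y → inRow (pos σ y) c ∧ not (lookup S y)) h y
  ... | true  | _  = refl
  ... | false | e with () ← trans (sym e) (cong (_∧ true) inr)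

  inside⇒box : ∀ x → inside x ≡ true → ∃ λ c → pos σ x ≡ box c × rowInside c ≡ true
  inside⇒box x h with pos σ x
  ... | box c = c , refl , h

  inside⇒∈ : ∀ x → inside x ≡ true → lookup S x ≡ true
  inside⇒∈ x h = let c , eq , ins = inside⇒box x h in
    rowInside⇒ c ins x (trans (cong (λ q → inRow q c) eq) (≡ᵇ-refl c))

  sameRow : Pos → Pos → Bool
  sameRow floating _ = false
  sameRow (box c)  q = inRow q c

  -- When such a pair exists, the swap of p and q fixes a, so the shift of D δ_T by a is again
  -- antisymmetric and `ES-antisymmetric` applies.
  repeats : Mon n → Fin n → Fin n → Bool
  repeats a p q = inside p ∧ (not (p ==F q) ∧ (sameRow (pos σ p) (pos σ q) ∧ (lookup a p ≡ᵇ lookup a q)))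

  -- Every row that is not inside S contains an element outside S, and meets each block at most once.
  excess≤inside : excess α (n ∸ ∣ S ∣) ≤ ∑ (λ x → ⟦ inside x ⟧)
  excess≤inside = begin
    excess α (n ∸ ∣ S ∣) ≤⟨ ∑-mono per-block ⟩
    ∑ (λ b → ∑ λ x → ⟦ bl σ x ==F b ⟧ * ⟦ inside x ⟧)
      ≡⟨ ∑-cong (λ b → sym (+-identityʳ (∑ λ x → ⟦ bl σ x ==F b ⟧ * ⟦ inside x ⟧))) ⟩
    ∑ (λ b → 1 * ∑ λ x → ⟦ bl σ x ==F b ⟧ * ⟦ inside x ⟧) ≡⟨ ∑-blocks σ (λ _ → 1) (λ x → ⟦ inside x ⟧) ⟨
    ∑ (λ x → 1 * ⟦ inside x ⟧) ≡⟨ ∑-cong (λ x → +-identityʳ ⟦ inside x ⟧) ⟩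
    ∑ (λ x → ⟦ inside x ⟧) ∎
    where
    open ≤-Reasoning
    module _ (b : Fin s) where
      B outside : Fin n → ℕ
      B x       = ⟦ bl σ x ==F b ⟧
      outside x = ⟦ isBox (pos σ x) ∧ not (inside x) ⟧
      once : ∀ q → (∃ λ z → pos σ z ≡ q) → ∑ (λ x → B x * ⟦ sameRow q (pos σ x) ⟧) ≤ 1
      once floating _ = ≤-trans (≤-reflexive (∑-zero λ x → *-zeroʳ (B x))) z≤n
      -- Rows are numbered from 1; a box occupied by some z is in such a row, where `rowcount`
      -- applies.
      once (box c) (z , eq) with pos-box-suc σ z eq
      ... | r , refl = ≤-trans (≤-reflexive (rowcount σ b r)) (⟦⟧≤1 (r <ᵇ lookup α b))
      witness : ∀ x → outside x ≤ ∑ (λ z → ⟦ not (lookup S z) ⟧ * ⟦ sameRow (pos σ z) (pos σ x) ⟧)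
      witness x with pos σ x
      ... | floating = z≤n
      ... | box c with rowInside c in ins
      ...   | true  = z≤n
      ...   | false =
        let z , h = count≢0⇒true (λ y → inRow (pos σ y) c ∧ not (lookup S y)) ins
            inr , z∉S = ∧-true (inRow (pos σ z) c) (not (lookup S z)) h
        in ≤-trans (≤-reflexive (cong₂ (λ u v → ⟦ u ⟧ * ⟦ v ⟧) (sym z∉S)
             (sym (trans (cong (λ q → sameRow q (box c)) (inRow⇒ (pos σ z) c inr)) (≡ᵇ-refl c)))))
           (∑-term (λ z → ⟦ not (lookup S z) ⟧ * ⟦ sameRow (pos σ z) (box c) ⟧) z)
      -- Double counting of pairs (x, z) with z outside S in the row of x: every x counted on the
      -- left has such a z, and z serves at most one x of block b.
      few-outside : ∑ (λ x → B x * outside x) ≤ n ∸ ∣ S ∣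
      few-outside = begin
        ∑ (λ x → B x * outside x) ≤⟨ ∑-mono (λ x → *-monoʳ-≤ (B x) (witness x)) ⟩
        ∑ (λ x → B x * ∑ λ z → N z * R z x) ≡⟨ ∑-cong (λ x → sym (∑-*ˡ (B x) (λ z → N z * R z x))) ⟩
        ∑ (λ x → ∑ λ z → B x * (N z * R z x)) ≡⟨ ∑-comm (λ x z → B x * (N z * R z x)) ⟩
        ∑ (λ z → ∑ λ x → B x * (N z * R z x))
          ≡⟨ ∑-cong (λ z → trans (∑-cong λ x → *-exchange (B x) (N z) (R z x)) (∑-*ˡ (N z) (λ x → B x * R z x))) ⟩
        ∑ (λ z → N z * ∑ λ x → B x * R z x) ≤⟨ ∑-mono (λ z → *-monoʳ-≤ (N z) (once (pos σ z) (z , refl))) ⟩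
        ∑ (λ z → N z * 1) ≡⟨ ∑-cong (λ z → *-identityʳ (N z)) ⟩
        ∑ N ≡⟨ complement-∑ S ⟨
        n ∸ ∣ S ∣ ∎
        where
        N : Fin n → ℕ
        N z = ⟦ not (lookup S z) ⟧
        R : Fin n → Fin n → ℕ
        R z x = ⟦ sameRow (pos σ z) (pos σ x) ⟧
      dichotomy : ∀ x → ⟦ isBox (pos σ x) ⟧ ≤ outside x + ⟦ inside x ⟧
      dichotomy x with pos σ x
      ... | floating = z≤n
      ... | box c with rowInside c
      ...   | true  = ≤-refl
      ...   | false = ≤-refl
      per-block : lookup α b ∸ (n ∸ ∣ S ∣) ≤ ∑ (λ x → B x * ⟦ inside x ⟧)
      per-block = m≤n+o⇒m∸n≤o (lookup α b) (n ∸ ∣ S ∣) (begin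
        lookup α b ≤⟨ boxes-in-block σ b ⟩
        ∑ (λ x → B x * ⟦ isBox (pos σ x) ⟧) ≤⟨ ∑-mono (λ x → *-monoʳ-≤ (B x) (dichotomy x)) ⟩
        ∑ (λ x → B x * (outside x + ⟦ inside x ⟧)) ≡⟨ ∑-cong (λ x → *-distribˡ-+ (B x) (outside x) ⟦ inside x ⟧) ⟩
        ∑ (λ x → B x * outside x + B x * ⟦ inside x ⟧) ≡⟨ ∑-+ (λ x → B x * outside x) (λ x → B x * ⟦ inside x ⟧) ⟩
        ∑ (λ x → B x * outside x) + ∑ (λ x → B x * ⟦ inside x ⟧) ≤⟨ +-monoˡ-≤ _ few-outside ⟩
        n ∸ ∣ S ∣ + ∑ (λ x → B x * ⟦ inside x ⟧) ∎)

  -- The d places of A and the elements of rows inside S all lie in S, and together they number more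
  -- than |S|, so they overlap.
  meets-inside : ∀ {d A} → ∣ S ∣ < d + excess α (n ∸ ∣ S ∣) → IndicatorIn d S A → ∃ λ x → inside x ≡ true × lookup A x ≢ 0
  meets-inside {d} {A} cond I with find (λ x → inside x ∧ not (lookup A x ≡ᵇ 0))
  ... | inj₂ (x , h) = let ins , A≢0 = ∧-true (inside x) (not (lookup A x ≡ᵇ 0)) h in
    x , ins , λ A≡0 → true≢false A≢0 (cong (λ a → not (a ≡ᵇ 0)) A≡0)
  ... | inj₁ h = contradiction cond (≤⇒≯ (begin
    d + excess α (n ∸ ∣ S ∣)                   ≤⟨ +-monoʳ-≤ d excess≤inside ⟩
    d + ∑ (λ x → ⟦ inside x ⟧)                 ≡⟨ cong (_+ ∑ (λ x → ⟦ inside x ⟧)) (indicator-sum I) ⟨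
    ∑ (lookup A) + ∑ (λ x → ⟦ inside x ⟧)      ≡⟨ ∑-+ (lookup A) (λ x → ⟦ inside x ⟧) ⟨
    ∑ (λ x → lookup A x + ⟦ inside x ⟧)        ≤⟨ ∑-mono termwise ⟩
    ∑ (λ x → ⟦ lookup S x ⟧)                   ≡⟨ size-∑ S ⟨
    ∣ S ∣                                      ∎))
    where
    open ≤-Reasoning
    termwise : ∀ x → lookup A x + ⟦ inside x ⟧ ≤ ⟦ lookup S x ⟧
    termwise x with inside x in ins | h x
    ... | false | _ = subst (_≤ ⟦ lookup S x ⟧) (sym (+-identityʳ _)) (indicator-≤ I x)
    ... | true  | e with lookup A x
    ...   | zero  = ≤-reflexive (cong ⟦_⟧ (sym (inside⇒∈ x ins)))
    termwise x | true | () | suc _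

tab-box : ∀ {n s} {α : Vec ℕ s} (σ : OP n s α) x {c} → pos σ x ≡ box c → tab σ x ≡ just c
tab-box σ x eq with pos σ x
tab-box σ x refl | box c = refl

-- e_d(S) annihilates δ_T because a coefficient of the result is antisymmetric in the columns inside S; if its
-- exponents are distinct on all of them, then their degree there is already that of δ_T, whereas every term of
-- e_d(S) has a factor in one of these columns.
Harmonic-δT : ∀ {n s} {α : Vec ℕ s} (σ : OP n s α) → Harmonic α (D (δT s (tab σ)))
Harmonic-δT {n} {s} {α} σ = record { pow = vanish ; elem = elementary }
  where
  Θ = tab σ
  vanish : ∀ i m → s ≤ lookup m i → D (δT s Θ) m ≡ 0ℚ
  vanish i m s≤ = trans (cong (fac m ℚ.*_) (coeff-δT-bounded s Θ (expσ<s σ) i m s≤)) (ℚP.*-zeroʳ (fac m))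
  elementary : ∀ S d → ∣ S ∣ < d + excess α (n ∸ ∣ S ∣) → ∀ a → ES d S (λ A → D (δT s Θ) (a ⊕ A)) ≡ 0ℚ
  elementary S d cond a with find (λ p → not (count (repeats σ S a p) ≡ᵇ 0))
  ... | inj₂ (p , h) = ES-antisymmetric S p q p≢q (inside⇒∈ σ S p ins) (rowInside⇒ σ S c row-in q q-row)
      (λ A → D (δT s Θ) (a ⊕ A)) antisym d
    where
    not-true : ∀ {b} → not b ≡ true → b ≡ false
    not-true {false} _ = refl
    hit = count≢0⇒true (repeats σ S a p) (not-true h)
    q = proj₁ hit
    split₁ = ∧-true (inside σ S p) _ (proj₂ hit)
    split₂ = ∧-true (not (p ==F q)) _ (proj₂ split₁)
    split₃ = ∧-true (sameRow σ S (pos σ p) (pos σ q)) _ (proj₂ split₂)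
    ins = proj₁ split₁
    p≢q : p ≢ q
    p≢q p≡q = true≢false (trans (cong (_==F q) p≡q) (==F-refl q)) (not-true (proj₁ split₂))
    in-box = inside⇒box σ S p ins
    c = proj₁ in-box
    row-in = proj₂ (proj₂ in-box)
    q-row : inRow (pos σ q) c ≡ true
    q-row = trans (cong (λ r → sameRow σ S r (pos σ q)) (sym (proj₁ (proj₂ in-box)))) (proj₁ split₃)
    a-fixed : permute p q a ≡ a
    a-fixed = permute-fixed p q a (≡ᵇ⇒≡′ _ _ (proj₂ split₃))
    antisym : ∀ A → D (δT s Θ) (a ⊕ permute p q A) ≡ ℚ.- D (δT s Θ) (a ⊕ A)
    antisym A = trans (cong (D (δT s Θ)) (trans (cong (_⊕ permute p q A) (sym a-fixed)) (sym (permute-⊕ p q a A))))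
      (D-δT-antisymmetric s Θ p q p≢q (tab-box σ p (proj₁ (proj₂ in-box))) (tab-box σ q (inRow⇒ (pos σ q) c q-row)) (a ⊕ A))
  ... | inj₁ h = ES-zero d S λ {A} I →
      trans (cong (fac (a ⊕ A) ℚ.*_) (too-large A (meets-inside σ S cond I))) (ℚP.*-zeroʳ (fac (a ⊕ A)))
    where
    not-false : ∀ {b} → not b ≡ false → b ≡ true
    not-false {true} _ = refl
    too-large : ∀ A → (∃ λ x → inside σ S x ≡ true × lookup A x ≢ 0) → coeff (δT s Θ) (a ⊕ A) ≡ 0ℚ
    too-large A (x , ins , Ax≢0) = coeff-δT-column s Θ c (a ⊕ A) (λ eq → <⇒≢ strict (sym eq))
      where
      in-box = inside⇒box σ S x ins
      c = proj₁ in-box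
      Q : Fin n → Bool
      Q y = sameCol s Θ (Θ y) (just c)
      Q⇒box : ∀ {y} → Q y ≡ true → pos σ y ≡ box c
      Q⇒box {y} Qy = inRow⇒ (pos σ y) c (trans (sym (sameCol-tab σ y c)) Qy)
      distinct : ∀ {y z} → Q y ≡ true → Q z ≡ true → lookup a y ≡ lookup a z → y ≡ z
      distinct {y} {z} Qy Qz eq with y Fin.≟ z
      ... | yes y≡z = y≡z
      ... | no y≢z  = ⊥-elim (true≢false
        (cong₂ _∧_ (trans (cong (insideOf σ S) (Q⇒box Qy)) (proj₂ (proj₂ in-box)))
          (cong₂ _∧_ (cong not (==F-≢ y≢z))
            (cong₂ _∧_ (trans (cong₂ (sameRow σ S) (Q⇒box Qy) (Q⇒box Qz)) (≡ᵇ-refl c))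
                       (trans (cong (_≡ᵇ lookup a z) eq) (≡ᵇ-refl (lookup a z))))))
        (count≡0⇒false (repeats σ S a y)
          (not-false (h y)) z))
      column-exp : ∀ y → ⟦ Q y ⟧ * expT s Θ y ≡ ⟦ Q y ⟧ * ∑ (λ z → ⟦ (y <F z) ∧ Q z ⟧)
      column-exp y with Q y in Qy
      ... | false = refl
      ... | true  = cong (_+ 0) (expT-just s Θ y c (sameCol⇒ s Θ (Θ y) c Qy))
      Qx : Q x ≡ true
      Qx = trans (sameCol-tab σ x c) (trans (cong (λ q → inRow q c) (proj₁ (proj₂ in-box))) (≡ᵇ-refl c))
      -- The exponents of a on column c are distinct, so their sum already reaches the degree of
      -- x(T) there; A adds at least one more at x.
      strict : ∑ (λ y → ⟦ Q y ⟧ * expT s Θ y) < ∑ (λ y → ⟦ Q y ⟧ * lookup (a ⊕ A) y)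
      strict = begin-strict
        ∑ (λ y → ⟦ Q y ⟧ * expT s Θ y)                    ≡⟨ ∑-cong column-exp ⟩
        ∑ (λ y → ⟦ Q y ⟧ * ∑ (λ z → ⟦ (y <F z) ∧ Q z ⟧))  ≤⟨ distinct-sum Q (lookup a) distinct ⟩
        ∑ (λ y → ⟦ Q y ⟧ * lookup a y)                    <⟨ ∑-mono-< (λ y → *-monoʳ-≤ ⟦ Q y ⟧ (grows y)) x grows-x ⟩
        ∑ (λ y → ⟦ Q y ⟧ * lookup (a ⊕ A) y)              ∎
        where
        open ≤-Reasoning
        grows : ∀ y → lookup a y ≤ lookup (a ⊕ A) y
        grows y = subst (lookup a y ≤_) (sym (VecP.lookup-zipWith _+_ y a A)) (m≤m+n _ _)
        grows-x : ⟦ Q x ⟧ * lookup a x < ⟦ Q x ⟧ * lookup (a ⊕ A) x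
        grows-x = subst (λ b → ⟦ b ⟧ * lookup a x < ⟦ b ⟧ * lookup (a ⊕ A) x) (sym Qx)
          (+-monoˡ-< 0 (subst (lookup a x <_) (sym (VecP.lookup-zipWith _+_ x a A)) (m<m+n (lookup a x) (n≢0⇒n>0 Ax≢0))))

-- Triangularity

*-cancel-zero : ∀ x y → x ≢ 0ℚ → x ℚ.* y ≡ 0ℚ → y ≡ 0ℚ
*-cancel-zero x y x≢0 eq = begin
  y                        ≡⟨ ℚP.*-identityˡ y ⟨
  1ℚ ℚ.* y                 ≡⟨ cong (ℚ._* y) (ℚP.*-inverseˡ x) ⟨
  (ℚ.1/ x ℚ.* x) ℚ.* y     ≡⟨ ℚP.*-assoc (ℚ.1/ x) x y ⟩
  ℚ.1/ x ℚ.* (x ℚ.* y)     ≡⟨ cong (ℚ.1/ x ℚ.*_) eq ⟩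
  ℚ.1/ x ℚ.* 0ℚ            ≡⟨ ℚP.*-zeroʳ (ℚ.1/ x) ⟩
  0ℚ                       ∎
  where
  open ≡-Reasoning
  instance _ = ℚ.≢-nonZero x≢0

-- V is closed under differentiation because I is an ideal.
Harmonic-shift : ∀ {n s} {α : Vec ℕ s} {F : Mon n → ℚ} v → Harmonic α F → Harmonic α (λ m → F (m ⊕ v))
Harmonic-shift {s = s} {F = F} v H = record
  { pow  =
    λ i m s≤ → Harmonic.pow H i (m ⊕ v) (≤-trans s≤ (subst (lookup m i ≤_) (sym (VecP.lookup-zipWith _+_ i m v)) (m≤m+n _ _)))
  ; elem = λ S d cond a → trans (ES-cong d S λ A → cong F (exchange a A)) (Harmonic.elem H S d cond (a ⊕ v))
  }
  where
  exchange : ∀ a A → (a ⊕ A) ⊕ v ≡ (a ⊕ v) ⊕ A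
  exchange a A = trans (VecP.zipWith-assoc +-assoc a A v)
    (trans (cong (a ⊕_) (VecP.zipWith-comm +-comm A v)) (sym (VecP.zipWith-assoc +-assoc a v A)))

Harmonic-cong : ∀ {n s} {α : Vec ℕ s} {F G : Mon n → ℚ} → (∀ m → F m ≡ G m) → Harmonic α F → Harmonic α G
Harmonic-cong F≡G H = record
  { pow  = λ i m s≤ → trans (sym (F≡G m)) (Harmonic.pow H i m s≤)
  ; elem = λ S d cond a → trans (sym (ES-cong d S λ A → F≡G (a ⊕ A))) (Harmonic.elem H S d cond a)
  }

Harmonic-+* : ∀ {n s} {α : Vec ℕ s} {F G : Mon n → ℚ} c → Harmonic α F → Harmonic α G → Harmonic α (λ m → F m ℚ.+ c ℚ.* G m)
Harmonic-+* {F = F} {G} c HF HG = record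
  { pow  = λ i m s≤ → combine (Harmonic.pow HF i m s≤) (Harmonic.pow HG i m s≤)
  ; elem = λ S d cond a → trans (ES-linear d S c (λ A → F (a ⊕ A)) (λ A → G (a ⊕ A)))
             (combine (Harmonic.elem HF S d cond a) (Harmonic.elem HG S d cond a))
  }
  where
  combine : ∀ {x y} → x ≡ 0ℚ → y ≡ 0ℚ → x ℚ.+ c ℚ.* y ≡ 0ℚ
  combine refl refl = trans (ℚP.+-identityˡ _) (ℚP.*-zeroʳ c)

module _ {n s} {α : Vec ℕ s} (σ : OP n s α) where

  Δ : Mon n → ℚ
  Δ = D (δσ σ)

  codeVec : Mon n
  codeVec = tabulate (code σ)

  slack : Mon n
  slack = tabulate (λ i → maxcode σ i ∸ code σ i)

  Δ-shift : ∀ m → Δ m ≡ D (δT s (tab σ)) (m ⊕ slack)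
  Δ-shift m = trans (D-⊙ (monomial slack) (δT s (tab σ)) m) (eval-monomial slack (λ e → D (δT s (tab σ)) (m ⊕ e)))

  Δ-harmonic : Harmonic α Δ
  Δ-harmonic = Harmonic-cong (sym ∘ Δ-shift) (Harmonic-shift slack (Harmonic-δT σ))

  code⊕slack : codeVec ⊕ slack ≡ leadExp s (tab σ)
  code⊕slack = vec-ext λ i → begin
    lookup (codeVec ⊕ slack) i                    ≡⟨ VecP.lookup-zipWith _+_ i codeVec slack ⟩
    lookup codeVec i + lookup slack i
      ≡⟨ cong₂ _+_ (VecP.lookup∘tabulate (code σ) i) (VecP.lookup∘tabulate (λ i → maxcode σ i ∸ code σ i) i) ⟩
    code σ i + (maxcode σ i ∸ code σ i)           ≡⟨ cong (λ a → code σ i + (a ∸ code σ i)) (maxcode≡expσ σ i) ⟩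
    code σ i + (expσ σ i ∸ code σ i)              ≡⟨ m+[n∸m]≡n (code≤expσ σ i) ⟩
    expσ σ i                                      ≡⟨ VecP.lookup∘tabulate (expσ σ) i ⟨
    lookup (leadExp s (tab σ)) i                  ∎
    where open ≡-Reasoning

  ≺-⊕ : ∀ {k} {m m′ : Mon k} v → m ≺ m′ → m ⊕ v ≺ m′ ⊕ v
  ≺-⊕ (x ∷ v) (this lt _)    = this (+-monoˡ-< x lt) refl
  ≺-⊕ (x ∷ v) (next refl lt) = next refl (≺-⊕ v lt)

  -- Adding `slack` preserves ≺ and carries the code to `leadExp`, so exponents above the code are
  -- carried to where δ_T vanishes.
  Δ-leading : IsLeading Δ codeVec
  Δ-leading =
    (λ eq → proj₁ lead (*-cancel-zero (fac b) _ (fac≢0 b) (trans (cong (D (δT s (tab σ))) (sym code⊕slack)) (trans (sym (Δ-shift codeVec)) eq)))) ,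
    (λ m lt → trans (Δ-shift m) (trans (cong (fac (m ⊕ slack) ℚ.*_) (proj₂ lead (m ⊕ slack) (subst (_≺ m ⊕ slack) code⊕slack (≺-⊕ slack lt))))
                                       (ℚP.*-zeroʳ (fac (m ⊕ slack)))))
    where
    b = leadExp s (tab σ)
    lead = coeff-δT-leading s (tab σ)

D-lincomb : ∀ {n s} {α : Vec ℕ s} (L : List (ℚ × OP n s α)) m → D (lincomb L) m ≡ Σℚ L (λ t → proj₁ t ℚ.* Δ (proj₂ t) m)
D-lincomb L m = begin
  fac m ℚ.* coeff (lincomb L) m ≡⟨ cong (fac m ℚ.*_) (coeff-sum (λ t → scaleₚ (proj₁ t) (δσ (proj₂ t))) L m) ⟩
  fac m ℚ.* Σℚ L (λ t → coeff (scaleₚ (proj₁ t) (δσ (proj₂ t))) m)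
    ≡⟨ Σℚ-*ˡ (fac m) L (λ t → coeff (scaleₚ (proj₁ t) (δσ (proj₂ t))) m) ⟨
  Σℚ L (λ t → fac m ℚ.* coeff (scaleₚ (proj₁ t) (δσ (proj₂ t))) m)
    ≡⟨ Σℚ-cong L (λ t → trans (cong (fac m ℚ.*_) (coeff-scale (proj₁ t) (δσ (proj₂ t)) m)) (swap (fac m) (proj₁ t) (coeff (δσ (proj₂ t)) m))) ⟩
  Σℚ L (λ t → proj₁ t ℚ.* Δ (proj₂ t) m) ∎
  where
  open ≡-Reasoning
  open Data.Rational.Solver.+-*-Solver using (solve; _:*_; _:=_)
  swap : ∀ x y z → x ℚ.* (y ℚ.* z) ≡ y ℚ.* (x ℚ.* z)
  swap = solve 3 (λ x y z → x :* (y :* z) := y :* (x :* z)) refl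

-- Spanning and independence from leading exponents

≺-compare : ∀ {n} (m m′ : Mon n) → m ≺ m′ ⊎ m ≡ m′ ⊎ m′ ≺ m
≺-compare []      []        = inj₂ (inj₁ refl)
≺-compare (x ∷ m) (y ∷ m′) with <-cmp x y
... | tri< lt _ _ = inj₁ (this lt refl)
... | tri> _ _ gt = inj₂ (inj₂ (this gt refl))
... | tri≈ _ refl _ with ≺-compare m m′
...   | inj₁ lt          = inj₁ (next refl lt)
...   | inj₂ (inj₁ refl) = inj₂ (inj₁ refl)
...   | inj₂ (inj₂ gt)   = inj₂ (inj₂ (next refl gt))

≺-trans : ∀ {n} {a b c : Mon n} → a ≺ b → b ≺ c → a ≺ c
≺-trans (this x _)    (this y _)    = this (<-trans x y) refl
≺-trans (this x _)    (next refl _) = this x refl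
≺-trans (next refl _) (this y _)    = this y refl
≺-trans (next refl x) (next refl y) = next refl (≺-trans x y)

≺-wellFounded : ∀ {n} → WellFounded (_≺_ {n})
≺-wellFounded = Lex.<-wellFounded trans (λ { refl lt → lt }) <-wellFounded

-- F is an arbitrary function, so a largest exponent exists only thanks to the bound s: the first
-- entry is searched downwards from s, and the rest recursively.
leading-term : ∀ {n} s (F : Mon n → ℚ) → (∀ i m → s ≤ lookup m i → F m ≡ 0ℚ) → (∀ m → F m ≡ 0ℚ) ⊎ ∃ (IsLeading F)
leading-term {zero} s F bounded with F [] ℚP.≟ 0ℚ
... | yes eq = inj₁ λ { [] → eq }
... | no ne  = inj₂ ([] , ne , λ { [] (Lex.base ()) })
leading-term {suc n} s F bounded = below s (λ x m s≤x → bounded zero (x ∷ m) s≤x)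
  where
  below : ∀ k → (∀ x m → k ≤ x → F (x ∷ m) ≡ 0ℚ) → (∀ m → F m ≡ 0ℚ) ⊎ ∃ (IsLeading F)
  below zero    above = inj₁ λ { (x ∷ m) → above x m z≤n }
  below (suc k) above with leading-term s (F ∘ (k ∷_)) (λ i m s≤ → bounded (suc i) (k ∷ m) s≤)
  ... | inj₂ (m , ne , higher) = inj₂ (k ∷ m , ne , λ { (x ∷ m′) (this k<x _) → above x m′ k<x ; (.k ∷ m′) (next refl lt) → higher m′ lt })
  ... | inj₁ none = below k λ x m k≤x → case m≤n⇒m<n∨m≡n k≤x of λ where
    (inj₁ k<x)  → above x m k<x
    (inj₂ refl) → none m

restore : ∀ f c x → f ≡ c ℚ.* x ℚ.+ (f ℚ.+ (ℚ.- c) ℚ.* x)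
restore = solve 3 (λ f c x → f := c :* x :+ (f :+ (:- c) :* x)) refl
  where open Data.Rational.Solver.+-*-Solver using (solve; _:+_; _:*_; :-_; _:=_)

cancel-leading : ∀ {n} (F G : Mon n → ℚ) m → IsLeading F m → IsLeading G m →
  ∃ λ c → ∀ m′ → m ≡ m′ ⊎ m ≺ m′ → F m′ ℚ.+ (ℚ.- c) ℚ.* G m′ ≡ 0ℚ
cancel-leading F G m leadF leadG = c , λ where
    m′ (inj₁ refl) → begin
      F m ℚ.+ (ℚ.- c) ℚ.* G m      ≡⟨ cong (F m ℚ.+_) (ℚP.neg-distribˡ-* c (G m)) ⟨
      F m ℚ.+ ℚ.- (c ℚ.* G m)      ≡⟨ cong (λ x → F m ℚ.+ ℚ.- x) (trans (ℚP.*-assoc (F m) (ℚ.1/ G m) (G m))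
                                        (trans (cong (F m ℚ.*_) (ℚP.*-inverseˡ (G m))) (ℚP.*-identityʳ (F m)))) ⟩
      F m ℚ.+ ℚ.- F m              ≡⟨ ℚP.+-inverseʳ (F m) ⟩
      0ℚ                           ∎
    m′ (inj₂ lt) → begin
      F m′ ℚ.+ (ℚ.- c) ℚ.* G m′    ≡⟨ cong₂ (λ x y → x ℚ.+ (ℚ.- c) ℚ.* y) (proj₂ leadF m′ lt) (proj₂ leadG m′ lt) ⟩
      0ℚ ℚ.+ (ℚ.- c) ℚ.* 0ℚ        ≡⟨ trans (ℚP.+-identityˡ _) (ℚP.*-zeroʳ (ℚ.- c)) ⟩
      0ℚ                           ∎
  where
  open ≡-Reasoning
  instance _ = ℚ.≢-nonZero (proj₁ leadG)
  c : ℚ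
  c = F m ℚ.* ℚ.1/ G m

combination : ∀ {n} {I : Set} → (I → Mon n → ℚ) → List (ℚ × I) → Mon n → ℚ
combination φ L m = Σℚ L (λ t → proj₁ t ℚ.* φ (proj₂ t) m)

module _ {n s : ℕ} {I : Set} (φ : I → Mon n → ℚ) (K : (Mon n → ℚ) → Set)
  (K-bounded : ∀ {F} → K F → ∀ i m → s ≤ lookup m i → F m ≡ 0ℚ)
  (K-reduce : ∀ {F} c i → K F → K (λ m → F m ℚ.+ (ℚ.- c) ℚ.* φ i m))
  (K-leading : ∀ {F m} → K F → IsLeading F m → ∃ λ i → IsLeading (φ i) m) where

  -- Subtracting the multiple of φ i that cancels the leading value leaves an element of K that is
  -- zero or has a smaller leading exponent.
  span-leading : ∀ F → K F → ∀ m → Acc _≺_ m → IsLeading F m → ∃ λ L → ∀ m′ → F m′ ≡ combination φ L m′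
  span-leading F KF m (acc smaller) lead with K-leading KF lead
  ... | i , leadᵢ with cancel-leading F (φ i) m lead leadᵢ
  ...   | c , vanish with leading-term s (λ m → F m ℚ.+ (ℚ.- c) ℚ.* φ i m) (K-bounded (K-reduce c i KF))
  ...     | inj₁ none = (c , i) ∷ [] , λ m′ → trans (restore (F m′) c (φ i m′)) (cong (c ℚ.* φ i m′ ℚ.+_) (none m′))
  ...     | inj₂ (m′ , lead′) with ≺-compare m′ m
  ...       | inj₂ (inj₁ m′≡m) = contradiction (vanish m′ (inj₁ (sym m′≡m))) (proj₁ lead′)
  ...       | inj₂ (inj₂ gt)   = contradiction (vanish m′ (inj₂ gt)) (proj₁ lead′)
  ...       | inj₁ lt with span-leading (λ m → F m ℚ.+ (ℚ.- c) ℚ.* φ i m) (K-reduce c i KF) m′ (smaller lt) lead′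
  ...         | L , F′≡ = (c , i) ∷ L , λ m″ → trans (restore (F m″) c (φ i m″)) (cong (c ℚ.* φ i m″ ℚ.+_) (F′≡ m″))

  span : ∀ F → K F → ∃ λ L → ∀ m → F m ≡ combination φ L m
  span F KF with leading-term s F (K-bounded KF)
  ... | inj₁ none       = [] , none
  ... | inj₂ (m , lead) = span-leading F KF m (≺-wellFounded m) lead

Σℚ-unique : ∀ {A B : Set} (g : A → B) (L : List A) (f : A → ℚ) {t} → Unique (map g L) → t ∈ L →
  (∀ t′ → t′ ∈ L → g t′ ≢ g t → f t′ ≡ 0ℚ) → Σℚ L f ≡ f t
Σℚ-unique g (t ∷ L) f (t∉ ∷ _) (here refl) h =
  trans (cong (f t ℚ.+_) (Σℚ-zero L λ t′ t′∈ → h t′ (there t′∈) (≢-sym (All.lookup t∉ (∈-map⁺ g t′∈))))) (ℚP.+-identityʳ (f t))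
Σℚ-unique g (t′ ∷ L) f (t′∉ ∷ uniq) (there t∈) h =
  trans (cong₂ ℚ._+_ (h t′ (here refl) (All.lookup t′∉ (∈-map⁺ g t∈))) (Σℚ-unique g L f uniq t∈ λ t″ t″∈ → h t″ (there t″∈))) (ℚP.+-identityˡ _)

module _ {n : ℕ} {I J : Set} (φ : I → Mon n → ℚ) (κ : I → Mon n) (leading : ∀ i → IsLeading (φ i) (κ i))
  (label : I → J) (κ-injective : ∀ i j → κ i ≡ κ j → label i ≡ label j) where

  Largest : List (ℚ × I) → ℚ × I → Set
  Largest L t = t ∈ L × proj₁ t ≢ 0ℚ × (∀ t′ → t′ ∈ L → proj₁ t′ ≢ 0ℚ → ¬ κ (proj₂ t) ≺ κ (proj₂ t′))

  largest : ∀ L → All (λ t → proj₁ t ≡ 0ℚ) L ⊎ ∃ (Largest L)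
  largest [] = inj₁ []
  largest (t ∷ L) with proj₁ t ℚP.≟ 0ℚ | largest L
  ... | yes eq | inj₁ zeros = inj₁ (eq ∷ zeros)
  ... | yes eq | inj₂ (u , u∈ , ne , max) = inj₂ (u , there u∈ , ne , λ
          { t′ (here refl) ne′ → contradiction eq ne′ ; t′ (there t′∈) → max t′ t′∈ })
  ... | no ne  | inj₁ zeros = inj₂ (t , here refl , ne , λ
          { t′ (here refl) _ → ≺-irrefl ; t′ (there t′∈) ne′ → contradiction (All.lookup zeros t′∈) ne′ })
  ... | no ne  | inj₂ (u , u∈ , ne-u , max) with ≺-compare (κ (proj₂ t)) (κ (proj₂ u))
  ...   | inj₁ lt        = inj₂ (u , there u∈ , ne-u , λ { t′ (here refl) _ → ≺-asym lt ; t′ (there t′∈) → max t′ t′∈ })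
  ...   | inj₂ (inj₁ eq) = inj₂ (u , there u∈ , ne-u , λ
          { t′ (here refl) _ gt → ≺-irrefl (subst (_≺ κ (proj₂ t)) (sym eq) gt) ; t′ (there t′∈) → max t′ t′∈ })
  ...   | inj₂ (inj₂ gt) = inj₂ (t , here refl , ne , λ
          { t′ (here refl) _ → ≺-irrefl ; t′ (there t′∈) ne′ lt → max t′ t′∈ ne′ (≺-trans gt lt) })

  -- At the largest leading exponent among the entries with nonzero coefficient only one entry
  -- survives. The label will be `blk`: distinctness of ordered set partitions is that of their
  -- block vectors, not of the records with their proofs.
  independent : ∀ L → Unique (map (label ∘ proj₂) L) → (∀ m → combination φ L m ≡ 0ℚ) → All (λ t → proj₁ t ≡ 0ℚ) L
  independent L uniq L≡0 with largest L
  ... | inj₁ zeros = zeros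
  ... | inj₂ (t , t∈ , ne , max) = contradiction
      (*-cancel-zero (φ (proj₂ t) m) (proj₁ t) (proj₁ (leading (proj₂ t))) (trans (ℚP.*-comm (φ (proj₂ t) m) (proj₁ t))
        (trans (sym (Σℚ-unique (label ∘ proj₂) L (λ t → proj₁ t ℚ.* φ (proj₂ t) m) uniq t∈ others)) (L≡0 m)))) ne
    where
    m = κ (proj₂ t)
    others : ∀ t′ → t′ ∈ L → label (proj₂ t′) ≢ label (proj₂ t) → proj₁ t′ ℚ.* φ (proj₂ t′) m ≡ 0ℚ
    others t′ t′∈ label≢ with proj₁ t′ ℚP.≟ 0ℚ
    ... | yes eq = trans (cong (ℚ._* φ (proj₂ t′) m) eq) (ℚP.*-zeroˡ (φ (proj₂ t′) m))
    ... | no ne′ with ≺-compare (κ (proj₂ t′)) m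
    ...   | inj₁ lt        = trans (cong (proj₁ t′ ℚ.*_) (proj₂ (leading (proj₂ t′)) m lt)) (ℚP.*-zeroʳ (proj₁ t′))
    ...   | inj₂ (inj₁ eq) = contradiction (κ-injective (proj₂ t′) (proj₂ t) eq) label≢
    ...   | inj₂ (inj₂ gt) = contradiction gt (max t′ t′∈ ne′)

*-cancel-≢0 : ∀ c x y → c ≢ 0ℚ → c ℚ.* x ≡ c ℚ.* y → x ≡ y
*-cancel-≢0 c x y c≢0 eq = x∙y⁻¹≈ε⇒x≈y x y (*-cancel-zero c (x ℚ.+ ℚ.- y) c≢0 (begin
  c ℚ.* (x ℚ.+ ℚ.- y)           ≡⟨ ℚP.*-distribˡ-+ c x (ℚ.- y) ⟩
  c ℚ.* x ℚ.+ c ℚ.* (ℚ.- y)     ≡⟨ cong₂ ℚ._+_ eq (sym (ℚP.neg-distribʳ-* c y)) ⟩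
  c ℚ.* y ℚ.+ ℚ.- (c ℚ.* y)     ≡⟨ ℚP.+-inverseʳ (c ℚ.* y) ⟩
  0ℚ                            ∎))
  where
  open ≡-Reasoning
  open Algebra.Properties.Group ℚP.+-0-group using (x∙y⁻¹≈ε⇒x≈y)

codeVec-injective : ∀ {n s} {α : Vec ℕ s} (σ τ : OP n s α) → codeVec σ ≡ codeVec τ → blk σ ≡ blk τ
codeVec-injective σ τ eq = code-injective σ τ λ x →
  trans (sym (VecP.lookup∘tabulate (code σ) x)) (trans (cong (λ v → lookup v x) eq) (VecP.lookup∘tabulate (code τ) x))

harmonic-leading : ∀ {n s} {α : Vec ℕ s} {F : Mon n → ℚ} {m} → Harmonic α F → IsLeading F m →
  ∃ λ (σ : OP n s α) → IsLeading (Δ σ) m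
harmonic-leading {m = m} H lead =
  let σ , eq = leading-is-code H lead
  in σ , subst (IsLeading (Δ σ)) (trans (VecP.tabulate-cong eq) (VecP.tabulate∘lookup m)) (Δ-leading σ)

theorem4p8 : (n k s : ℕ) (lam : Vec ℕ s) → 1 ≤ k → k ≤ n → IsPartition k lam
    → IsHarmonicBasis n s lam
theorem4p8 n k s lam 1≤k k≤n (_ , total) =
  (λ σ → Harmonic⇒InV lam≤n {g = δσ σ} (Δ-harmonic σ)) ,
  (λ L uniq L≈0 → independent Δ codeVec Δ-leading blk codeVec-injective L uniq λ m →
     trans (sym (D-lincomb L m)) (trans (cong (fac m ℚ.*_) (L≈0 m)) (ℚP.*-zeroʳ (fac m)))) ,
  (λ g g∈V →
     let L , g≡ = span Δ (Harmonic lam) Harmonic.pow (λ c σ H → Harmonic-+* (ℚ.- c) H (Δ-harmonic σ)) harmonic-leading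
                    (D g) (InV⇒Harmonic lam≤n {g = g} g∈V)
     in L , λ m → *-cancel-≢0 (fac m) (coeff g m) (coeff (lincomb L) m) (fac≢0 m) (trans (g≡ m) (sym (D-lincomb L m))))
  where
  -- Each part is at most k ≤ n, so no column of λ beyond the n-th is missed by the tails of the
  -- padded conjugate.
  lam≤n : ∀ b → lookup lam b ≤ n
  lam≤n b = ≤-trans (lookup≤sum lam b) (subst (_≤ n) (sym total) k≤n)
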